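{- Let $\Phi$ be an affine root system and $c$ a Coxeter element. A set $C\subseteq\Phi_c$ is a real $c$-cluster (a $c$-cluster not containing $\delta$) if and only if it is a maximal set of pairwise $c$-compatible roots in $\Phi_c^{\mathrm{re}}$.
   Context: Setup. $A=(a_{ij})$ symmetrizable Cartan matrix ($d_ia_{ij}=d_ja_{ji}$); $V$ with basis $\Pi=\{\alpha_1,\dots,\alpha_n\}$; $\alpha_i^\vee=d_i^{ -1}\alpha_i$; coordinates $[v:\alpha_i]$, $[v:\alpha_i^\vee]$; $[x]_+=\max(x,0)$; $K(\alpha_i^\vee,\alpha_j)=a_{ij}$; $s_i(v)=v-K(\alpha_i^\vee,v)\alpha_i$; $W=\langle s_i\rangle$; $\Phi$ the root system, $\Phi^+$ positive roots; $\beta^\vee=2\beta/K(\beta,\beta)$ for real $\beta$. Affine type: $K$ positive semidefinite, not definite, positive definite on spans of proper subsets of $\Pi$; imaginary roots are nonzero multiples of $\delta$ (positive imaginary root closest to $0$, spanning $\ker K$, $W$-fixed); $\delta^\vee$ is the positive imaginary root closest to $0$ of the root system of $A^T$ realized in $V$ with simple roots $\alpha_i^\vee$. $c=s_1\cdots s_n$ after reindexing. Choose $\gamma$ with $(c-1)\gamma=\delta$ and put $U_c=\{v:K(\gamma,v)=0\}$ (independent of choice); $\Upsilon_c=\Phi\cap U_c$; $\Pi_c$ the unique minimal subset of $\Upsilon_c\cap\Phi^+$ whose nonnegative span contains $\Upsilon_c\cap\Phi^+$. $\Upsilon_c$ is a union of irreducible components, each an affine type A root system with simple roots the elements of $\Pi_c$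 in it; the tube support $\mathrm{Supp}_{\Pi_c}(\beta)$ of a real $\beta\in\Upsilon_c$ is the set of elements of $\Pi_c$ with nonzero coefficient in its unique expansion in its component's simple roots (union for sets); component-full means containing all simple roots of some component. $\Phi_c^{T,\mathrm{re}}$ = positive real roots of $\Upsilon_c$ with non-component-full tube support; $\Phi_c=-\Pi\cup(\Phi^+\setminus U_c)\cup\Phi_c^{T,\mathrm{re}}\cup\{\delta\}$; $\Phi_c^{\mathrm{re}}=\Phi_c\setminus\{\delta\}$. Compatibility. For real $\alpha\in\Upsilon_c$, $\beta_j\in\Pi_c$ is adjacent to $\alpha$ if $\beta_j\in\mathrm{Supp}_{\Pi_c}(c\alpha)\cup\mathrm{Supp}_{\Pi_c}(c^{ -1}\alpha)$, $\beta_j\notin\mathrm{Supp}_{\Pi_c}(\alpha)$; $\mathrm{adj}(\alpha,\beta)$ counts elements of $\Pi_c$ adjacent to $\alpha$ in $\mathrm{Supp}_{\Pi_c}(\beta)$. For $\alpha,\beta\in\Phi_c$ (using $\delta^\vee$ when $\alpha=\delta$): $(\alpha\|\beta)_c^{\to}=-\sum_i[\alpha^\vee:\alpha_i^\vee][\beta:\alpha_i]-\sum_{1\le j<i\le n}a_{ij}[\alpha^\vee:\alpha_i^\vee]_+[\beta:\alpha_j]_+$, and $(\alpha\|\beta)_c^{\leftarrow}$ the same with second sum over $1\le i<j\le n$; $(\alpha\|\beta)_c=\mathrm{adj}(\alpha,\beta)$ if $\alpha,\beta\in\Phi_c^{T,\mathrm{re}}$ and $\mathrm{Supp}_{\Pi_c}(\{\alpha,\beta\})$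 is component-full, else $\max[(\alpha\|\beta)_c^{\to},(\alpha\|\beta)_c^{\leftarrow}]$. Distinct $\alpha,\beta\in\Phi_c$ are $c$-compatible iff $(\alpha\|\beta)_c=0$. A $c$-cluster is a maximal subset of $\Phi_c$ whose distinct elements are pairwise $c$-compatible. -}

module Defs where

open import Level using (0ℓ)
open import Data.Nat as ℕ using (ℕ; zero; suc)
open import Data.Integer as ℤ using (ℤ; +_)
open import Data.Rational as ℚ using (ℚ; 0ℚ; 1ℚ; _+_; _*_; _-_; -_; _⊔_; _≤_; _<_; ≢-nonZero)
open import Data.Rational.Properties using (_≟_)
open import Data.Fin as Fin using (Fin; toℕ)
open import Data.Fin.Subset using (Subset; _∈_; _∪_; _∩_; ∁; ∣_∣)
open import Data.Vec as Vec using (Vec; lookup; tabulate; zipWith; replicate)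
open import Data.Vec.Properties using (≡-dec)
open import Data.List as List using (List; []; _∷_; allFin; reverse)
open import Data.Product using (Σ; ∃; ∃₂; _×_; _,_)
open import Data.Sum using (_⊎_)
open import Data.Bool using (if_then_else_)
open import Relation.Nullary using (¬_; yes; no; ¬?)
open import Relation.Nullary.Decidable using (⌊_⌋)
open import Relation.Unary using (Pred; _⊆_)
open import Relation.Binary.PropositionalEquality using (_≡_; _≢_)
open import Relation.Binary.Construct.Closure.ReflexiveTransitive using (Star)

sumFin : ∀ {n} → (Fin n → ℚ) → ℚ
sumFin {zero}  f = 0ℚ
sumFin {suc n} f = f Fin.zero + sumFin (λ i → f (Fin.suc i))

pos : ℚ → ℚ
pos x = x ⊔ 0ℚ

-- total division (only ever used with nonzero divisor)
div : ℚ → ℚ → ℚ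
div p q with q ≟ 0ℚ
... | yes _  = 0ℚ
... | no q≢0 = ℚ._÷_ p q {{≢-nonZero q≢0}}

IsInt : ℚ → Set
IsInt q = ℚ.denominatorℕ q ≡ 1

-- The whole setup.
--   n      : rank; V = ℚ^n with basis Π = (α_1,…,α_n); a vector v : Vec ℚ n lists [v:α_i]
--   A      : Cartan matrix, d : symmetrizing constants
--   δ      : coordinates [δ:α_i];  δv : coordinates [δ^∨:α_i^∨]
--   γ      : a choice of γ with (c-1)γ = δ
--   m, P   : Π_c = {P_0,…,P_{m-1}}
module Setup (n : ℕ) (A : Fin n → Fin n → ℤ) (d : Fin n → ℚ)
             (δ δv γ : Vec ℚ n) (m : ℕ) (P : Vec (Vec ℚ n) m) where

  V : Set
  V = Vec ℚ n

  _!_ : V → Fin n → ℚ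
  v ! i = lookup v i

  a : Fin n → Fin n → ℚ
  a i j = A i j ℚ./ 1

  zeroV : V
  zeroV = replicate n 0ℚ

  e : Fin n → V
  e i = tabulate (λ k → if ⌊ k Fin.≟ i ⌋ then 1ℚ else 0ℚ)

  neg : V → V
  neg = Vec.map (λ x → - x)

  scale : ℚ → V → V
  scale q = Vec.map (q *_)

  K : V → V → ℚ
  K u v = sumFin (λ i → sumFin (λ j → d i * a i j * (u ! i) * (v ! j)))

  -- s_i(v) = v - K(α_i^∨,v) α_i,  K(α_i^∨, v) = Σ_j a_ij [v:α_j]
  s : Fin n → V → V
  s i v = tabulate (λ k → if ⌊ k Fin.≟ i ⌋
                           then (v ! i) - sumFin (λ j → a i j * (v ! j))
                           else v ! k)

  act : List (Fin n) → V → V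
  act []      v = v
  act (i ∷ w) v = s i (act w v)

  c : V → V
  c = act (allFin n)

  c⁻¹ : V → V
  c⁻¹ = act (reverse (allFin n))

  IsSymmetrizableCartan : Set
  IsSymmetrizableCartan =
    (∀ i → A i i ≡ + 2) ×
    (∀ i j → i ≢ j → A i j ℤ.≤ + 0) ×
    (∀ i j → A i j ≡ + 0 → A j i ≡ + 0) ×
    (∀ i → 0ℚ < d i) ×
    (∀ i j → d i * a i j ≡ d j * a j i)

  -- K positive semidefinite, not definite, positive definite on the
  -- span of every proper subset of Π
  IsAffine : Set
  IsAffine =
    (∀ u → 0ℚ ≤ K u u) ×
    (∃ λ u → u ≢ zeroV × K u u ≡ 0ℚ) ×
    (∀ u → u ≢ zeroV → (∃ λ i → u ! i ≡ 0ℚ) → 0ℚ < K u u)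

  -- δ: positive imaginary root closest to 0 (positive integer coordinates,
  -- spanning ker K, primitive)
  IsDelta : Set
  IsDelta =
    (∀ i → IsInt (δ ! i) × 0ℚ < δ ! i) ×
    (∀ i → sumFin (λ j → a i j * (δ ! j)) ≡ 0ℚ) ×
    (∀ t → (∀ i → IsInt (t * (δ ! i))) → IsInt t)

  -- δ^∨ for A^T, in coordinates w.r.t. the α_i^∨
  IsDeltaCheck : Set
  IsDeltaCheck =
    (∀ i → IsInt (δv ! i) × 0ℚ < δv ! i) ×
    (∀ i → sumFin (λ j → a j i * (δv ! j)) ≡ 0ℚ) ×
    (∀ t → (∀ i → IsInt (t * (δv ! i))) → IsInt t)

  IsGamma : Set
  IsGamma = c γ ≡ zipWith _+_ γ δ

  RealRoot : V → Set
  RealRoot v = ∃₂ λ (w : List (Fin n)) (i : Fin n) → act w (e i) ≡ v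

  ImagRoot : V → Set
  ImagRoot v = ∃ λ (k : ℤ) → k ≢ + 0 × v ≡ scale (k ℚ./ 1) δ

  Root : V → Set
  Root v = RealRoot v ⊎ ImagRoot v

  Positive : V → Set
  Positive v = (∀ i → 0ℚ ≤ v ! i) × v ≢ zeroV

  InU : V → Set
  InU v = K γ v ≡ 0ℚ

  InΥ⁺ : V → Set
  InΥ⁺ v = Root v × Positive v × InU v

  Pc : Fin m → V
  Pc j = lookup P j

  lincomb : (Fin m → ℚ) → V
  lincomb k = tabulate (λ i → sumFin (λ j → k j * (Pc j ! i)))

  IsΠc : Set
  IsΠc =
    (∀ j → InΥ⁺ (Pc j)) ×
    (∀ j k → Pc j ≡ Pc k → j ≡ k) ×
    (∀ v → InΥ⁺ v → ∃ λ (k : Fin m → ℚ) → (∀ j → 0ℚ ≤ k j) × lincomb k ≡ v) ×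
    (∀ j → ¬ (∀ v → InΥ⁺ v → ∃ λ (k : Fin m → ℚ) →
                 (∀ l → 0ℚ ≤ k l) × k j ≡ 0ℚ × lincomb k ≡ v))

  -- irreducible components of Υ_c: connected components of the
  -- (Cartan) graph on Π_c
  Link : Fin m → Fin m → Set
  Link j k = K (Pc j) (Pc k) ≢ 0ℚ

  SameComp : Fin m → Fin m → Set
  SameComp = Star Link

  -- S is the tube support of β: the set of elements of Π_c with nonzero
  -- coefficient in the expansion of β in the simple roots of one component
  HasSupp : V → Subset m → Set
  HasSupp β S = ∃ λ (k : Fin m → ℚ) →
    (∀ j l → k j ≢ 0ℚ → k l ≢ 0ℚ → SameComp j l) ×
    lincomb k ≡ β ×
    S ≡ tabulate (λ j → ⌊ ¬? (k j ≟ 0ℚ) ⌋)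

  CompFull : Subset m → Set
  CompFull S = ∃ λ j → ∀ l → SameComp j l → l ∈ S

  ΦTre : V → Set
  ΦTre v = RealRoot v × Positive v × InU v × (∀ S → HasSupp v S → ¬ CompFull S)

  Φc : V → Set
  Φc v = (∃ λ i → v ≡ neg (e i))
       ⊎ (Root v × Positive v × ¬ InU v)
       ⊎ ΦTre v
       ⊎ v ≡ δ

  Φcre : V → Set
  Φcre v = Φc v × v ≢ δ

  -- coordinates [α^∨ : α_i^∨]
  corootC : V → V
  corootC α with ≡-dec _≟_ α δ
  ... | yes _ = δv
  ... | no  _ = tabulate (λ i → d i * div ((+ 2 ℚ./ 1) * (α ! i)) (K α α))

  compR : V → V → ℚ
  compR α β =
    (- sumFin (λ i → (corootC α ! i) * (β ! i)))
    - sumFin (λ i → sumFin (λ j →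
        if ⌊ toℕ j ℕ.<? toℕ i ⌋
        then a i j * pos (corootC α ! i) * pos (β ! j) else 0ℚ))

  compL : V → V → ℚ
  compL α β =
    (- sumFin (λ i → (corootC α ! i) * (β ! i)))
    - sumFin (λ i → sumFin (λ j →
        if ⌊ toℕ i ℕ.<? toℕ j ⌋
        then a i j * pos (corootC α ! i) * pos (β ! j) else 0ℚ))

  TubeCase : V → V → Set
  TubeCase α β = ΦTre α × ΦTre β ×
    ∃₂ λ Sα Sβ → HasSupp α Sα × HasSupp β Sβ × CompFull (Sα ∪ Sβ)

  AdjZero : V → V → Set
  AdjZero α β = ∀ Sα Sβ S₊ S₋ → HasSupp α Sα → HasSupp β Sβ →
    HasSupp (c α) S₊ → HasSupp (c⁻¹ α) S₋ →
    ∣ Sβ ∩ ((S₊ ∪ S₋) ∩ ∁ Sα) ∣ ≡ 0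

  Compat : V → V → Set
  Compat α β = (TubeCase α β × AdjZero α β)
             ⊎ (¬ TubeCase α β × compR α β ⊔ compL α β ≡ 0ℚ)

  PairwiseCompat : Pred V 0ℓ → Set
  PairwiseCompat D = ∀ x y → D x → D y → x ≢ y → Compat x y

  MaximalCompatIn : Pred V 0ℓ → Pred V 0ℓ → Set₁
  MaximalCompatIn X C = C ⊆ X × PairwiseCompat C ×
    (∀ (D : Pred V 0ℓ) → C ⊆ D → D ⊆ X → PairwiseCompat D → D ⊆ C)

  IsCluster : Pred V 0ℓ → Set₁
  IsCluster = MaximalCompatIn Φc

{-# OPTIONS --safe #-}

-- Only the implication from right to left needs an argument.  If C is maximal in Φ_c^re but every root of C is
-- compatible with δ, then C consists of roots in tubes, and it suffices to find a real root b outside U_c with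
-- E(b,α) = 0 ≤ E(α,b) for all α ∈ C, where E is the Euler form of c: then C ∪ {b} contradicts maximality.
-- Folding the gallery of c = s_1 ⋯ s_n at γ by Hurwitz moves writes c as s_b s_b′ ∏ s_ρ with b′ parallel to b
-- modulo δ, ρ ∈ U_c and E(b,ρ) = 0.  As E(b,·) has constant sign on the positive roots of U_c, this makes it non-zero
-- on exactly one simple root of each component of Υ_c, and reflecting b in that simple root moves the position along
-- the c-orbit.  Compatible roots in a tube are arcs of such an orbit, and the element following an arc of maximal
-- size is avoided by all of them; so b can be moved to positions avoided by C.
module Submission where

open import Defs
open import Level using (0ℓ)
open import Data.Nat as ℕ using (ℕ; zero; suc; z≤n; s≤s)
import Data.Nat.Properties as ℕₚ
import Data.Nat.Coprimality as Coprimality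
open import Data.Integer as ℤ using (ℤ; -[1+_])
import Data.Integer.Properties as ℤₚ
open import Data.Rational as ℚ using (ℚ; mkℚ; 0ℚ; 1ℚ; _+_; _*_; _-_; -_; _⊔_; _≤_; _<_; _/_; ≢-nonZero)
open import Data.Rational.Properties
  using (_≟_; _<?_; _≤?_; ≤-refl; ≤-trans; ≤-reflexive; <⇒≤; ≤-<-trans; <-≤-trans; <-irrefl; <-cmp; <⇒≢; ≰⇒>;
    ≮⇒≥; ≤-antisym; ≤-total; *-assoc; *-comm; *-distribˡ-+; *-identityʳ; *-identityˡ; *-inverseˡ;
    *-monoʳ-<-pos; *-monoˡ-≤-nonNeg; *-zeroʳ; *-zeroˡ; +-assoc; +-comm; +-identityʳ; +-identityˡ; +-inverseʳ;
    +-inverseˡ; +-mono-<-≤; +-mono-≤; +-monoʳ-<; +-monoʳ-≤; +-monoˡ-<; +-monoˡ-≤; drop-*<*; fromℚᵘ-cong;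
    p≤p⊔q; p≤q⇒p⊔q≡q; p≤q⊔p; p≥q⇒p⊔q≡p; ↥p/↧p≡p)
open import Data.Rational.Solver
open import Data.Fin as Fin using (Fin; toℕ)
import Data.Fin.Properties as Finₚ
open import Data.Vec as Vec using (Vec; lookup; tabulate; zipWith)
import Data.Vec.Properties as Vecₚ
open import Data.List as List using (List; []; _∷_; _++_; allFin; reverse)
import Data.List.Properties as Listₚ
open import Data.List.Relation.Unary.All as All using (All; []; _∷_)
import Data.List.Relation.Unary.All.Properties as Allₚ
open import Data.List.Relation.Unary.AllPairs as AllPairs using (AllPairs; []; _∷_)
import Data.List.Relation.Unary.AllPairs.Properties as AllPairsₚ
open import Data.Product using (∃; ∃₂; _×_; _,_; proj₁; proj₂)
open import Data.Sum as Sum using (_⊎_; inj₁; inj₂)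
open import Data.Empty using (⊥; ⊥-elim)
open import Data.Unit using (⊤; tt)
open import Data.Bool using (if_then_else_; true; false)
open import Function using (_∘_; id)
open import Relation.Nullary using (¬_; yes; no; Dec)
open import Relation.Nullary.Decidable using (⌊_⌋)
open import Relation.Binary.Definitions using (tri<; tri≈; tri>)
open import Relation.Binary.PropositionalEquality using (_≡_; _≢_; refl; sym; trans; cong; cong₂; subst; subst₂; module ≡-Reasoning)
open import Relation.Unary using (Pred; _⊆_)
open import Function.Bundles using (_⇔_; mk⇔)
open +-*-Solver using (solve; _:+_; _:*_; _:-_; :-_; _:=_; con)

-- No classification of affine types enters. Real roots are handled through `RL`: integrality of a
-- vector and of its coroot is stable under reflections and already gives sign-coherence,
-- primitivity and finiteness modulo δ. The skewness E(cx, y) = -E(y, x) then governs the dynamics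
-- of c. For positive real roots the two one-sided degrees are values of E divided by `D`, up to
-- sign, so compatibility outside the tube case is a condition on E.
--
-- That b has a single position in each component comes from a relation: modulo δ, c P_j differs
-- from P_j by simple roots on which E(b, ·) vanishes, because E(b, ·) has constant sign on the
-- simple roots and kills each ρ. A linear relation modulo δ among simple roots cannot have both a
-- positive and a nonpositive coefficient in one component, and a second position would produce one.
--
-- C is an arbitrary predicate, so whether C avoids a given simple root need not be decidable. The
-- search for b therefore takes place under a double negation, which suffices because the goal is a
-- contradiction.

infixr 1 _■_
_■_ : ∀ {A : Set} {x y z : A} → x ≡ y → y ≡ z → x ≡ z
_■_ = trans

-- Order and arithmetic of the rationals.

2ℚ : ℚ
2ℚ = ℤ.+ 2 / 1

0<1 : 0ℚ < 1ℚ
0<1 = ℚ.*<* (ℤ.+<+ (s≤s z≤n))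

0<2 : 0ℚ < 2ℚ
0<2 = ℚ.*<* (ℤ.+<+ (s≤s z≤n))

0≤+ : ∀ {x y} → 0ℚ ≤ x → 0ℚ ≤ y → 0ℚ ≤ x + y
0≤+ p q = +-mono-≤ p q

0<+ : ∀ {x y} → 0ℚ < x → 0ℚ ≤ y → 0ℚ < x + y
0<+ p q = +-mono-<-≤ p q

0≤* : ∀ {x y} → 0ℚ ≤ x → 0ℚ ≤ y → 0ℚ ≤ x * y
0≤* {x} {y} p q = ≤-trans (≤-reflexive (sym (*-zeroʳ x))) (*-monoˡ-≤-nonNeg x {{ℚ.nonNegative p}} q)

0<* : ∀ {x y} → 0ℚ < x → 0ℚ < y → 0ℚ < x * y
0<* {x} {y} p q = ≤-<-trans (≤-reflexive (sym (*-zeroʳ x))) (*-monoʳ-<-pos x {{ℚ.positive p}} q)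

0≤- : ∀ {x y} → x ≤ y → 0ℚ ≤ y - x
0≤- {x} {y} p = ≤-trans (≤-reflexive (sym (+-inverseʳ x))) (+-monoˡ-≤ (- x) p)

0<- : ∀ {x y} → x < y → 0ℚ < y - x
0<- {x} {y} p = ≤-<-trans (≤-reflexive (sym (+-inverseʳ x))) (+-monoˡ-< (- x) p)

by≤ : ∀ {x y z} → 0ℚ ≤ z → x + z ≡ y → x ≤ y
by≤ {x} {y} {z} p e = subst₂ _≤_ (+-identityʳ x) e (+-monoʳ-≤ x p)

by< : ∀ {x y z} → 0ℚ < z → x + z ≡ y → x < y
by< {x} {y} {z} p e = subst₂ _<_ (+-identityʳ x) e (+-monoʳ-< x p)

0≤-⇒≤ : ∀ {x y} → 0ℚ ≤ y - x → x ≤ y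
0≤-⇒≤ {x} {y} p = by≤ p (solve 2 (λ x y → x :+ (y :- x) := y) refl x y)

0≤-neg : ∀ {x} → x ≤ 0ℚ → 0ℚ ≤ - x
0≤-neg {x} p = subst (0ℚ ≤_) (+-identityˡ (- x)) (0≤- p)

0<-neg : ∀ {x} → x < 0ℚ → 0ℚ < - x
0<-neg {x} p = subst (0ℚ <_) (+-identityˡ (- x)) (0<- p)

neg-≤0 : ∀ {x} → 0ℚ ≤ x → - x ≤ 0ℚ
neg-≤0 {x} p = by≤ p (+-inverseˡ x)

neg-<0 : ∀ {x} → 0ℚ < x → - x < 0ℚ
neg-<0 {x} p = by< p (+-inverseˡ x)

≤0-neg : ∀ {x} → 0ℚ ≤ - x → x ≤ 0ℚ
≤0-neg {x} p = by≤ p (+-inverseʳ x)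

<0-neg : ∀ {x} → 0ℚ < - x → x < 0ℚ
<0-neg {x} p = by< p (+-inverseʳ x)

pos⇒≢0 : ∀ {x} → 0ℚ < x → x ≢ 0ℚ
pos⇒≢0 p e = <-irrefl (sym e) p

≤∧≢⇒< : ∀ {x} → 0ℚ ≤ x → x ≢ 0ℚ → 0ℚ < x
≤∧≢⇒< {x} p ne with <-cmp 0ℚ x
... | tri< q _ _ = q
... | tri≈ _ e _ = ⊥-elim (ne (sym e))
... | tri> _ _ q = ⊥-elim (<-irrefl refl (≤-<-trans p q))

<⇒≱' : ∀ {x y} → x < y → y ≤ x → ⊥
<⇒≱' p q = <-irrefl refl (<-≤-trans p q)

sq≥0 : ∀ x → 0ℚ ≤ x * x
sq≥0 x with ≤-total 0ℚ x
... | inj₁ p = 0≤* p p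
... | inj₂ p = subst (0ℚ ≤_) (solve 1 (λ x → (:- x) :* (:- x) := x :* x) refl x) (0≤* (0≤-neg p) (0≤-neg p))

div-* : ∀ p q → q ≢ 0ℚ → div p q * q ≡ p
div-* p q ne with q ≟ 0ℚ
... | yes e = ⊥-elim (ne e)
... | no ne' = *-assoc p _ q ■ cong (p *_) (*-inverseˡ q {{≢-nonZero ne'}}) ■ *-identityʳ p

abstract
  -- The value at 0 is 0, inherited from `div`, so `coef` and `refl-by` are total; the defining
  -- equation always comes with a proof of nonvanishing.
  inv : ℚ → ℚ
  inv = div 1ℚ

  inv-* : ∀ {x} → x ≢ 0ℚ → inv x * x ≡ 1ℚ
  inv-* {x} = div-* 1ℚ x

*≡0 : ∀ {x y} → x * y ≡ 0ℚ → x ≢ 0ℚ → y ≡ 0ℚ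
*≡0 {x} {y} e ne = begin
  y                  ≡⟨ sym (*-identityˡ y) ⟩
  1ℚ * y             ≡⟨ cong (_* y) (sym (inv-* ne)) ⟩
  inv x * x * y      ≡⟨ *-assoc (inv x) x y ⟩
  inv x * (x * y)    ≡⟨ cong (inv x *_) e ⟩
  inv x * 0ℚ         ≡⟨ *-zeroʳ (inv x) ⟩
  0ℚ ∎
  where open ≡-Reasoning

*≢0 : ∀ {x y} → x ≢ 0ℚ → y ≢ 0ℚ → x * y ≢ 0ℚ
*≢0 p q e = q (*≡0 e p)

*-cancel : ∀ {x y z} → x ≢ 0ℚ → x * y ≡ x * z → y ≡ z
*-cancel {x} {y} {z} ne e = begin
  y           ≡⟨ solve 2 (λ y z → y := (y :- z) :+ z) refl y z ⟩
  (y - z) + z ≡⟨ cong (_+ z) (*≡0 {x} (solve 3 (λ x y z → x :* (y :- z) := x :* y :- x :* z) refl x y z ■ cong (_- x * z) e ■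
      +-inverseʳ (x * z)) ne) ⟩
  0ℚ + z      ≡⟨ +-identityˡ z ⟩
  z ∎
  where open ≡-Reasoning

0<*⇒0< : ∀ {x y} → 0ℚ < x → 0ℚ < x * y → 0ℚ < y
0<*⇒0< {x} {y} p q with 0ℚ <? y
... | yes r = r
... | no r = ⊥-elim (<⇒≱' q (≤0-neg (subst (0ℚ ≤_) (solve 2 (λ x y → x :* (:- y) := :- (x :* y)) refl x y)
    (0≤* (<⇒≤ p) (0≤-neg (≮⇒≥ r))))))

0≤*⇒0≤ : ∀ {x y} → 0ℚ < x → 0ℚ ≤ x * y → 0ℚ ≤ y
0≤*⇒0≤ {x} {y} p q with 0ℚ ≤? y
... | yes r = r
... | no r = ⊥-elim (<⇒≱' (<0-neg (subst (0ℚ <_) (solve 2 (λ x y → x :* (:- y) := :- (x :* y)) refl x y)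
    (0<* p (0<-neg (≰⇒> r))))) q)

inv-pos : ∀ {x} → 0ℚ < x → 0ℚ < inv x
inv-pos {x} p = 0<*⇒0< p (subst (0ℚ <_) (sym (*-comm x (inv x) ■ inv-* (pos⇒≢0 p))) 0<1)

+≡0 : ∀ {x y} → 0ℚ ≤ x → 0ℚ ≤ y → x + y ≡ 0ℚ → x ≡ 0ℚ
+≡0 {x} {y} p q e = ≤-antisym (by≤ q e) p

+≡0ʳ : ∀ {x y} → 0ℚ ≤ x → 0ℚ ≤ y → x + y ≡ 0ℚ → y ≡ 0ℚ
+≡0ʳ {x} {y} p q e = +≡0 q p (+-comm y x ■ e)

pos-id : ∀ {x} → 0ℚ ≤ x → pos x ≡ x
pos-id p = p≥q⇒p⊔q≡p p

pos≥0 : ∀ x → 0ℚ ≤ pos x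
pos≥0 x = p≤q⊔p x 0ℚ

pos-neg : ∀ {x} → x ≤ 0ℚ → pos x ≡ 0ℚ
pos-neg p = p≤q⇒p⊔q≡q p

pos-split : ∀ x → x ≡ pos x + (- 1ℚ) * pos (- x)
pos-split x with ≤-total 0ℚ x
... | inj₁ p = sym (cong₂ (λ u v → u + (- 1ℚ) * v) (pos-id p) (pos-neg (neg-≤0 p)) ■
    solve 1 (λ x → x :+ con (- 1ℚ) :* con 0ℚ := x) refl x)
... | inj₂ p = sym (cong₂ (λ u v → u + (- 1ℚ) * v) (pos-neg p) (pos-id (0≤-neg p)) ■
    solve 1 (λ x → con 0ℚ :+ con (- 1ℚ) :* (:- x) := x) refl x)

pos-disjoint : ∀ x → pos x ≡ 0ℚ ⊎ pos (- x) ≡ 0ℚ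
pos-disjoint x with ≤-total 0ℚ x
... | inj₁ p = inj₂ (pos-neg (neg-≤0 p))
... | inj₂ p = inj₁ (pos-neg p)

-- Integers inside ℚ

Int : ℚ → Set
Int q = ∃ λ (z : ℤ) → q ≡ z / 1

-- `z / 1` is normalised through a gcd and is stuck on a variable `z`; this is the same number in
-- normal form, on which order and arithmetic compute.
mkℤ : ℤ → ℚ
mkℤ z = mkℚ z 0 (Coprimality.sym (Coprimality.1-coprimeTo ℤ.∣ z ∣))

/1≡mkℤ : ∀ z → z / 1 ≡ mkℤ z
/1≡mkℤ z = ↥p/↧p≡p (mkℤ z)

IsInt⇒Int : ∀ q → IsInt q → Int q
IsInt⇒Int (mkℚ n zero c) e = n , sym (/1≡mkℤ n)

private
  +-/1 : ∀ z w → z / 1 + w / 1 ≡ (z ℤ.+ w) / 1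
  +-/1 z w = cong₂ _+_ (/1≡mkℤ z) (/1≡mkℤ w) ■
    cong (_/ 1) (cong₂ ℤ._+_ (ℤₚ.*-identityʳ z) (ℤₚ.*-identityʳ w))

  *-/1 : ∀ z w → z / 1 * (w / 1) ≡ (z ℤ.* w) / 1
  *-/1 z w = cong₂ _*_ (/1≡mkℤ z) (/1≡mkℤ w)

Int-0 : Int 0ℚ
Int-0 = ℤ.+ 0 , refl

Int-1 : Int 1ℚ
Int-1 = ℤ.+ 1 , refl

Int-+ : ∀ {x y} → Int x → Int y → Int (x + y)
Int-+ (z , refl) (w , refl) = z ℤ.+ w , +-/1 z w

Int-* : ∀ {x y} → Int x → Int y → Int (x * y)
Int-* (z , refl) (w , refl) = z ℤ.* w , *-/1 z w

Int-neg : ∀ {x} → Int x → Int (- x)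
Int-neg {x} p = subst Int (solve 1 (λ x → con (- 1ℚ) :* x := :- x) refl x) (Int-* (ℤ.- (ℤ.+ 1) , refl) p)

Int-- : ∀ {x y} → Int x → Int y → Int (x - y)
Int-- p q = Int-+ p (Int-neg q)

-- The gap between 0 and 1 behind every descent and every integrality bound below.
Int-pos : ∀ {x} → Int x → 0ℚ < x → 1ℚ ≤ x
Int-pos (z , refl) p = subst (1ℚ ≤_) (sym e) (ℚ.*≤* (lem (drop-*<* (subst (0ℚ <_) e p))))
  where
  e = /1≡mkℤ z
  lem : ℤ.+ 0 ℤ.* ℤ.+ 1 ℤ.< z ℤ.* ℤ.+ 1 → ℤ.+ 1 ℤ.* ℤ.+ 1 ℤ.≤ z ℤ.* ℤ.+ 1
  lem q = ℤₚ.≤-trans (ℤₚ.≤-reflexive refl) (ℤₚ.i<j⇒suc[i]≤j q)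

fromℕ : ℕ → ℚ
fromℕ k = ℤ.+ k / 1

fromℕ-suc : ∀ k → fromℕ (suc k) ≡ 1ℚ + fromℕ k
fromℕ-suc k = sym (+-/1 (ℤ.+ 1) (ℤ.+ k))

Int-fromℕ : ∀ k → Int (fromℕ k)
Int-fromℕ k = ℤ.+ k , refl

0≤fromℕ : ∀ k → 0ℚ ≤ fromℕ k
0≤fromℕ zero = ≤-refl
0≤fromℕ (suc k) = subst (0ℚ ≤_) (sym (fromℕ-suc k)) (0≤+ (<⇒≤ 0<1) (0≤fromℕ k))

0<fromℕsuc : ∀ k → 0ℚ < fromℕ (suc k)
0<fromℕsuc k = subst (0ℚ <_) (sym (fromℕ-suc k)) (0<+ 0<1 (0≤fromℕ k))

fromℕ-+ : ∀ k l → fromℕ (k ℕ.+ l) ≡ fromℕ k + fromℕ l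
fromℕ-+ k l = sym (+-/1 (ℤ.+ k) (ℤ.+ l))

Int-nonneg : ∀ {x} → Int x → 0ℚ ≤ x → ∃ λ k → x ≡ fromℕ k
Int-nonneg (ℤ.+ k , e) p = k , e
Int-nonneg (-[1+ k ] , refl) p = ⊥-elim (<⇒≱' (ℚ.*<* ℤ.-<+) (subst (0ℚ ≤_) (/1≡mkℤ -[1+ k ]) p))

arch : ∀ q → ∃ λ k → q ≤ fromℕ k
arch q@(mkℚ (ℤ.+ n) d c) = n , subst (q ≤_) (sym (/1≡mkℤ (ℤ.+ n)))
  (ℚ.*≤* (subst₂ ℤ._≤_ (ℤₚ.pos-* n 1) (ℤₚ.pos-* n (suc d)) (ℤ.+≤+ (ℕₚ.*-monoʳ-≤ n (s≤s z≤n)))))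
arch (mkℚ -[1+ n ] d c) = 0 , <⇒≤ (ℚ.*<* ℤ.-<+)

arch* : ∀ {t} q → 0ℚ < t → ∃ λ k → q < fromℕ k * t
arch* {t} q p with arch (q * inv t)
... | k , h = suc k , by< (0<+ p (0≤* (<⇒≤ p) (0≤- h))) eq
  where
  eq : q + (t + t * (fromℕ k - q * inv t)) ≡ fromℕ (suc k) * t
  eq = solve 4 (λ q t k i → q :+ (t :+ t :* (k :- q :* i)) := q :* (con 1ℚ :- i :* t) :+ (con 1ℚ :+ k) :* t) refl q t (fromℕ k)
      (inv t) ■
    cong₂ (λ u w → q * (1ℚ - u) + w * t) (inv-* (pos⇒≢0 p)) (sym (fromℕ-suc k)) ■
        solve 3 (λ q k t → q :* (con 1ℚ :- con 1ℚ) :+ k :* t := k :* t) refl q (fromℕ (suc k)) t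

arch-suc : ∀ q → ∃ λ k → q < fromℕ (suc k)
arch-suc q with arch q
... | k , h = k , ≤-<-trans h (by< {fromℕ k} 0<1 (+-comm (fromℕ k) 1ℚ ■ sym (fromℕ-suc k)))

-- The step of a descent on an integer-valued measure bounded by a natural number.
Int-step : ∀ {x y} k → Int x → Int y → y < x → x < fromℕ (suc k) → y < fromℕ k
Int-step {x} {y} k p q r s = by< (0<+ (0<- s) (0≤- (Int-pos (Int-- p q) (0<- r))))
    (cong (λ u → y + (u - x + (x - y - 1ℚ))) (fromℕ-suc k) ■
    solve 3 (λ x y k → y :+ (con 1ℚ :+ k :- x :+ (x :- y :- con 1ℚ)) := k) refl x y (fromℕ k))

denom : ∀ q → ∃ λ k → Int (fromℕ (suc k) * q)
denom q@(mkℚ n d c) = d , n , (begin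
  fromℕ (suc d) * q          ≡⟨ cong₂ _*_ (/1≡mkℤ (ℤ.+ suc d)) refl ⟩
  (ℤ.+ suc d ℤ.* n) / (1 ℕ.* suc d) ≡⟨ fromℚᵘ-cong {mkℚᵘ (ℤ.+ suc d ℤ.* n) (d ℕ.+ 0)} {mkℚᵘ n 0} (ℚᵘ.*≡* lem) ⟩
  n / 1 ∎)
  where
  open ≡-Reasoning
  open import Data.Rational.Unnormalised as ℚᵘ using (mkℚᵘ)
  lem : (ℤ.+ suc d ℤ.* n) ℤ.* ℤ.+ 1 ≡ n ℤ.* ℤ.+ suc (d ℕ.+ 0)
  lem = ℤₚ.*-identityʳ _ ■ ℤₚ.*-comm (ℤ.+ suc d) n ■ cong (λ u → n ℤ.* ℤ.+ suc u) (sym (ℕₚ.+-identityʳ d))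

-- Sums


sum-cong : ∀ {n} {f g : Fin n → ℚ} → (∀ i → f i ≡ g i) → sumFin f ≡ sumFin g
sum-cong {zero} h = refl
sum-cong {suc n} h = cong₂ _+_ (h Fin.zero) (sum-cong (h ∘ Fin.suc))

sum-0 : ∀ n → sumFin {n} (λ _ → 0ℚ) ≡ 0ℚ
sum-0 zero = refl
sum-0 (suc n) = +-identityˡ _ ■ sum-0 n

sum-+ : ∀ {n} (f g : Fin n → ℚ) → sumFin (λ i → f i + g i) ≡ sumFin f + sumFin g
sum-+ {zero} f g = refl
sum-+ {suc n} f g = cong (f Fin.zero + g Fin.zero +_) (sum-+ (f ∘ Fin.suc) (g ∘ Fin.suc)) ■
  solve 4 (λ a b c d → a :+ b :+ (c :+ d) := a :+ c :+ (b :+ d)) refl (f Fin.zero) (g Fin.zero) (sumFin (f ∘ Fin.suc))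
      (sumFin (g ∘ Fin.suc))

sum-* : ∀ {n} q (f : Fin n → ℚ) → sumFin (λ i → q * f i) ≡ q * sumFin f
sum-* {zero} q f = sym (*-zeroʳ q)
sum-* {suc n} q f = cong (q * f Fin.zero +_) (sum-* q (f ∘ Fin.suc)) ■
    sym (*-distribˡ-+ q (f Fin.zero) (sumFin (f ∘ Fin.suc)))

sum-*ʳ : ∀ {n} q (f : Fin n → ℚ) → sumFin (λ i → f i * q) ≡ sumFin f * q
sum-*ʳ q f = sum-cong (λ i → *-comm (f i) q) ■ sum-* q f ■ *-comm q (sumFin f)

sum-neg : ∀ {n} (f : Fin n → ℚ) → sumFin (λ i → - f i) ≡ - sumFin f
sum-neg f = sum-cong (λ i → solve 1 (λ x → :- x := con (- 1ℚ) :* x) refl (f i)) ■ sum-* (- 1ℚ) f ■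
    solve 1 (λ x → con (- 1ℚ) :* x := :- x) refl (sumFin f)

sum-swap : ∀ {m n} (f : Fin m → Fin n → ℚ) → sumFin (λ i → sumFin (f i)) ≡ sumFin (λ j → sumFin (λ i → f i j))
sum-swap {zero} {n} f = sym (sum-0 n)
sum-swap {suc m} f = cong (sumFin (f Fin.zero) +_) (sum-swap (f ∘ Fin.suc)) ■
    sym (sum-+ (f Fin.zero) (λ j → sumFin (λ i → f (Fin.suc i) j)))

sum-≥0 : ∀ {n} {f : Fin n → ℚ} → (∀ i → 0ℚ ≤ f i) → 0ℚ ≤ sumFin f
sum-≥0 {zero} h = ≤-refl
sum-≥0 {suc n} h = 0≤+ (h Fin.zero) (sum-≥0 (h ∘ Fin.suc))

sum≡0⇒ : ∀ {n} {f : Fin n → ℚ} → (∀ i → 0ℚ ≤ f i) → sumFin f ≡ 0ℚ → ∀ i → f i ≡ 0ℚ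
sum≡0⇒ {suc n} h e Fin.zero = +≡0 (h Fin.zero) (sum-≥0 (h ∘ Fin.suc)) e
sum≡0⇒ {suc n} h e (Fin.suc i) = sum≡0⇒ (h ∘ Fin.suc) (+≡0ʳ (h Fin.zero) (sum-≥0 (h ∘ Fin.suc)) e) i

sum-pos⇒ : ∀ {n} (f : Fin n → ℚ) → 0ℚ < sumFin f → ∃ λ i → 0ℚ < f i
sum-pos⇒ {zero} f p = ⊥-elim (<-irrefl refl p)
sum-pos⇒ {suc n} f p with 0ℚ <? f Fin.zero
... | yes q = Fin.zero , q
... | no q with sum-pos⇒ (f ∘ Fin.suc) (<-≤-trans p (subst (f Fin.zero + sumFin (f ∘ Fin.suc) ≤_) (+-identityˡ _)
    (+-monoˡ-≤ (sumFin (f ∘ Fin.suc)) (≮⇒≥ q))))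
... | i , r = Fin.suc i , r

sum-≢0⇒ : ∀ {n} (f : Fin n → ℚ) → sumFin f ≢ 0ℚ → ∃ λ i → f i ≢ 0ℚ
sum-≢0⇒ {zero} f p = ⊥-elim (p refl)
sum-≢0⇒ {suc n} f p with f Fin.zero ≟ 0ℚ
... | no q = Fin.zero , q
... | yes q with sum-≢0⇒ (f ∘ Fin.suc) (λ e → p (cong₂ _+_ q e ■ refl))
... | i , r = Fin.suc i , r

sum-Int : ∀ {n} {f : Fin n → ℚ} → (∀ i → Int (f i)) → Int (sumFin f)
sum-Int {zero} h = Int-0
sum-Int {suc n} h = Int-+ (h Fin.zero) (sum-Int (h ∘ Fin.suc))

kron : ∀ {n} → Fin n → Fin n → ℚ
kron i k = if ⌊ k Fin.≟ i ⌋ then 1ℚ else 0ℚ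

kron-refl : ∀ {n} (i : Fin n) → kron i i ≡ 1ℚ
kron-refl i with i Fin.≟ i
... | yes _ = refl
... | no p = ⊥-elim (p refl)

kron-≢ : ∀ {n} {i k : Fin n} → k ≢ i → kron i k ≡ 0ℚ
kron-≢ {i = i} {k} p with k Fin.≟ i
... | yes q = ⊥-elim (p q)
... | no _ = refl

sum-only : ∀ {n} (f : Fin n → ℚ) i → (∀ k → k ≢ i → f k ≡ 0ℚ) → sumFin f ≡ f i
sum-only {suc n} f Fin.zero h = cong (f Fin.zero +_) (sum-cong (λ k → h (Fin.suc k) (λ ())) ■ sum-0 n) ■ +-identityʳ _
sum-only {suc n} f (Fin.suc i) h = cong₂ _+_ (h Fin.zero (λ ()))
    (sum-only (f ∘ Fin.suc) i (λ k p → h (Fin.suc k) (p ∘ Finₚ.suc-injective))) ■ +-identityˡ _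

sum-kron : ∀ {n} (f : Fin n → ℚ) i → sumFin (λ k → kron i k * f k) ≡ f i
sum-kron f i = sum-only _ i (λ k p → cong (_* f k) (kron-≢ p) ■ *-zeroˡ (f k)) ■ cong (_* f i) (kron-refl i) ■
    *-identityˡ (f i)

record AffineData : Set where
  field
    n : ℕ
    A : Fin n → Fin n → ℤ
    d : Fin n → ℚ
    δ δv γ : Vec ℚ n
    m : ℕ
    P : Vec (Vec ℚ n) m
  open Setup n A d δ δv γ m P public
  field
    cartan : IsSymmetrizableCartan
    affine : IsAffine
    isδ    : IsDelta
    isγ    : IsGamma
    isΠc   : IsΠc

-- Vectors in root coordinates and the Euler form.

module Lattice (H : AffineData) where
  open AffineData H

  infixl 6 _⊹_
  infixr 8 _∙_

  abstract
    _⊹_ : V → V → V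
    _⊹_ = zipWith _+_

    _∙_ : ℚ → V → V
    _∙_ = scale

    !-⊹ : ∀ u v i → (u ⊹ v) ! i ≡ u ! i + v ! i
    !-⊹ u v i = Vecₚ.lookup-zipWith _+_ i u v

    !-∙ : ∀ q v i → (q ∙ v) ! i ≡ q * v ! i
    !-∙ q v i = Vecₚ.lookup-map i (q *_) v

    ⊹-def : ∀ u v → u ⊹ v ≡ zipWith _+_ u v
    ⊹-def u v = refl

    ∙-def : ∀ q v → q ∙ v ≡ scale q v
    ∙-def q v = refl

  !-neg : ∀ v i → neg v ! i ≡ - (v ! i)
  !-neg v i = Vecₚ.lookup-map i (λ x → - x) v

  !-zero : ∀ i → zeroV ! i ≡ 0ℚ
  !-zero i = Vecₚ.lookup-replicate i 0ℚ

  !-e : ∀ i k → e i ! k ≡ kron i k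
  !-e i k = Vecₚ.lookup∘tabulate (kron i) k

  !-lin : ∀ u q v i → (u ⊹ q ∙ v) ! i ≡ u ! i + q * v ! i
  !-lin u q v i = !-⊹ u (q ∙ v) i ■ cong (u ! i +_) (!-∙ q v i)

  vext : ∀ {u v : V} → (∀ i → u ! i ≡ v ! i) → u ≡ v
  vext {u} {v} h = sym (Vecₚ.tabulate∘lookup u) ■ Vecₚ.tabulate-cong h ■ Vecₚ.tabulate∘lookup v

  neg≡ : ∀ v → neg v ≡ (- 1ℚ) ∙ v
  neg≡ v = vext (λ i → !-neg v i ■ solve 1 (λ x → :- x := con (- 1ℚ) :* x) refl (v ! i) ■ sym (!-∙ (- 1ℚ) v i))

  0∙ : ∀ v → 0ℚ ∙ v ≡ zeroV
  0∙ v = vext (λ i → !-∙ 0ℚ v i ■ *-zeroˡ (v ! i) ■ sym (!-zero i))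

  ∙0 : ∀ q → q ∙ zeroV ≡ zeroV
  ∙0 q = vext (λ i → !-∙ q zeroV i ■ cong (q *_) (!-zero i) ■ *-zeroʳ q ■ sym (!-zero i))

  1∙ : ∀ v → 1ℚ ∙ v ≡ v
  1∙ v = vext (λ i → !-∙ 1ℚ v i ■ *-identityˡ (v ! i))

  ∙∙ : ∀ p q v → p ∙ (q ∙ v) ≡ (p * q) ∙ v
  ∙∙ p q v = vext (λ i → !-∙ p (q ∙ v) i ■ cong (p *_) (!-∙ q v i) ■ sym (*-assoc p q (v ! i)) ■ sym (!-∙ (p * q) v i))

  ⊹0 : ∀ v → v ⊹ zeroV ≡ v
  ⊹0 v = vext (λ i → !-⊹ v zeroV i ■ cong (v ! i +_) (!-zero i) ■ +-identityʳ (v ! i))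

  0⊹ : ∀ v → zeroV ⊹ v ≡ v
  0⊹ v = vext (λ i → !-⊹ zeroV v i ■ cong (_+ v ! i) (!-zero i) ■ +-identityˡ (v ! i))

  ⊹0∙ : ∀ v w → v ⊹ 0ℚ ∙ w ≡ v
  ⊹0∙ v w = cong (v ⊹_) (0∙ w) ■ ⊹0 v

  ⊹∙⊹∙ : ∀ u p q v → u ⊹ p ∙ v ⊹ q ∙ v ≡ u ⊹ (p + q) ∙ v
  ⊹∙⊹∙ u p q v = vext (λ i → !-lin (u ⊹ p ∙ v) q v i ■ cong (_+ q * v ! i) (!-lin u p v i) ■
    solve 4 (λ u p q v → u :+ p :* v :+ q :* v := u :+ (p :+ q) :* v) refl (u ! i) p q (v ! i) ■ sym (!-lin u (p + q) v i))

  _≟ⱽ_ : (u v : V) → Dec (u ≡ v)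
  _≟ⱽ_ = Vecₚ.≡-dec _≟_

  ⊹-cancel : ∀ {u p v} → u ⊹ p ∙ v ≡ zeroV → u ≡ (- p) ∙ v
  ⊹-cancel {u} {p} {v} h = vext (λ i → solve 3 (λ u p v → u := u :+ p :* v :+ (:- p) :* v) refl (u ! i) p (v ! i) ■
    cong (_+ (- p) * v ! i) (sym (!-lin u p v i) ■ cong (_! i) h ■ !-zero i) ■ +-identityˡ _ ■ sym (!-∙ (- p) v i))

  -- The Euler form: twice its symmetrization is K, and its ordering is that of c.

  low : Fin n → Fin n → ℚ
  low i j = if ⌊ toℕ j ℕ.<? toℕ i ⌋ then a i j else 0ℚ

  euler : Fin n → Fin n → ℚ
  euler i j = d i * (kron i j + low i j)

  kron-sym : ∀ {k} (i j : Fin k) → kron i j ≡ kron j i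
  kron-sym i j with i Fin.≟ j | j Fin.≟ i
  ... | yes _ | yes _ = refl
  ... | no _ | no _ = refl
  ... | yes p | no q = ⊥-elim (q (sym p))
  ... | no p | yes q = ⊥-elim (p (sym q))

  private
    low-< : ∀ {i j} → toℕ i ℕ.≤ toℕ j → low i j ≡ 0ℚ
    low-< {i} {j} p with toℕ j ℕ.<? toℕ i
    ... | yes q = ⊥-elim (ℕₚ.<⇒≱ q p)
    ... | no _ = refl

    low-> : ∀ {i j} → toℕ j ℕ.< toℕ i → low i j ≡ a i j
    low-> {i} {j} p with toℕ j ℕ.<? toℕ i
    ... | yes q = refl
    ... | no q = ⊥-elim (q p)

  d>0 : ∀ i → 0ℚ < d i
  d>0 = proj₁ (proj₂ (proj₂ (proj₂ cartan)))

  da≡ : ∀ i j → d i * a i j ≡ d j * a j i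
  da≡ = proj₂ (proj₂ (proj₂ (proj₂ cartan)))

  a-diag : ∀ i → a i i ≡ 2ℚ
  a-diag i = cong (_/ 1) (proj₁ cartan i)

  a≤0 : ∀ {i j} → i ≢ j → a i j ≤ 0ℚ
  a≤0 {i} {j} p = subst (_≤ 0ℚ) (sym (/1≡mkℤ (A i j))) (ℚ.*≤* (ℤₚ.≤-trans (ℤₚ.≤-reflexive (ℤₚ.*-identityʳ (A i j)))
      (proj₁ (proj₂ cartan) i j p)))

  Int-a : ∀ i j → Int (a i j)
  Int-a i j = A i j , refl

  Int-kron : ∀ {k} (i j : Fin k) → Int (kron i j)
  Int-kron i j with j Fin.≟ i
  ... | yes _ = Int-1
  ... | no _ = Int-0

  -- Symmetrizability pulls out `d j` instead of `d i`. This gives integrality when the second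
  -- argument is the coroot, and later identifies `compL` with the Euler form in the opposite order.
  euler′ : ∀ i j → euler i j ≡ d j * (kron i j + (if ⌊ toℕ j ℕ.<? toℕ i ⌋ then a j i else 0ℚ))
  euler′ i j with toℕ j ℕ.<? toℕ i | j Fin.≟ i
  ... | yes p | yes refl = refl
  ... | no p | yes refl = refl
  ... | yes p | no q = cong (d i *_) (+-identityˡ (a i j)) ■ da≡ i j ■ cong (d j *_) (sym (+-identityˡ (a j i)))
  ... | no p | no q = *-zeroʳ (d i) ■ sym (*-zeroʳ (d j))

  private
    Int-low : ∀ i j → Int (low i j)
    Int-low i j with toℕ j ℕ.<? toℕ i
    ... | yes _ = Int-a i j
    ... | no _ = Int-0

    euler-sum : ∀ i j → euler i j + euler j i ≡ d i * a i j
    euler-sum i j with Finₚ.<-cmp i j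
    ... | tri≈ _ refl _ = cong₂ (λ x y → d i * (x + y) + d i * (x + y)) (kron-refl i) (low-< {i} {i} ℕₚ.≤-refl) ■
          solve 1 (λ x → x :* (con 1ℚ :+ con 0ℚ) :+ x :* (con 1ℚ :+ con 0ℚ) := x :* con 2ℚ) refl (d i) ■
              cong (d i *_) (sym (a-diag i))
    ... | tri< p q _ = cong₂ (λ x y → d i * x + d j * y) (cong₂ _+_ (kron-≢ (q ∘ sym)) (low-< (ℕₚ.<⇒≤ p)))
        (cong₂ _+_ (kron-≢ q) (low-> p)) ■
          solve 3 (λ x y z → x :* (con 0ℚ :+ con 0ℚ) :+ y :* (con 0ℚ :+ z) := y :* z) refl (d i) (d j) (a j i) ■ sym (da≡ i j)
    ... | tri> _ q p = cong₂ (λ x y → d i * x + d j * y) (cong₂ _+_ (kron-≢ (q ∘ sym)) (low-> p))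
        (cong₂ _+_ (kron-≢ q) (low-< (ℕₚ.<⇒≤ p))) ■
          solve 3 (λ x y z → x :* (con 0ℚ :+ z) :+ y :* (con 0ℚ :+ con 0ℚ) := x :* z) refl (d i) (d j) (a i j)

  abstract
    E : V → V → ℚ
    E u v = sumFin (λ i → sumFin (λ j → euler i j * (u ! i) * (v ! j)))

    E-def : ∀ u v → E u v ≡ sumFin (λ i → sumFin (λ j → euler i j * (u ! i) * (v ! j)))
    E-def u v = refl

    Eˡ : ∀ u q v w → E (u ⊹ q ∙ v) w ≡ E u w + q * E v w
    Eˡ u q v w = sum-cong {n} (λ i → sum-cong {n} (λ j → cong (λ t → euler i j * t * (w ! j)) (!-lin u q v i) ■
        solve 5 (λ m u q v w → m :* (u :+ q :* v) :* w := m :* u :* w :+ q :* (m :* v :* w)) refl (euler i j) (u ! i) q (v ! i)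
            (w ! j)) ■
        sum-+ {n} _ _ ■ cong (sumFin (λ j → euler i j * (u ! i) * (w ! j)) +_) (sum-* {n} q _)) ■
      sum-+ {n} _ _ ■ cong (E u w +_) (sum-* {n} q _)

    Eʳ : ∀ w u q v → E w (u ⊹ q ∙ v) ≡ E w u + q * E w v
    Eʳ w u q v = sum-cong {n} (λ i → sum-cong {n} (λ j → cong (λ t → euler i j * (w ! i) * t) (!-lin u q v j) ■
        solve 5 (λ m u q v w → m :* w :* (u :+ q :* v) := m :* w :* u :+ q :* (m :* w :* v)) refl (euler i j) (u ! j) q (v ! j)
            (w ! i)) ■
        sum-+ {n} _ _ ■ cong (sumFin (λ j → euler i j * (w ! i) * (u ! j)) +_) (sum-* {n} q _)) ■
      sum-+ {n} _ _ ■ cong (E w u +_) (sum-* {n} q _)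

    E-eˡ : ∀ i v → E (e i) v ≡ sumFin (λ j → euler i j * (v ! j))
    E-eˡ i v = sum-cong {n} (λ k → sum-cong {n} (λ j → cong (λ t → euler k j * t * (v ! j)) (!-e i k) ■
        solve 3 (λ m t v → m :* t :* v := t :* (m :* v)) refl (euler k j) (kron i k) (v ! j)) ■ sum-* {n} (kron i k) _) ■
      sum-kron {n} (λ k → sumFin (λ j → euler k j * (v ! j))) i

    E-eʳ : ∀ u j → E u (e j) ≡ sumFin (λ i → euler i j * (u ! i))
    E-eʳ u j = sum-cong {n} (λ i → sum-cong {n} (λ k → cong (λ t → euler i k * (u ! i) * t) (!-e j k) ■
        *-comm (euler i k * (u ! i)) (kron j k)) ■ sum-kron {n} (λ k → euler i k * (u ! i)) j)

    E-expˡ : ∀ u v → E u v ≡ sumFin (λ i → u ! i * E (e i) v)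
    E-expˡ u v = sum-cong {n} (λ i → sum-cong {n} (λ j → solve 3 (λ m t v → m :* t :* v := t :* (m :* v)) refl (euler i j)
        (u ! i) (v ! j)) ■ sum-* {n} (u ! i) _ ■ cong (u ! i *_) (sym (E-eˡ i v)))

    E-expʳ : ∀ u v → E u v ≡ sumFin (λ j → v ! j * E u (e j))
    E-expʳ u v = sum-swap {n} {n} _ ■ sum-cong {n} (λ j → sum-cong {n} (λ i → *-comm (euler i j * (u ! i)) (v ! j)) ■
        sum-* {n} (v ! j) _ ■ cong (v ! j *_) (sym (E-eʳ u j)))

    E-ee : ∀ i j → E (e i) (e j) ≡ euler i j
    E-ee i j = E-eˡ i (e j) ■ sum-cong {n} (λ k → cong (euler i k *_) (!-e j k) ■ *-comm (euler i k) (kron j k)) ■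
        sum-kron {n} (euler i) j

    K≡E+E : ∀ u v → K u v ≡ E u v + E v u
    K≡E+E u v = sum-cong {n} (λ i → sum-cong {n} (λ j → cong (λ t → t * (u ! i) * (v ! j)) (sym (euler-sum i j)) ■
        solve 4 (λ x y u v → (x :+ y) :* u :* v := x :* u :* v :+ y :* v :* u) refl (euler i j) (euler j i) (u ! i) (v ! j)) ■
            sum-+ {n} _ _) ■
      sum-+ {n} _ _ ■ cong (E u v +_) (sum-swap {n} {n} (λ i j → euler j i * (v ! j) * (u ! i)))

  -- integral coordinates in the simple roots, resp. in the simple coroots
  IntV CoV : V → Set
  IntV v = ∀ i → Int (v ! i)
  CoV v = ∀ i → Int (d i * v ! i)

  abstract
    E-Int₁ : ∀ {x y} → CoV x → IntV y → Int (E x y)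
    E-Int₁ {x} {y} p q = sum-Int
        (λ i → sum-Int (λ j → subst Int (solve 4 (λ d m x y → (d :* x) :* (m :* y) := d :* m :* x :* y) refl (d i)
        (kron i j + low i j) (x ! i) (y ! j))
      (Int-* (p i) (Int-* (Int-+ (Int-kron i j) (Int-low i j)) (q j)))))

    E-Int₂ : ∀ {x y} → IntV x → CoV y → Int (E x y)
    E-Int₂ {x} {y} p q = sum-Int
        (λ i → sum-Int (λ j → subst Int (solve 4 (λ d m x y → (d :* y) :* (m :* x) := d :* m :* x :* y) refl (d j)
        (kron i j + _) (x ! i) (y ! j) ■ cong (λ t → t * x ! i * y ! j) (sym (euler′ i j)))
      (Int-* (q j) (Int-* (Int-+ (Int-kron i j) (lem i j)) (p i)))))
      where
      lem : ∀ i j → Int (if ⌊ toℕ j ℕ.<? toℕ i ⌋ then a j i else 0ℚ)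
      lem i j with toℕ j ℕ.<? toℕ i
      ... | yes _ = Int-a j i
      ... | no _ = Int-0

  E-diag : ∀ i → E (e i) (e i) ≡ d i
  E-diag i = E-ee i i ■ cong₂ (λ x y → d i * (x + y)) (kron-refl i) (low-< {i} {i} ℕₚ.≤-refl) ■
      solve 1 (λ x → x :* (con 1ℚ :+ con 0ℚ) := x) refl (d i)

  E-upper : ∀ {i j} → i Fin.< j → E (e i) (e j) ≡ 0ℚ
  E-upper {i} {j} p = E-ee i j ■ cong₂ (λ x y → d i * (x + y)) (kron-≢ (λ q → Finₚ.<-irrefl (sym q) p)) (low-< (ℕₚ.<⇒≤ p)) ■
      *-zeroʳ (d i)

  infix 7 ⟪_,_⟫
  ⟪_,_⟫ : V → V → ℚ
  ⟪ u , v ⟫ = E u v + E v u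

  -- Half of `K v v`, so that `D (e i)` is `d i`, the coroot of β is `inv (D β) ∙ β`, and `coef β v`
  -- below is K(β^∨, v).
  D : V → ℚ
  D v = E v v

  coef : V → V → ℚ
  coef β v = ⟪ β , v ⟫ * inv (D β)

  refl-by : V → V → V
  refl-by β v = v ⊹ (- coef β v) ∙ β

  ⟪⟫-comm : ∀ u v → ⟪ u , v ⟫ ≡ ⟪ v , u ⟫
  ⟪⟫-comm u v = +-comm (E u v) (E v u)

  ⟪⟫-ee : ∀ i j → ⟪ e i , e j ⟫ ≡ d i * a i j
  ⟪⟫-ee i j = cong₂ _+_ (E-ee i j) (E-ee j i) ■ euler-sum i j

  ⟪⟫ˡ : ∀ u q v w → ⟪ u ⊹ q ∙ v , w ⟫ ≡ ⟪ u , w ⟫ + q * ⟪ v , w ⟫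
  ⟪⟫ˡ u q v w = cong₂ _+_ (Eˡ u q v w) (Eʳ w u q v) ■ solve 5 (λ a b q x y → a :+ q :* x :+ (b :+ q :* y) := a :+ b :+ q :*
      (x :+ y)) refl (E u w) (E w u) q (E v w) (E w v)

  ⟪⟫ʳ : ∀ w u q v → ⟪ w , u ⊹ q ∙ v ⟫ ≡ ⟪ w , u ⟫ + q * ⟪ w , v ⟫
  ⟪⟫ʳ w u q v = ⟪⟫-comm w _ ■ ⟪⟫ˡ u q v w ■ cong₂ (λ x y → x + q * y) (⟪⟫-comm u w) (⟪⟫-comm v w)

  E0ˡ : ∀ w → E zeroV w ≡ 0ℚ
  E0ˡ w = cong (λ z → E z w) (sym (⊹0∙ zeroV w)) ■ E-expˡ _ w ■
      sum-cong {n} (λ i → cong (_* E (e i) w) (cong (_! i) (⊹0∙ zeroV w) ■ !-zero i) ■ *-zeroˡ (E (e i) w)) ■ sum-0 n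

  E0ʳ : ∀ w → E w zeroV ≡ 0ℚ
  E0ʳ w = E-expʳ w zeroV ■ sum-cong {n} (λ i → cong (_* E w (e i)) (!-zero i) ■ *-zeroˡ (E w (e i))) ■ sum-0 n

  E∙ˡ : ∀ q v w → E (q ∙ v) w ≡ q * E v w
  E∙ˡ q v w = cong (λ z → E z w) (sym (0⊹ (q ∙ v))) ■ Eˡ zeroV q v w ■ cong (_+ q * E v w) (E0ˡ w) ■ +-identityˡ _

  E∙ʳ : ∀ q v w → E w (q ∙ v) ≡ q * E w v
  E∙ʳ q v w = cong (E w) (sym (0⊹ (q ∙ v))) ■ Eʳ w zeroV q v ■ cong (_+ q * E w v) (E0ʳ w) ■ +-identityˡ _

-- Null vectors, reflections and real roots.

module Roots (H : AffineData) where
  open AffineData H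
  open Lattice H public

  ⟪⟫-expʳ : ∀ u v → ⟪ u , v ⟫ ≡ sumFin (λ j → v ! j * ⟪ u , e j ⟫)
  ⟪⟫-expʳ u v = cong₂ _+_ (E-expʳ u v) (E-expˡ v u) ■ sym (sum-+ {n} _ _) ■
    sum-cong {n} (λ j → sym (*-distribˡ-+ (v ! j) (E u (e j)) (E (e j) u)))

  ⟪e⟫ : ∀ i v → ⟪ e i , v ⟫ ≡ d i * sumFin (λ j → a i j * v ! j)
  ⟪e⟫ i v = ⟪⟫-expʳ (e i) v ■ sum-cong {n} (λ j → cong (v ! j *_) (⟪⟫-ee i j) ■
    solve 3 (λ v d a → v :* (d :* a) := d :* (a :* v)) refl (v ! j) (d i) (a i j)) ■ sum-* {n} (d i) _

  K-diag : ∀ u → K u u ≡ D u + D u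
  K-diag u = K≡E+E u u

  D≥0 : ∀ u → 0ℚ ≤ D u
  D≥0 u = 0≤*⇒0≤ 0<2 (subst (0ℚ ≤_) (K-diag u ■ solve 1 (λ x → x :+ x := con 2ℚ :* x) refl (D u)) (proj₁ affine u))

  D>0-proper : ∀ u → u ≢ zeroV → (∃ λ i → u ! i ≡ 0ℚ) → 0ℚ < D u
  D>0-proper u p q = 0<*⇒0< 0<2 (subst (0ℚ <_) (K-diag u ■ solve 1 (λ x → x :+ x := con 2ℚ :* x) refl (D u))
      (proj₂ (proj₂ affine) u p q))

  ≢zero : ∀ {u} → u ≢ zeroV → ∃ λ i → u ! i ≢ 0ℚ
  ≢zero {u} p with Finₚ.all? (λ i → u ! i ≟ 0ℚ)
  ... | yes q = ⊥-elim (p (vext (λ i → q i ■ sym (!-zero i))))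
  ... | no q = Finₚ.¬∀⟶∃¬ n _ (λ i → u ! i ≟ 0ℚ) q

  i₀ : Fin n
  i₀ = proj₁ (≢zero (proj₁ (proj₂ (proj₁ (proj₂ affine)))))

  δ>0 : ∀ i → 0ℚ < δ ! i
  δ>0 i = proj₂ (proj₁ isδ i)

  Int-δ : IntV δ
  Int-δ i = IsInt⇒Int (δ ! i) (proj₁ (proj₁ isδ i))

  δ≢0 : δ ≢ zeroV
  δ≢0 p = pos⇒≢0 (δ>0 i₀) (cong (_! i₀) p ■ !-zero i₀)

  ⟪eδ⟫ : ∀ i → ⟪ e i , δ ⟫ ≡ 0ℚ
  ⟪eδ⟫ i = ⟪e⟫ i δ ■ cong (d i *_) (proj₁ (proj₂ isδ) i) ■ *-zeroʳ (d i)

  ⟪δ⟫ : ∀ v → ⟪ δ , v ⟫ ≡ 0ℚ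
  ⟪δ⟫ v = ⟪⟫-expʳ δ v ■ sum-cong {n} (λ j → cong (v ! j *_) (⟪⟫-comm δ (e j) ■ ⟪eδ⟫ j) ■ *-zeroʳ (v ! j)) ■ sum-0 n

  ⟪⟫δ : ∀ v → ⟪ v , δ ⟫ ≡ 0ℚ
  ⟪⟫δ v = ⟪⟫-comm v δ ■ ⟪δ⟫ v

  neg-neg : ∀ x → - - x ≡ x
  neg-neg = solve 1 (λ t → :- (:- t) := t) refl

  half : ∀ {x y} → x + x ≡ y + y → x ≡ y
  half {x} {y} h = *-cancel {2ℚ} (pos⇒≢0 0<2) (solve 1 (λ x → con 2ℚ :* x := x :+ x) refl x ■ h ■
      solve 1 (λ x → x :+ x := con 2ℚ :* x) refl y)

  Dδ : D δ ≡ 0ℚ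
  Dδ = half (⟪δ⟫ δ)

  D-lin : ∀ u q v → D (u ⊹ q ∙ v) ≡ D u + q * ⟪ u , v ⟫ + q * q * D v
  D-lin u q v = Eˡ u q v _ ■ cong₂ (λ x y → x + q * y) (Eʳ u u q v) (Eʳ v u q v) ■
    solve 5 (λ a b c d q → a :+ q :* b :+ q :* (c :+ q :* d) := a :+ q :* (b :+ c) :+ q :* q :* d) refl (E u u) (E u v) (E v u)
        (E v v) q

  D∙ : ∀ q v → D (q ∙ v) ≡ q * q * D v
  D∙ q v = E∙ˡ q v _ ■ cong (q *_) (E∙ʳ q v v) ■ sym (*-assoc q q (D v))

  D-δshift : ∀ u q → D (u ⊹ q ∙ δ) ≡ D u
  D-δshift u q = D-lin u q δ ■ cong₂ (λ x y → D u + q * x + q * q * y) (⟪⟫δ u) Dδ ■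
      solve 2 (λ a q → a :+ q :* con 0ℚ :+ q :* q :* con 0ℚ := a) refl (D u) q

  Qδ : V → Set
  Qδ v = ∃ λ t → v ≡ t ∙ δ

  -- Subtracting the multiple of δ that kills the coordinate `i₀` lands in a proper coordinate
  -- subspace, where the form is definite.
  null : ∀ {u} → D u ≡ 0ℚ → Qδ u
  null {u} h = t , lem
    where
    t = div (u ! i₀) (δ ! i₀)
    w = u ⊹ (- t) ∙ δ
    w₀ : w ! i₀ ≡ 0ℚ
    w₀ = !-lin u (- t) δ i₀ ■ solve 3 (λ u t x → u :+ (:- t) :* x := u :- t :* x) refl (u ! i₀) t (δ ! i₀) ■
      cong (λ z → u ! i₀ - z) (div-* (u ! i₀) (δ ! i₀) (pos⇒≢0 (δ>0 i₀))) ■ +-inverseʳ (u ! i₀)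
    lem : u ≡ t ∙ δ
    lem with w ≟ⱽ zeroV
    ... | yes p = ⊹-cancel {u} { - t} {δ} p ■ cong (_∙ δ) (neg-neg t)
    ... | no p = ⊥-elim (<-irrefl (sym (D-δshift u (- t) ■ h)) (D>0-proper w p (i₀ , w₀)))

  D-Qδ : ∀ {v} → Qδ v → D v ≡ 0ℚ
  D-Qδ (t , refl) = D∙ t δ ■ cong (t * t *_) Dδ ■ *-zeroʳ (t * t)

  ⟪Qδ⟫ : ∀ {v} u → Qδ v → ⟪ u , v ⟫ ≡ 0ℚ
  ⟪Qδ⟫ u (t , refl) = cong₂ _+_ (E∙ʳ t δ u) (E∙ˡ t δ u) ■ sym (*-distribˡ-+ t (E u δ) (E δ u)) ■ cong (t *_) (⟪⟫δ u) ■
      *-zeroʳ t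

  -- Reflections

  coef-* : ∀ {β} v → D β ≢ 0ℚ → coef β v * D β ≡ ⟪ β , v ⟫
  coef-* {β} v p = (*-assoc ⟪ β , v ⟫ (inv (D β)) (D β)) ■ cong (⟪ β , v ⟫ *_) (inv-* p) ■ (*-identityʳ ⟪ β , v ⟫)

  coef-lin : ∀ β u q v → coef β (u ⊹ q ∙ v) ≡ coef β u + q * coef β v
  coef-lin β u q v = cong (_* inv (D β)) (⟪⟫ʳ β u q v) ■ (solve 4 (λ x q y i → (x :+ q :* y) :* i := x :* i :+ q :*
      (y :* i)) refl ⟪ β , u ⟫ q ⟪ β , v ⟫ (inv (D β)))

  coef-refl : ∀ {β} → D β ≢ 0ℚ → coef β β ≡ 2ℚ
  coef-refl {β} p = *-cancel {D β} p (*-comm (D β) (coef β β) ■ coef-* β p ■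
      solve 1 (λ x → x :+ x := x :* con 2ℚ) refl (D β))

  refl-lin : ∀ β u q v → refl-by β (u ⊹ q ∙ v) ≡ refl-by β u ⊹ q ∙ refl-by β v
  refl-lin β u q v = vext (λ i → !-lin (u ⊹ q ∙ v) (- coef β (u ⊹ q ∙ v)) β i ■
      cong₂ (λ x y → x + (- y) * β ! i) (!-lin u q v i) (coef-lin β u q v) ■
    solve 6 (λ u q v k l b → u :+ q :* v :+ (:- (k :+ q :* l)) :* b := u :+ (:- k) :* b :+ q :* (v :+ (:- l) :* b)) refl
        (u ! i) q (v ! i) (coef β u) (coef β v) (β ! i) ■
      sym (!-lin (refl-by β u) q (refl-by β v) i ■ cong₂ (λ x y → x + q * y) (!-lin u (- coef β u) β i)
          (!-lin v (- coef β v) β i)))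

  refl-orth : ∀ {β v} → ⟪ β , v ⟫ ≡ 0ℚ → refl-by β v ≡ v
  refl-orth {β} {v} h = cong (λ z → v ⊹ (- z) ∙ β) (cong (_* inv (D β)) h ■ *-zeroˡ (inv (D β))) ■ ⊹0∙ v β

  coef-refl-by : ∀ {β} v → D β ≢ 0ℚ → coef β (refl-by β v) ≡ - coef β v
  coef-refl-by {β} v p = coef-lin β v (- coef β v) β ■ cong (λ z → coef β v + (- coef β v) * z) (coef-refl p) ■
      solve 1 (λ x → x :+ (:- x) :* con 2ℚ := :- x) refl (coef β v)

  refl-invol : ∀ {β} v → D β ≢ 0ℚ → refl-by β (refl-by β v) ≡ v
  refl-invol {β} v p = cong (λ z → refl-by β v ⊹ (- z) ∙ β) (coef-refl-by v p) ■ ⊹∙⊹∙ v (- coef β v) (- - coef β v) β ■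
    cong (λ z → v ⊹ z ∙ β) (+-inverseʳ (- coef β v)) ■ ⊹0∙ v β

  refl-iso : ∀ {β} u v → D β ≢ 0ℚ → ⟪ refl-by β u , refl-by β v ⟫ ≡ ⟪ u , v ⟫
  refl-iso {β} u v p = begin
    ⟪ refl-by β u , refl-by β v ⟫                           ≡⟨ ⟪⟫ˡ u (- k) β (refl-by β v) ⟩
    ⟪ u , refl-by β v ⟫ + (- k) * ⟪ β , refl-by β v ⟫        ≡⟨ cong₂ (λ x y → x + (- k) * y) (⟪⟫ʳ u v (- l) β)
        (sym (coef-* (refl-by β v) p) ■ cong (_* D β) (coef-refl-by v p)) ⟩
    ⟪ u , v ⟫ + (- l) * ⟪ u , β ⟫ + (- k) * ((- l) * D β)      ≡⟨ cong (λ z → ⟪ u , v ⟫ + (- l) * z + (- k) * ((- l) * D β))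
        (⟪⟫-comm u β ■ sym (coef-* u p)) ⟩
    ⟪ u , v ⟫ + (- l) * (k * D β) + (- k) * ((- l) * D β)    ≡⟨ solve 4
        (λ x k l d → x :+ (:- l) :* (k :* d) :+ (:- k) :* ((:- l) :* d) := x) refl ⟪ u , v ⟫ k l (D β) ⟩
    ⟪ u , v ⟫ ∎
    where
    open ≡-Reasoning
    k = coef β u
    l = coef β v

  refl-D : ∀ {β} v → D β ≢ 0ℚ → D (refl-by β v) ≡ D v
  refl-D v p = half (refl-iso v v p)

  -- Real roots, characterized by the integrality of the root and of its coroot.

  record RL (v : V) : Set where
    constructor mkRL
    field
      int  : IntV v
      D>0  : 0ℚ < D v
      coint : CoV (inv (D v) ∙ v)
    D≢0 : D v ≢ 0ℚ
    D≢0 = pos⇒≢0 D>0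
  open RL public

  RL≢0 : ∀ {v} → RL v → v ≢ zeroV
  RL≢0 r refl = D≢0 r (E0ˡ zeroV)

  coef-Int : ∀ {β v} → RL β → IntV v → Int (coef β v)
  coef-Int {β} {v} r p = subst Int (cong₂ _+_ (E∙ˡ (inv (D β)) β v) (E∙ʳ (inv (D β)) β v) ■
      solve 3 (λ i x y → i :* x :+ i :* y := (x :+ y) :* i) refl (inv (D β)) (E β v) (E v β))
    (Int-+ (E-Int₁ (coint r) p) (E-Int₂ p (coint r)))

  E/D-Int : ∀ {β v} → RL β → IntV v → Int (E β v * inv (D β))
  E/D-Int {β} {v} r p = subst Int (E∙ˡ (inv (D β)) β v ■ *-comm (inv (D β)) (E β v)) (E-Int₁ (coint r) p)

  E/D-Intʳ : ∀ {β v} → RL β → IntV v → Int (E v β * inv (D β))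
  E/D-Intʳ {β} {v} r p = subst Int (E∙ʳ (inv (D β)) β v ■ *-comm (inv (D β)) (E v β)) (E-Int₂ p (coint r))

  IntV-lin : ∀ {u q v} → IntV u → Int q → IntV v → IntV (u ⊹ q ∙ v)
  IntV-lin {u} {q} {v} p r s i = subst Int (sym (!-lin u q v i)) (Int-+ (p i) (Int-* r (s i)))

  -- The coroot of s_β v is v^∨ - K(v^∨, β) β^∨, again an integral combination of simple coroots.
  RL-refl : ∀ {β v} → RL β → RL v → RL (refl-by β v)
  RL-refl {β} {v} rβ rv = mkRL (IntV-lin {v} (int rv) (Int-neg (coef-Int rβ (int rv))) (int rβ))
      (subst (0ℚ <_) (sym Dw) (D>0 rv)) co
    where
    w = refl-by β v
    Dw = refl-D v (D≢0 rβ)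
    co : CoV (inv (D w) ∙ w)
    co i = subst Int eq (Int-- (coint rv i) (Int-* (coef-Int rv (int rβ)) (coint rβ i)))
      where
      open ≡-Reasoning
      eq : d i * (inv (D v) ∙ v) ! i - coef v β * (d i * (inv (D β) ∙ β) ! i) ≡ d i * (inv (D w) ∙ w) ! i
      eq = begin
        d i * (inv (D v) ∙ v) ! i - coef v β * (d i * (inv (D β) ∙ β) ! i)
          ≡⟨ cong₂ (λ x y → d i * x - coef v β * (d i * y)) (!-∙ (inv (D v)) v i) (!-∙ (inv (D β)) β i) ⟩
        d i * (inv (D v) * v ! i) - ⟪ v , β ⟫ * inv (D v) * (d i * (inv (D β) * β ! i))
          ≡⟨ cong (λ z → d i * (inv (D v) * v ! i) - z * inv (D v) * (d i * (inv (D β) * β ! i))) (⟪⟫-comm v β) ⟩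
        d i * (inv (D v) * v ! i) - ⟪ β , v ⟫ * inv (D v) * (d i * (inv (D β) * β ! i))
          ≡⟨ solve 6 (λ d j v x k b → d :* (j :* v) :- x :* j :* (d :* (k :* b)) := d :* (j :* (v :+ (:- (x :* k)) :* b))) refl
              (d i) (inv (D v)) (v ! i) ⟪ β , v ⟫ (inv (D β)) (β ! i) ⟩
        d i * (inv (D v) * (v ! i + (- coef β v) * β ! i))
          ≡⟨ cong₂ (λ x y → d i * (inv x * y)) (sym Dw) (sym (!-lin v (- coef β v) β i)) ⟩
        d i * (inv (D w) * w ! i)
          ≡⟨ cong (d i *_) (sym (!-∙ (inv (D w)) w i)) ⟩
        d i * (inv (D w) ∙ w) ! i ∎

  RL-neg : ∀ {v} → RL v → RL ((- 1ℚ) ∙ v)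
  RL-neg {v} r = mkRL (λ i → subst Int (solve 1 (λ x → :- x := con (- 1ℚ) :* x) refl (v ! i) ■ sym (!-∙ (- 1ℚ) v i))
      (Int-neg (int r i)))
    (subst (0ℚ <_) (sym Dw) (D>0 r))
    (λ i → subst Int (cong (λ z → - (d i * z)) (!-∙ (inv (D v)) v i) ■
        solve 3 (λ d j x → :- (d :* (j :* x)) := d :* (j :* (con (- 1ℚ) :* x))) refl (d i) (inv (D v)) (v ! i) ■
        cong (d i *_) (sym (!-∙ (inv (D w)) w i ■ cong₂ (λ x y → inv x * y) Dw (!-∙ (- 1ℚ) v i))))
      (Int-neg (coint r i)))
    where
    w = (- 1ℚ) ∙ v
    Dw : D w ≡ D v
    Dw = D∙ (- 1ℚ) v ■ *-identityˡ (D v)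

  RL-shift : ∀ {v t} → RL v → Int t → CoV ((inv (D v) * t) ∙ δ) → RL (v ⊹ t ∙ δ)
  RL-shift {v} {t} r p q = mkRL (IntV-lin {v} (int r) p Int-δ) (subst (0ℚ <_) (sym (D-δshift v t)) (D>0 r))
    (λ i → subst Int (cong₂ (λ x y → d i * x + d i * y) (!-∙ (inv (D v)) v i) (!-∙ (inv (D v) * t) δ i) ■
        solve 5 (λ d j x t y → d :* (j :* x) :+ d :* (j :* t :* y) := d :* (j :* (x :+ t :* y))) refl (d i) (inv (D v))
            (v ! i) t (δ ! i) ■
         cong (d i *_) (sym (!-∙ (inv (D w)) w i ■ cong₂ (λ x y → inv x * y) (D-δshift v t) (!-lin v t δ i))))
      (Int-+ (coint r i) (q i)))
    where w = v ⊹ t ∙ δ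

  RL-e : ∀ i → RL (e i)
  RL-e i = mkRL (λ k → subst Int (sym (!-e i k)) (Int-kron i k)) (subst (0ℚ <_) (sym (E-diag i)) (d>0 i))
    (λ k → subst Int (cong (d k *_) (sym (!-∙ (inv (D (e i))) (e i) k ■ cong₂ (λ x y → inv x * y) (E-diag i) (!-e i k))))
        (lem k))
    where
    lem : ∀ k → Int (d k * (inv (d i) * kron i k))
    lem k with k Fin.≟ i
    ... | yes refl = subst Int (sym (inv-* (pos⇒≢0 (d>0 i))) ■ solve 2 (λ d j → j :* d := d :* (j :* con 1ℚ)) refl (d i)
        (inv (d i))) Int-1
    ... | no _ = subst Int (sym (cong (d k *_) (*-zeroʳ (inv (d i))) ■ *-zeroʳ (d k))) Int-0

  s≡refl : ∀ i v → s i v ≡ refl-by (e i) v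
  s≡refl i v = vext (λ k → Vecₚ.lookup∘tabulate _ k ■ sym (!-lin v (- coef (e i) v) (e i) k ■
      cong₂ (λ x y → v ! k + (- x) * y) ceq (!-e i k) ■ lem k))
    where
    S = sumFin (λ j → a i j * v ! j)
    ceq : coef (e i) v ≡ S
    ceq = *-cancel {d i} (pos⇒≢0 (d>0 i)) (*-comm (d i) (coef (e i) v) ■ cong (coef (e i) v *_) (sym (E-diag i)) ■
        coef-* v (D≢0 (RL-e i)) ■ ⟪e⟫ i v)
    lem : ∀ k → v ! k + (- S) * kron i k ≡ (if ⌊ k Fin.≟ i ⌋ then (v ! i) - S else v ! k)
    lem k with k Fin.≟ i
    ... | yes refl = solve 2 (λ v s → v :+ (:- s) :* con 1ℚ := v :- s) refl (v ! k) S
    ... | no _ = solve 2 (λ v s → v :+ (:- s) :* con 0ℚ := v) refl (v ! k) S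

-- Sign-coherence of real roots, and the Coxeter transformation as an isometry of E.

module Coherence (H : AffineData) where
  open AffineData H
  open Roots H public

  v⁺ v⁻ : V → V
  v⁺ v = tabulate (λ i → pos (v ! i))
  v⁻ v = tabulate (λ i → pos (- (v ! i)))

  !-v⁺ : ∀ v i → v⁺ v ! i ≡ pos (v ! i)
  !-v⁺ v i = Vecₚ.lookup∘tabulate (λ i → pos (v ! i)) i

  !-v⁻ : ∀ v i → v⁻ v ! i ≡ pos (- (v ! i))
  !-v⁻ v i = Vecₚ.lookup∘tabulate (λ i → pos (- (v ! i))) i

  private
    pos-or : ∀ x → pos x ≡ x ⊎ pos x ≡ 0ℚ
    pos-or x with ≤-total 0ℚ x
    ... | inj₁ p = inj₁ (pos-id p)
    ... | inj₂ p = inj₂ (p≤q⇒p⊔q≡q p)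

  v≡⁺⁻ : ∀ v → v ≡ v⁺ v ⊹ (- 1ℚ) ∙ v⁻ v
  v≡⁺⁻ v = vext (λ i → pos-split (v ! i) ■ sym (!-lin (v⁺ v) (- 1ℚ) (v⁻ v) i ■
      cong₂ (λ x y → x + (- 1ℚ) * y) (!-v⁺ v i) (!-v⁻ v i)))

  ⟪⁺⁻⟫≤0 : ∀ v → ⟪ v⁺ v , v⁻ v ⟫ ≤ 0ℚ
  ⟪⁺⁻⟫≤0 v = ≤0-neg (subst (0ℚ ≤_) (sum-cong {n} (λ i → sum-neg {n} _) ■ sum-neg {n} _ ■ cong -_ (K≡E+E (v⁺ v) (v⁻ v)))
      (sum-≥0 {n} (λ i → sum-≥0 {n} (λ j →
      subst (λ z → 0ℚ ≤ - z) (cong₂ (λ x y → d i * a i j * x * y) (sym (!-v⁺ v i)) (sym (!-v⁻ v j))) (lem i j)))))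
    where
    lem : ∀ i j → 0ℚ ≤ - (d i * a i j * pos (v ! i) * pos (- (v ! j)))
    lem i j with i Fin.≟ j
    ... | no p = subst (0ℚ ≤_) (solve 4 (λ d a x y → d :* (:- a) :* x :* y := :- (d :* a :* x :* y)) refl (d i) (a i j)
        (pos (v ! i)) (pos (- (v ! j))))
            (0≤* (0≤* (0≤* (<⇒≤ (d>0 i)) (0≤-neg (a≤0 p))) (pos≥0 (v ! i))) (pos≥0 (- (v ! j))))
    ... | yes refl with pos-disjoint (v ! i)
    ... | inj₁ e = ≤-reflexive (sym (cong (λ z → - (d i * a i i * z * pos (- (v ! i)))) e ■
        solve 2 (λ x y → :- (x :* con 0ℚ :* y) := con 0ℚ) refl (d i * a i i) (pos (- (v ! i)))))
    ... | inj₂ e = ≤-reflexive (sym (cong (λ z → - (d i * a i i * pos (v ! i) * z)) e ■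
        solve 2 (λ x y → :- (x :* y :* con 0ℚ) := con 0ℚ) refl (d i * a i i) (pos (v ! i))))

  -- If both v⁺ and v⁻ are nonzero then each has norm at least D v, and they pair nonpositively.
  coherent : ∀ {v} → RL v → Positive v ⊎ Positive ((- 1ℚ) ∙ v)
  coherent {v} r with v⁺ v ≟ⱽ zeroV | v⁻ v ≟ⱽ zeroV
  ... | _ | yes q = inj₁ ((λ i → subst (0ℚ ≤_) (sym (!-v⁺ v i) ■ cong (_! i) (sym v≡)) (pos≥0 (v ! i))) , RL≢0 r)
    where
    v≡ : v ≡ v⁺ v
    v≡ = v≡⁺⁻ v ■ cong (λ z → v⁺ v ⊹ (- 1ℚ) ∙ z) q ■ cong (v⁺ v ⊹_) (∙0 (- 1ℚ)) ■ ⊹0 (v⁺ v)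
  ... | yes q | no _ = inj₂ ((λ i → subst (0ℚ ≤_) (sym (!-v⁻ v i) ■ cong (_! i) (sym v≡)) (pos≥0 (- (v ! i)))) , RL≢0
      (RL-neg r))
    where
    v≡ : (- 1ℚ) ∙ v ≡ v⁻ v
    v≡ = cong ((- 1ℚ) ∙_) (v≡⁺⁻ v ■ cong (_⊹ (- 1ℚ) ∙ v⁻ v) q ■ 0⊹ _) ■ ∙∙ (- 1ℚ) (- 1ℚ) (v⁻ v) ■ 1∙ (v⁻ v)
  ... | no p | no q = ⊥-elim (<⇒≱' (by< {D v} {D v + D v} (D>0 r) refl) (≤-trans (+-mono-≤ (big⁺ p q) (big⁻ p q))
      (by≤ (0≤-neg (⟪⁺⁻⟫≤0 v)) eq)))
    where
    eq : D (v⁺ v) + D (v⁻ v) + - ⟪ v⁺ v , v⁻ v ⟫ ≡ D v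
    eq = (solve 3 (λ x y z → x :+ y :+ :- z := x :+ con (- 1ℚ) :* z :+ con (- 1ℚ) :* con (- 1ℚ) :* y) refl (D (v⁺ v))
        (D (v⁻ v)) ⟪ v⁺ v , v⁻ v ⟫) ■ sym (D-lin (v⁺ v) (- 1ℚ) (v⁻ v)) ■ cong D (sym (v≡⁺⁻ v))
    -- `D w` divided by `D v` pairs a coroot-integral vector with an integral one; a positive
    -- integer is at least 1. Applied to both parts, this gives `D v ≥ 2 D v`.
    bound : ∀ w → IntV w → CoV (inv (D v) ∙ w) → 0ℚ < D w → D v ≤ D w
    bound w iw cw pw = by≤ (0≤* (<⇒≤ (D>0 r)) (0≤- (Int-pos (subst Int (E∙ˡ (inv (D v)) w w) (E-Int₁ cw iw))
        (0<* (inv-pos (D>0 r)) pw))))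
      (solve 3 (λ x j w → x :+ x :* (j :* w :- con 1ℚ) := (j :* x) :* w) refl (D v) (inv (D v)) (D w) ■
          cong (_* D w) (inv-* (D≢0 r)) ■ *-identityˡ (D w))
    pick : ∀ {P : ℚ → Set} → P 0ℚ → ∀ x → P x → P (pos x)
    pick {P} z x px with pos-or x
    ... | inj₁ e = subst P (sym e) px
    ... | inj₂ e = subst P (sym e) z
    -- Each part vanishes where the other does not, so both lie in proper coordinate subspaces and
    -- have positive norm.
    zero-of : ∀ {u w} → (∀ i → u ! i ≡ 0ℚ ⊎ w ! i ≡ 0ℚ) → u ≢ zeroV → ∃ λ i → w ! i ≡ 0ℚ
    zero-of h ne with ≢zero ne
    ... | i , ne′ with h i
    ... | inj₁ e = ⊥-elim (ne′ e)
    ... | inj₂ e = i , e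
    dis : ∀ i → v⁺ v ! i ≡ 0ℚ ⊎ v⁻ v ! i ≡ 0ℚ
    dis i with pos-disjoint (v ! i)
    ... | inj₁ e = inj₁ (!-v⁺ v i ■ e)
    ... | inj₂ e = inj₂ (!-v⁻ v i ■ e)
    co0 : ∀ i → Int (d i * (inv (D v) * 0ℚ))
    co0 i = subst Int (sym (cong (d i *_) (*-zeroʳ (inv (D v))) ■ *-zeroʳ (d i))) Int-0
    co : ∀ i → Int (d i * (inv (D v) * v ! i))
    co i = subst (λ z → Int (d i * z)) (!-∙ (inv (D v)) v i) (coint r i)
    co- : ∀ i → Int (d i * (inv (D v) * - (v ! i)))
    co- i = subst Int (solve 3 (λ d j x → :- (d :* (j :* x)) := d :* (j :* (:- x))) refl (d i) (inv (D v)) (v ! i))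
        (Int-neg (co i))
    big⁺ : v⁺ v ≢ zeroV → v⁻ v ≢ zeroV → D v ≤ D (v⁺ v)
    big⁺ p q = bound (v⁺ v) (λ i → subst Int (sym (!-v⁺ v i)) (pick {Int} Int-0 (v ! i) (int r i)))
      (λ i → subst (λ z → Int (d i * z)) (sym (!-∙ (inv (D v)) (v⁺ v) i ■ cong (inv (D v) *_) (!-v⁺ v i)))
          (pick {λ z → Int (d i * (inv (D v) * z))} (co0 i) (v ! i) (co i)))
      (D>0-proper (v⁺ v) p (zero-of {v⁻ v} {v⁺ v} (λ i → Sum.swap (dis i)) q))
    big⁻ : v⁺ v ≢ zeroV → v⁻ v ≢ zeroV → D v ≤ D (v⁻ v)
    big⁻ p q = bound (v⁻ v) (λ i → subst Int (sym (!-v⁻ v i)) (pick {Int} Int-0 (- (v ! i)) (Int-neg (int r i))))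
      (λ i → subst (λ z → Int (d i * z)) (sym (!-∙ (inv (D v)) (v⁻ v) i ■ cong (inv (D v) *_) (!-v⁻ v i)))
          (pick {λ z → Int (d i * (inv (D v) * z))} (co0 i) (- (v ! i)) (co- i)))
      (D>0-proper (v⁻ v) q (zero-of {v⁺ v} {v⁻ v} dis p))

  ¬both : ∀ {v} → Positive v → Positive ((- 1ℚ) ∙ v) → ⊥
  ¬both {v} p q = proj₂ p (vext
      (λ i → ≤-antisym (≤0-neg (subst (0ℚ ≤_) (!-∙ (- 1ℚ) v i ■ solve 1 (λ x → con (- 1ℚ) :* x := :- x) refl (v ! i))
      (proj₁ q i))) (proj₁ p i) ■ sym (!-zero i)))

  positive? : ∀ {v} → RL v → Dec (Positive v)
  positive? r with coherent r
  ... | inj₁ p = yes p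
  ... | inj₂ q = no (λ p → ¬both p q)

  -- A real root and its multiple t are both primitive, hence t = 1.
  RL-prim : ∀ {v t} → RL v → RL (t ∙ v) → 0ℚ < t → t ≡ 1ℚ
  RL-prim {v} {t} r r′ p = ≤-antisym (by≤ (0≤* (<⇒≤ p) (0≤- u≥1)) (solve 2 (λ t u → t :+ t :* (u :- con 1ℚ) := u :* t) refl t
      (inv t) ■ it)) t≥1
    where
    it : inv t * t ≡ 1ℚ
    it = inv-* (pos⇒≢0 p)
    Int-t : Int t
    Int-t = subst Int (cong (_* inv (D v)) (E∙ʳ t v v) ■ *-assoc t (D v) (inv (D v)) ■
        cong (t *_) (*-comm (D v) (inv (D v)) ■ inv-* (D≢0 r)) ■ *-identityʳ t) (E/D-Int r (int r′))
    Int-u : Int (inv t)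
    Int-u = subst Int (*-cancel (D≢0 r′) (solve 3 (λ a e j → a :* (e :* j) := e :* (j :* a)) refl (D (t ∙ v)) (E (t ∙ v) v)
        (inv (D (t ∙ v))) ■
        cong₂ _*_ (E∙ˡ t v v) (inv-* (D≢0 r′)) ■ *-identityʳ (t * D v) ■
            sym (cong (_* (t * D v)) it ■ *-identityˡ (t * D v)) ■
          solve 3 (λ u t x → u :* t :* (t :* x) := t :* t :* x :* u) refl (inv t) t (D v) ■ cong (_* inv t) (sym (D∙ t v))))
      (E/D-Int r′ (int r))
    t≥1 = Int-pos Int-t p
    u≥1 = Int-pos Int-u (inv-pos p)

  -- The reflection changes only the coordinate `i`. By coherence the image is negative, so all
  -- other coordinates of `v` vanish, and a root that is a multiple of `e i` is `e i` by `RL-prim`.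
  reflected-simple : ∀ {v} i → RL v → Positive v → ¬ Positive (refl-by (e i) v) → v ≡ e i
  reflected-simple {v} i r p ¬q = go (coherent (RL-refl (RL-e i) r))
    where
    module _ (q : Positive ((- 1ℚ) ∙ refl-by (e i) v)) where
      off : ∀ k → k ≢ i → v ! k ≡ 0ℚ
      off k ne = ≤-antisym (≤0-neg (subst (0ℚ ≤_) eq (proj₁ q k))) (proj₁ p k)
        where
        eq : ((- 1ℚ) ∙ refl-by (e i) v) ! k ≡ - (v ! k)
        eq = !-∙ (- 1ℚ) (refl-by (e i) v) k ■ cong ((- 1ℚ) *_) (!-lin v (- coef (e i) v) (e i) k ■
            cong (λ z → v ! k + (- coef (e i) v) * z) (!-e i k ■ kron-≢ ne)) ■
          solve 2 (λ x c → con (- 1ℚ) :* (x :+ c :* con 0ℚ) := :- x) refl (v ! k) (- coef (e i) v)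
      v≡ : v ≡ v ! i ∙ e i
      v≡ = vext lem
        where
        lem : ∀ k → v ! k ≡ (v ! i ∙ e i) ! k
        lem k with k Fin.≟ i
        ... | yes refl = sym (!-∙ (v ! i) (e i) i ■ cong (v ! i *_) (!-e i i ■ kron-refl i) ■ *-identityʳ (v ! i))
        ... | no ne = off k ne ■ sym (!-∙ (v ! i) (e i) k ■ cong (v ! i *_) (!-e i k ■ kron-≢ ne) ■ *-zeroʳ (v ! i))
      t>0 : 0ℚ < v ! i
      t>0 = ≤∧≢⇒< (proj₁ p i) (λ e0 → proj₂ p (v≡ ■ cong (_∙ e i) e0 ■ 0∙ (e i)))
    go : Positive (refl-by (e i) v) ⊎ Positive ((- 1ℚ) ∙ refl-by (e i) v) → v ≡ e i
    go (inj₁ q) = ⊥-elim (¬q q)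
    go (inj₂ q) = v≡ q ■ cong (_∙ e i) (RL-prim {e i} {v ! i} (RL-e i) (subst RL (v≡ q) r) (t>0 q)) ■ 1∙ (e i)

  ht : V → ℚ
  ht v = sumFin (λ i → v ! i)

  ht-lin : ∀ u q v → ht (u ⊹ q ∙ v) ≡ ht u + q * ht v
  ht-lin u q v = sum-cong {n} (λ i → !-lin u q v i) ■ sum-+ {n} _ _ ■ cong (ht u +_) (sum-* {n} q _)

  ht-e : ∀ i → ht (e i) ≡ 1ℚ
  ht-e i = sum-cong {n} (λ k → !-e i k ■ sym (*-identityʳ (kron i k))) ■ sum-kron {n} (λ _ → 1ℚ) i

  ht≥0 : ∀ {v} → Positive v → 0ℚ ≤ ht v
  ht≥0 p = sum-≥0 {n} (proj₁ p)

  ht-Int : ∀ v → IntV v → Int (ht v)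
  ht-Int v p = sum-Int {n} p

  -- Since `D v` is positive, some simple root with positive coefficient in `v` pairs positively
  -- with `v`. Reflecting in it lowers the integral height; the descent stops when the image is no
  -- longer positive, that is, at a simple root.
  RL⇒RealRoot : ∀ {v} → RL v → Positive v → RealRoot v
  RL⇒RealRoot {v} r p = go (proj₁ b) r p (proj₂ b)
    where
    b = arch-suc (ht v)
    go : ∀ k {v} → RL v → Positive v → ht v < fromℕ (suc k) → RealRoot v
    go k {v} r p h = step k h (positive? r′)
      where
      found = sum-pos⇒ {n} (λ j → v ! j * ⟪ v , e j ⟫) (subst (0ℚ <_) (⟪⟫-expʳ v v) (0<+ (D>0 r) (D≥0 v)))
      i = proj₁ found
      q : 0ℚ < v ! i * ⟪ v , e i ⟫
      q = proj₂ found
      r′ = RL-refl (RL-e i) r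
      vi>0 : 0ℚ < v ! i
      vi>0 = ≤∧≢⇒< (proj₁ p i) (λ e0 → pos⇒≢0 q (cong (_* ⟪ v , e i ⟫) e0 ■ (*-zeroˡ ⟪ v , e i ⟫)))
      c>0 : 0ℚ < coef (e i) v
      c>0 = 0<* (subst (0ℚ <_) (⟪⟫-comm v (e i)) (0<*⇒0< vi>0 q)) (inv-pos (D>0 (RL-e i)))
      smaller : ht (refl-by (e i) v) < ht v
      smaller = by< c>0 (cong (_+ coef (e i) v) (ht-lin v (- coef (e i) v) (e i) ■
          cong (λ z → ht v + (- coef (e i) v) * z) (ht-e i)) ■ solve 2 (λ h c → h :+ (:- c) :* con 1ℚ :+ c := h) refl (ht v)
          (coef (e i) v))
      step : ∀ k → ht v < fromℕ (suc k) → Dec (Positive (refl-by (e i) v)) → RealRoot v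
      step k h (no ¬p) = [] , i , sym (reflected-simple i r p ¬p)
      step zero h (yes p′) = ⊥-elim (<⇒≱' (Int-step zero (ht-Int v (int r)) (ht-Int (refl-by (e i) v) (int r′)) smaller h)
          (ht≥0 p′))
      step (suc k) h (yes p′) = let w , j , eq = go k r′ p′ (Int-step (suc k) (ht-Int v (int r)) (ht-Int (refl-by (e i) v) (int r′)) smaller h) in
        i ∷ w , j , (cong (s i) eq ■ s≡refl i _ ■ refl-invol v (D≢0 (RL-e i)))

  RealRoot⇒RL : ∀ {v} → RealRoot v → RL v
  RealRoot⇒RL (w , i , refl) = go w
    where
    go : ∀ w → RL (act w (e i))
    go [] = RL-e i
    go (j ∷ w) = subst RL (sym (s≡refl j (act w (e i)))) (RL-refl (RL-e j) (go w))

  -- Products of reflections and exceptional sequences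

  actR : List V → V → V
  actR [] v = v
  actR (β ∷ L) v = refl-by β (actR L v)

  Exc : List V → Set
  Exc = AllPairs (λ β β′ → E β β′ ≡ 0ℚ)

  act-fix : ∀ {η L} x → All (λ β → E η β ≡ 0ℚ) L → E η (actR L x) ≡ E η x
  act-fix x [] = refl
  act-fix {η} {β ∷ L} x (p ∷ ps) = Eʳ η (actR L x) (- coef β (actR L x)) β ■
      cong₂ (λ u v → u + (- coef β (actR L x)) * v) (act-fix x ps) p ■
      solve 2 (λ u k → u :+ k :* con 0ℚ := u) refl (E η x) (- coef β (actR L x))

  -- The Coxeter transformation formula of an exceptional sequence. Prepending η does not affect the
  -- later β, as `E η β` is 0; at η itself, subtracting ⟪η, w⟫ from `E w η` leaves `- E η w`, and
  -- `E η w` is `E η x` by `act-fix`.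
  exc-skew : ∀ {L} x → All RL L → Exc L → All (λ β → E (actR L x) β ≡ - E β x) L
  exc-skew x [] [] = []
  exc-skew {η ∷ L} x (r ∷ rs) (p ∷ ps) = first ∷ go p (exc-skew x rs ps)
    where
    w = actR L x
    first : E (refl-by η w) η ≡ - E η x
    first = Eˡ w (- coef η w) η η ■ solve 3 (λ a k b → a :+ (:- k) :* b := a :- k :* b) refl (E w η) (coef η w) (D η) ■
        cong (λ z → E w η - z) (coef-* w (D≢0 r)) ■
      solve 2 (λ a b → a :- (b :+ a) := :- b) refl (E w η) (E η w) ■ cong -_ (act-fix x p)
    go : ∀ {L′} → All (λ β → E η β ≡ 0ℚ) L′ → All (λ β → E w β ≡ - E β x) L′ → All (λ β → E (refl-by η w) β ≡ - E β x) L′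
    go [] [] = []
    go {β ∷ _} (q ∷ qs) (h ∷ hs) = (Eˡ w (- coef η w) η β ■ cong₂ (λ u v → u + (- coef η w) * v) h q ■
        solve 2 (λ u k → u :+ k :* con 0ℚ := u) refl (- E β x) (- coef η w)) ∷ go qs hs

  actR-lin : ∀ L u q v → actR L (u ⊹ q ∙ v) ≡ actR L u ⊹ q ∙ actR L v
  actR-lin [] u q v = refl
  actR-lin (β ∷ L) u q v = cong (refl-by β) (actR-lin L u q v) ■ refl-lin β (actR L u) q (actR L v)

  actR-++ : ∀ L M v → actR (L ++ M) v ≡ actR L (actR M v)
  actR-++ [] M v = refl
  actR-++ (β ∷ L) M v = cong (refl-by β) (actR-++ L M v)

  act≡actR : ∀ w v → act w v ≡ actR (List.map e w) v
  act≡actR [] v = refl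
  act≡actR (i ∷ w) v = s≡refl i (act w v) ■ cong (refl-by (e i)) (act≡actR w v)

  simples : List V
  simples = List.map e (allFin n)

  sorted : AllPairs Fin._<_ (allFin n)
  sorted = AllPairsₚ.tabulate⁺-< id

  Exc-simples : Exc simples
  Exc-simples = AllPairsₚ.map⁺ (AllPairs.map E-upper sorted)

  RL-es : ∀ w → All RL (List.map e w)
  RL-es [] = []
  RL-es (i ∷ w) = RL-e i ∷ RL-es w

  c≡ : ∀ v → c v ≡ actR simples v
  c≡ = act≡actR (allFin n)

  c-lin : ∀ u q v → c (u ⊹ q ∙ v) ≡ c u ⊹ q ∙ c v
  c-lin u q v = c≡ _ ■ actR-lin simples u q v ■ sym (cong₂ (λ x y → x ⊹ q ∙ y) (c≡ u) (c≡ v))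

  -- The simple roots are a basis, so `exc-skew` extends to every `y`. Used twice it shows that `c`
  -- preserves `E`; at a fixed vector it shows that the vector is isotropic.
  c-skew : ∀ x y → E (c x) y ≡ - E y x
  c-skew x y = E-expʳ (c x) y ■ sum-cong {n} (λ j → cong (y ! j *_) (lem j) ■
      solve 2 (λ a b → a :* (:- b) := :- (a :* b)) refl (y ! j) (E (e j) x)) ■ sum-neg {n} _ ■ cong -_ (sym (E-expˡ y x))
    where
    lem : ∀ j → E (c x) (e j) ≡ - E (e j) x
    lem j = cong (λ z → E z (e j)) (c≡ x) ■ All.lookup (exc-skew x (RL-es (allFin n)) Exc-simples)
        (Mem.∈-map⁺ e (Mem.∈-allFin j))
      where import Data.List.Membership.Propositional.Properties as Mem

  E-cc : ∀ x y → E (c x) (c y) ≡ E x y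
  E-cc x y = c-skew x (c y) ■ cong -_ (c-skew y x) ■ neg-neg (E x y)

  c-fix : ∀ {x} → c x ≡ x → Qδ x
  c-fix {x} h = null (half′ (sym (cong (λ z → E z x) h) ■ c-skew x x))
    where
    half′ : ∀ {y} → y ≡ - y → y ≡ 0ℚ
    half′ {y} e = half (cong (y +_) e ■ +-inverseʳ y)

  RL-c : ∀ {v} → RL v → RL (c v)
  RL-c {v} r = subst RL (sym (c≡ v)) (go (allFin n))
    where
    go : ∀ w → RL (actR (List.map e w) v)
    go [] = r
    go (i ∷ w) = RL-refl (RL-e i) (go w)

  actR-δ : ∀ L → actR L δ ≡ δ
  actR-δ [] = refl
  actR-δ (β ∷ L) = cong (refl-by β) (actR-δ L) ■ refl-orth (⟪⟫δ β)

  cδ : c δ ≡ δ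
  cδ = c≡ δ ■ actR-δ simples

  -- Substitute δ = cγ - γ and apply skewness. This describes `U_c` as the kernel of `E δ`, without
  -- γ.
  Eδ : ∀ y → E δ y ≡ - ⟪ γ , y ⟫
  Eδ y = solve 3 (λ a b x → x := (b :+ con 1ℚ :* x) :- b) refl (E y γ) (E γ y) (E δ y) ■
      cong (_- E γ y) (sym (Eˡ γ 1ℚ δ y) ■ cong (λ z → E z y) (cong (γ ⊹_) (1∙ δ) ■ ⊹-def γ δ ■ sym isγ) ■ c-skew γ y) ■
    solve 2 (λ a b → (:- a) :- b := :- (b :+ a)) refl (E y γ) (E γ y)

  -- A positive real root made negative by s_k is α_k.
  sign-change : ∀ {b} → RL b → Positive b → ¬ Positive (c b) → ∃ λ k → ∀ y → E y b ≡ y ! k * d k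
  sign-change {b} r p ¬q = proj₁ res , (λ y → E-expˡ y b ■ sum-cong {n} (λ i → cong (y ! i *_)
      (All.lookup (proj₁ (proj₂ (proj₂ res))) (Mem.∈-allFin i)) ■
      solve 3 (λ y k d → y :* (k :* d) := k :* (y :* d)) refl (y ! i) (kron (proj₁ res) i) (d (proj₁ res))) ■
      sum-kron {n} (λ i → y ! i * d (proj₁ res)) (proj₁ res))
    where
    import Data.List.Membership.Propositional.Properties as Mem
    open import Data.List.Membership.Propositional using (_∈_)
    open import Data.List.Relation.Unary.Any using (here; there)
    RL-w : ∀ w → RL (actR (List.map e w) b)
    RL-w [] = r
    RL-w (j ∷ w) = RL-refl (RL-e j) (RL-w w)
    -- An inversion of `c` has the form s_n ⋯ s_{k+1} α_k, and E(e_i, ·) takes on it the value `d k`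
    -- at i = k and 0 elsewhere. The last conjunct carries this past the letters to the left of `w`,
    -- which are E-orthogonal to the letters of `w`.
    Goal : List (Fin n) → Set
    Goal w = ∃ λ k → k ∈ w × All (λ i → E (e i) b ≡ kron k i * d k) w × (∀ η → All (λ i → E η (e i) ≡ 0ℚ) w → E η b ≡ 0ℚ)
    module First i w (lt : All (i Fin.<_) w) (srt : AllPairs Fin._<_ w) (u≡ : actR (List.map e w) b ≡ e i) where
      up : ∀ {w} → All (i Fin.<_) w → All (λ β → E (e i) β ≡ 0ℚ) (List.map e w)
      up [] = []
      up (x ∷ xs) = E-upper x ∷ up xs
      first : E (e i) b ≡ d i
      first = sym (act-fix b (up lt)) ■ cong (E (e i)) u≡ ■ E-diag i
      perp : ∀ η → All (λ j → E η (e j) ≡ 0ℚ) (i ∷ w) → E η b ≡ 0ℚ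
      perp η (h ∷ hs) = sym (act-fix b (Allₚ.map⁺ hs)) ■ cong (E η) u≡ ■ h
      conv : ∀ {w′} → All (i Fin.<_) w′ → All (λ β → E (actR (List.map e w) b) β ≡ - E β b) (List.map e w′) → All
          (λ j → E (e j) b ≡ kron i j * d i) w′
      conv [] _ = []
      conv {j ∷ _} (x ∷ xs) (h ∷ hs) = (sym (neg-neg (E (e j) b)) ■ cong -_ (sym h ■ cong (λ z → E z (e j)) u≡ ■ E-upper x) ■
          sym (cong (_* d i) (kron-≢ (λ q → Finₚ.<-irrefl (sym q) x)) ■ *-zeroˡ (d i))) ∷ conv xs hs
      goal : Goal (i ∷ w)
      goal = i , here refl , (first ■ sym (cong (_* d i) (kron-refl i) ■ *-identityˡ (d i))) ∷ conv lt
          (exc-skew b (RL-es w) (AllPairsₚ.map⁺ (AllPairs.map E-upper srt))) , perp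
    go : ∀ w → AllPairs Fin._<_ w → ¬ Positive (actR (List.map e w) b) → Goal w
    step : ∀ i w → All (i Fin.<_) w → AllPairs Fin._<_ w → ¬ Positive (actR (List.map e (i ∷ w)) b) → Dec
        (Positive (actR (List.map e w) b)) → Goal (i ∷ w)
    go [] _ ¬p = ⊥-elim (¬p p)
    go (i ∷ w) (lt ∷ srt) ¬p = step i w lt srt ¬p (positive? (RL-w w))
    step i w lt srt ¬p (no ¬p′) = let k , k∈ , al , perp = go w srt ¬p′ in
      k , there k∈ , (perp (e i) (All.map E-upper lt) ■ sym (cong (_* d k) (kron-≢
          (λ q → Finₚ.<-irrefl q (All.lookup lt k∈))) ■ *-zeroˡ (d k))) ∷ al , (λ { η (_ ∷ hs) → perp η hs })
    step i w lt srt ¬p (yes p′) = First.goal i w lt srt (reflected-simple i (RL-w w) p′ ¬p)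
    res : Goal (allFin n)
    res = go (allFin n) sorted (subst (λ z → ¬ Positive z) (c≡ b) ¬q)

-- Iteration of c on real roots: recurrence, drift along δ, positivity.

module Dynamics (H : AffineData) where
  open AffineData H
  open Coherence H public

  g : V → ℚ
  g v = E δ v

  Kγ≡ : ∀ v → K γ v ≡ - g v
  Kγ≡ v = K≡E+E γ v ■ sym (neg-neg ⟪ γ , v ⟫) ■ cong -_ (sym (Eδ v))

  InU⇒ : ∀ {v} → InU v → g v ≡ 0ℚ
  InU⇒ {v} h = sym (neg-neg (g v)) ■ cong -_ (sym (Kγ≡ v) ■ h)

  ⇒InU : ∀ {v} → g v ≡ 0ℚ → InU v
  ⇒InU {v} h = Kγ≡ v ■ cong -_ h

  E-δʳ : ∀ v → E v δ ≡ - g v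
  E-δʳ v = solve 2 (λ x y → x := (x :+ y) :- y) refl (E v δ) (g v) ■ cong (_- g v) (⟪⟫δ v) ■ +-identityˡ (- g v)

  g-lin : ∀ u q v → g (u ⊹ q ∙ v) ≡ g u + q * g v
  g-lin = Eʳ δ

  g-δ : ∀ v t → g (v ⊹ t ∙ δ) ≡ g v
  g-δ v t = g-lin v t δ ■ cong (λ z → g v + t * z) Dδ ■ solve 2 (λ x t → x :+ t :* con 0ℚ := x) refl (g v) t

  g-c : ∀ v → g (c v) ≡ g v
  g-c v = cong (λ z → E z (c v)) (sym cδ) ■ E-cc δ v

  g-Qδ : ∀ {v} → Qδ v → g v ≡ 0ℚ
  g-Qδ (t , refl) = E∙ʳ t δ δ ■ cong (t *_) Dδ ■ *-zeroʳ t

  c-zero : c zeroV ≡ zeroV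
  c-zero = c≡ zeroV ■ go simples
    where
    go : ∀ L → actR L zeroV ≡ zeroV
    go [] = refl
    go (β ∷ L) = cong (refl-by β) (go L) ■ refl-orth (cong₂ _+_ (E0ʳ β) (E0ˡ β) ■ refl)

  c-Qδ : ∀ {v} → Qδ v → c v ≡ v
  c-Qδ (t , refl) = cong c (sym (0⊹ (t ∙ δ))) ■ c-lin zeroV t δ ■ cong₂ (λ x y → x ⊹ t ∙ y) c-zero cδ ■ 0⊹ (t ∙ δ)

  -- Otherwise γ would be a multiple of δ, hence fixed by `c`, and δ would vanish.
  Dγ>0 : 0ℚ < D γ
  Dγ>0 = ≤∧≢⇒< (D≥0 γ) (λ h → δ≢0 (lem (c-Qδ (null h))))
    where
    lem : c γ ≡ γ → δ ≡ zeroV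
    lem cγ = vext (λ i → solve 2 (λ x y → y := (x :+ y) :- x) refl (γ ! i) (δ ! i) ■
        cong (_- γ ! i) (sym (!-⊹ γ δ i) ■ cong (_! i) (⊹-def γ δ ■ sym isγ ■ cγ)) ■ +-inverseʳ (γ ! i) ■ sym (!-zero i))

  c⁻¹-c : ∀ v → c⁻¹ (c v) ≡ v
  c⁻¹-c v = go (allFin n) v
    where
    act-++ : ∀ w w′ v → act (w ++ w′) v ≡ act w (act w′ v)
    act-++ [] w′ v = refl
    act-++ (i ∷ w) w′ v = cong (s i) (act-++ w w′ v)
    ss : ∀ i v → s i (s i v) ≡ v
    ss i v = s≡refl i (s i v) ■ cong (refl-by (e i)) (s≡refl i v) ■ refl-invol v (D≢0 (RL-e i))
    go : ∀ w v → act (reverse w) (act w v) ≡ v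
    go [] v = refl
    go (i ∷ w) v = cong (λ z → act z (s i (act w v))) (Listₚ.unfold-reverse i w) ■
        act-++ (reverse w) (i ∷ []) (s i (act w v)) ■ cong (act (reverse w)) (ss i (act w v)) ■ go w v

  c-inj : ∀ {u v} → c u ≡ c v → u ≡ v
  c-inj {u} {v} h = sym (c⁻¹-c u) ■ cong c⁻¹ h ■ c⁻¹-c v

  c^ : ℕ → V → V
  c^ zero v = v
  c^ (suc k) v = c (c^ k v)

  c^-+ : ∀ k l v → c^ (k ℕ.+ l) v ≡ c^ k (c^ l v)
  c^-+ zero l v = refl
  c^-+ (suc k) l v = cong c (c^-+ k l v)

  c^-suc : ∀ k v → c^ k (c v) ≡ c (c^ k v)
  c^-suc zero v = refl
  c^-suc (suc k) v = cong c (c^-suc k v)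

  c-δ : ∀ v t → c (v ⊹ t ∙ δ) ≡ c v ⊹ t ∙ δ
  c-δ v t = c-lin v t δ ■ cong (λ z → c v ⊹ t ∙ z) cδ

  c^-δ : ∀ k v t → c^ k (v ⊹ t ∙ δ) ≡ c^ k v ⊹ t ∙ δ
  c^-δ zero v t = refl
  c^-δ (suc k) v t = cong c (c^-δ k v t) ■ c-δ (c^ k v) t

  c^-inj : ∀ k {u v} → c^ k u ≡ c^ k v → u ≡ v
  c^-inj zero h = h
  c^-inj (suc k) h = c^-inj k (c-inj h)

  E-c^ : ∀ k x y → E (c^ k x) (c^ k y) ≡ E x y
  E-c^ zero x y = refl
  E-c^ (suc k) x y = E-cc (c^ k x) (c^ k y) ■ E-c^ k x y

  g-c^ : ∀ k v → g (c^ k v) ≡ g v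
  g-c^ zero v = refl
  g-c^ (suc k) v = g-c (c^ k v) ■ g-c^ k v

  RL-c^ : ∀ k {v} → RL v → RL (c^ k v)
  RL-c^ zero r = r
  RL-c^ (suc k) r = RL-c (RL-c^ k r)

  switch : ∀ {Q : ℕ → Set} → (∀ k → Dec (Q k)) → ∀ J → Q 0 → ¬ Q J → ∃ λ j → Q j × ¬ Q (suc j)
  switch dec zero q ¬q = ⊥-elim (¬q q)
  switch dec (suc J) q ¬q with dec J
  ... | yes p = J , p , ¬q
  ... | no ¬p = switch dec J q ¬p

  common-denom : ∀ {k} (q : Fin k → ℚ) → ∃ λ κ → Int κ × 0ℚ < κ × (∀ i → Int (κ * q i))
  common-denom {zero} q = 1ℚ , Int-1 , 0<1 , λ ()
  common-denom {suc k} q with denom (q Fin.zero) | common-denom (q ∘ Fin.suc)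
  ... | κ₁ , h₁ | κ₂ , i₂ , p₂ , h₂ = fromℕ (suc κ₁) * κ₂ , Int-* (Int-fromℕ (suc κ₁)) i₂ , 0<* (0<fromℕsuc κ₁) p₂ ,
    λ { Fin.zero → subst Int (solve 3 (λ a b x → b :* (a :* x) := a :* b :* x) refl (fromℕ (suc κ₁)) κ₂ (q Fin.zero))
        (Int-* i₂ h₁)
      ; (Fin.suc i) → subst Int (solve 3 (λ a b x → a :* (b :* x) := a :* b :* x) refl (fromℕ (suc κ₁)) κ₂ (q (Fin.suc i)))
          (Int-* (Int-fromℕ (suc κ₁)) (h₂ i)) }

  -- κ clears the denominators of δ / D₀, so that translation by κ δ preserves the real roots of norm D₀.
  module Shift (D₀ : ℚ) where
    private
      cd = common-denom (λ i → d i * (inv D₀ * δ ! i))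
    κ : ℚ
    κ = proj₁ cd
    κ-Int : Int κ
    κ-Int = proj₁ (proj₂ cd)
    κ>0 : 0ℚ < κ
    κ>0 = proj₁ (proj₂ (proj₂ cd))

    RL-κ : ∀ {v z} → RL v → D v ≡ D₀ → Int z → RL (v ⊹ (z * κ) ∙ δ)
    RL-κ {v} {z} r e iz = RL-shift r (Int-* iz κ-Int) (λ i → subst Int (solve 5
        (λ z k d j x → z :* (k :* (d :* (j :* x))) := d :* (j :* (z :* k) :* x)) refl z κ (d i) (inv D₀) (δ ! i) ■
        cong (d i *_) (cong (λ w → inv w * (z * κ) * δ ! i) (sym e) ■ sym (!-∙ (inv (D v) * (z * κ)) δ i)))
            (Int-* iz (proj₂ (proj₂ (proj₂ cd)) i)))

    some-pos : ∀ {v} → RL v → 0ℚ < v ! i₀ → Positive v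
    some-pos {v} r p = go (coherent r)
      where
      go : Positive v ⊎ Positive ((- 1ℚ) ∙ v) → Positive v
      go (inj₁ q) = q
      go (inj₂ q) = ⊥-elim (<⇒≱' p (≤0-neg (subst (0ℚ ≤_) (!-∙ (- 1ℚ) v i₀ ■ solve 1 (λ x → con (- 1ℚ) :* x := :- x) refl
          (v ! i₀)) (proj₁ q i₀))))

    κδ>0 : 0ℚ < κ * δ ! i₀
    κδ>0 = 0<* κ>0 (δ>0 i₀)

    lift : ∀ {v} → RL v → D v ≡ D₀ → ∃ λ z → Int z × RL (v ⊹ (z * κ) ∙ δ) × Positive (v ⊹ (z * κ) ∙ δ)
    lift {v} r e = fromℕ k , Int-fromℕ k , r′ , some-pos r′
        (subst (0ℚ <_) (sym (!-lin v (fromℕ k * κ) δ i₀)) (subst (0ℚ <_) (solve 4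
        (λ k κ d v → k :* (κ :* d) :- :- v := v :+ k :* κ :* d) refl (fromℕ k) κ (δ ! i₀) (v ! i₀)) (0<- (proj₂ ar))))
      where
      ar = arch* (- (v ! i₀)) κδ>0
      k = proj₁ ar
      r′ = RL-κ r e (Int-fromℕ k)

    -- Translating down by κδ, stop at a positive root whose next translate is not positive. By
    -- coherence that translate is nonpositive in every coordinate, which bounds the chosen root by
    -- κδ.
    reduce : ∀ {v} → RL v → D v ≡ D₀ → ∃ λ z → Int z × RL (v ⊹ (z * κ) ∙ δ) × Positive (v ⊹ (z * κ) ∙ δ) ×
        (∀ i → (v ⊹ (z * κ) ∙ δ) ! i ≤ κ * δ ! i)
    reduce {v} r e = finish (switch {λ j → Positive (w j)} (λ j → positive? (RLw j)) J q0 ¬qJ)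
      where
      up = lift r e
      z₀ = proj₁ up
      zz : ℕ → ℚ
      zz j = z₀ - fromℕ j
      Int-zz : ∀ j → Int (zz j)
      Int-zz j = Int-- (proj₁ (proj₂ up)) (Int-fromℕ j)
      w : ℕ → V
      w j = v ⊹ (zz j * κ) ∙ δ
      RLw : ∀ j → RL (w j)
      RLw j = RL-κ r e (Int-zz j)
      q0 : Positive (w 0)
      q0 = subst (λ z → Positive (v ⊹ (z * κ) ∙ δ)) (solve 1 (λ z → z := z :- con 0ℚ) refl z₀) (proj₂ (proj₂ (proj₂ up)))
      ar = arch* (v ! i₀ + z₀ * κ * δ ! i₀) κδ>0
      J = proj₁ ar
      ¬qJ : ¬ Positive (w J)
      ¬qJ q = <⇒≱' (proj₂ ar) (0≤-⇒≤ (subst (0ℚ ≤_) (!-lin v (zz J * κ) δ i₀ ■ solve 5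
          (λ v z j k d → v :+ (z :- j) :* k :* d := v :+ z :* k :* d :- j :* (k :* d)) refl (v ! i₀) z₀ (fromℕ J) κ (δ ! i₀))
          (proj₁ q i₀)))
      finish : (∃ λ j → Positive (w j) × ¬ Positive (w (suc j))) → ∃ λ z → Int z × RL (v ⊹ (z * κ) ∙ δ) × Positive
          (v ⊹ (z * κ) ∙ δ) × (∀ i → (v ⊹ (z * κ) ∙ δ) ! i ≤ κ * δ ! i)
      finish (j , p , ¬p) = zz j , Int-zz j , RLw j , p , bd (coherent (RLw (suc j)))
        where
        bd : Positive (w (suc j)) ⊎ Positive ((- 1ℚ) ∙ w (suc j)) → ∀ i → w j ! i ≤ κ * δ ! i
        bd (inj₁ q) = ⊥-elim (¬p q)
        bd (inj₂ q) i = by≤ (proj₁ q i) (cong₂ _+_ (!-lin v (zz j * κ) δ i) (!-∙ (- 1ℚ) (w (suc j)) i ■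
            cong ((- 1ℚ) *_) (!-lin v (zz (suc j) * κ) δ i ■ cong (λ x → v ! i + (z₀ - x) * κ * δ ! i) (fromℕ-suc j))) ■
          solve 5 (λ v z j k d → v :+ (z :- j) :* k :* d :+ con (- 1ℚ) :* (v :+ (z :- (con 1ℚ :+ j)) :* k :* d) := k :* d) refl
              (v ! i) z₀ (fromℕ j) κ (δ ! i))

  fromℕ-≤ : ∀ {k l} → fromℕ k ≤ fromℕ l → k ℕ.≤ l
  fromℕ-≤ {k} {l} p with k ℕ.≤? l
  ... | yes q = q
  ... | no q = ⊥-elim (<⇒≱' (subst (fromℕ l <_) (cong fromℕ (ℕₚ.m+[n∸m]≡n (ℕₚ.≰⇒> q)))
      (subst (fromℕ l <_) (sym (fromℕ-+ (suc l) (k ℕ.∸ suc l)) ■ refl)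
     (by< {fromℕ l} (0<+ 0<1 (0≤fromℕ (k ℕ.∸ suc l))) (solve 2 (λ a b → a :+ (con 1ℚ :+ b) := con 1ℚ :+ a :+ b) refl (fromℕ l)
         (fromℕ (k ℕ.∸ suc l)) ■ cong (_+ fromℕ (k ℕ.∸ suc l)) (sym (fromℕ-suc l)))))) p)

  term≤sum : ∀ {k} {f : Fin k → ℚ} → (∀ i → 0ℚ ≤ f i) → ∀ i → f i ≤ sumFin f
  term≤sum {suc k} {f} h Fin.zero = by≤ (sum-≥0 (h ∘ Fin.suc)) refl
  term≤sum {suc k} {f} h (Fin.suc i) = ≤-trans (term≤sum (h ∘ Fin.suc) i)
      (by≤ (h Fin.zero) (+-comm (sumFin (f ∘ Fin.suc)) (f Fin.zero)))

  -- Modulo δ there are only finitely many real roots of given norm.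
  c^-recurs : ∀ {v} → RL v → ∃₂ λ N t → c^ (suc N) v ≡ v ⊹ t ∙ δ
  c^-recurs {v} r = finish (Finₚ.pigeonhole (ℕₚ.n<1+n (suc B ℕ.^ n)) (λ k → code (toℕ k)))
    where
    open Shift (D v)
    red : ∀ k → ∃ λ z → Int z × RL (c^ k v ⊹ (z * κ) ∙ δ) × Positive (c^ k v ⊹ (z * κ) ∙ δ) ×
        (∀ i → (c^ k v ⊹ (z * κ) ∙ δ) ! i ≤ κ * δ ! i)
    red k = reduce (RL-c^ k r) (E-c^ k v v)
    w : ℕ → V
    w k = c^ k v ⊹ (proj₁ (red k) * κ) ∙ δ
    nn : ∀ k i → ∃ λ l → w k ! i ≡ fromℕ l
    nn k i = Int-nonneg (int (proj₁ (proj₂ (proj₂ (red k)))) i) (proj₁ (proj₁ (proj₂ (proj₂ (proj₂ (red k))))) i)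
    bnd = arch (sumFin (λ i → κ * δ ! i))
    B = proj₁ bnd
    nn≤ : ∀ k i → proj₁ (nn k i) ℕ.≤ B
    nn≤ k i = fromℕ-≤ (≤-trans (≤-reflexive (sym (proj₂ (nn k i))))
        (≤-trans (proj₂ (proj₂ (proj₂ (proj₂ (red k)))) i) (≤-trans (term≤sum {n} {λ i → κ * δ ! i}
        (λ i → <⇒≤ (0<* κ>0 (δ>0 i))) i) (proj₂ bnd))))
    digit : ∀ k → Fin n → Fin (suc B)
    digit k i = Fin.fromℕ< (s≤s (nn≤ k i))
    -- The reduced iterates have natural coordinates bounded by `B`, so they are coded by `n` digits
    -- in base `suc B`.
    code : ∀ k → Fin (suc B ℕ.^ n)
    code k = Fin.funToFin (digit k)
    same : ∀ {k l} → code k ≡ code l → w k ≡ w l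
    same {k} {l} h = vext (λ i → proj₂ (nn k i) ■ cong fromℕ (sym (Finₚ.toℕ-fromℕ< (s≤s (nn≤ k i))) ■
        cong toℕ (sym (Finₚ.finToFun-funToFin (digit k) i) ■ cong (λ z → Fin.finToFun z i) h ■
        Finₚ.finToFun-funToFin (digit l) i) ■ Finₚ.toℕ-fromℕ< (s≤s (nn≤ l i))) ■ sym (proj₂ (nn l i)))
    finish : (∃₂ λ i j → i Fin.< j × code (toℕ i) ≡ code (toℕ j)) → ∃₂ λ N t → c^ (suc N) v ≡ v ⊹ t ∙ δ
    finish (i , j , lt , eq) = N , t , c^-inj (toℕ i) (sym (c^-+ (toℕ i) (suc N) v) ■ cong (λ z → c^ z v) j≡ ■ lem ■
        sym (c^-δ (toℕ i) v t))
      where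
      N = toℕ j ℕ.∸ suc (toℕ i)
      j≡ : toℕ i ℕ.+ suc N ≡ toℕ j
      j≡ = ℕₚ.+-suc (toℕ i) N ■ ℕₚ.m+[n∸m]≡n lt
      zi = proj₁ (red (toℕ i)) * κ
      zj = proj₁ (red (toℕ j)) * κ
      t = zi + - zj
      lem : c^ (toℕ j) v ≡ c^ (toℕ i) v ⊹ t ∙ δ
      lem = sym (⊹∙⊹∙ (c^ (toℕ j) v) zj (- zj) δ ■ cong (λ z → c^ (toℕ j) v ⊹ z ∙ δ) (+-inverseʳ zj) ■
          ⊹0∙ (c^ (toℕ j) v) δ) ■
        cong (λ z → z ⊹ (- zj) ∙ δ) (sym (same {toℕ i} {toℕ j} eq)) ■ ⊹∙⊹∙ (c^ (toℕ i) v) zi (- zj) δ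

  S : ℕ → V → V
  S zero v = zeroV
  S (suc k) v = S k v ⊹ 1ℚ ∙ c^ k v

  g-S : ∀ k v → g (S k v) ≡ fromℕ k * g v
  g-S zero v = E0ʳ δ ■ sym (*-zeroˡ (g v))
  g-S (suc k) v = g-lin (S k v) 1ℚ (c^ k v) ■ cong₂ (λ x y → x + 1ℚ * y) (g-S k v) (g-c^ k v) ■
      solve 2 (λ k x → k :* x :+ con 1ℚ :* x := (con 1ℚ :+ k) :* x) refl (fromℕ k) (g v) ■ cong (_* g v) (sym (fromℕ-suc k))

  S-c : ∀ k v → c (S k v) ⊹ 1ℚ ∙ v ≡ S (suc k) v
  S-c zero v = cong (_⊹ 1ℚ ∙ v) c-zero
  S-c (suc k) v = cong (_⊹ 1ℚ ∙ v) (c-lin (S k v) 1ℚ (c^ k v)) ■ sw (c (S k v)) (c^ (suc k) v) v ■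
      cong (_⊹ 1ℚ ∙ c^ (suc k) v) (S-c k v)
    where
    sw : ∀ x y z → x ⊹ 1ℚ ∙ y ⊹ 1ℚ ∙ z ≡ x ⊹ 1ℚ ∙ z ⊹ 1ℚ ∙ y
    sw x y z = vext (λ i → !-lin (x ⊹ 1ℚ ∙ y) 1ℚ z i ■ cong (_+ 1ℚ * z ! i) (!-lin x 1ℚ y i) ■
        solve 4 (λ o x y z → x :+ o :* y :+ o :* z := x :+ o :* z :+ o :* y) refl 1ℚ (x ! i) (y ! i) (z ! i) ■
        sym (!-lin (x ⊹ 1ℚ ∙ z) 1ℚ y i ■ cong (_+ 1ℚ * y ! i) (!-lin x 1ℚ z i)))

  -- The orbit sum Σ over a period satisfies cΣ = Σ + tδ = Σ + t(c - 1)γ, so Σ - tγ is fixed by `c`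
  -- and is a multiple of δ. Applying `g` gives `drift`: the translation `t` has the sign opposite
  -- to `g v`, and vanishes on `U`.
  record Period (v : V) : Set where
    field
      N : ℕ
      t : ℚ
      period : c^ (suc N) v ≡ v ⊹ t ∙ δ
      orbit-sum : ∃ λ x → S (suc N) v ≡ t ∙ γ ⊹ x ∙ δ
      drift : t * (- (D γ + D γ)) ≡ fromℕ (suc N) * g v

  private
   periodic′ : ∀ {v} → RL v → Period v
   periodic′ {v} r = record { N = N ; t = t ; period = per ; orbit-sum = os ; drift = dr }
     where
     rec = c^-recurs r
     N = proj₁ rec
     t = proj₁ (proj₂ rec)
     per : c^ (suc N) v ≡ v ⊹ t ∙ δ
     per = proj₂ (proj₂ rec)
     Sv = S (suc N) v
     cS : c Sv ≡ Sv ⊹ t ∙ δ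
     cS = vext (λ i → solve 3 (λ x y o → x := (x :+ o :* y) :+ (:- (o :* y))) refl (c Sv ! i) (v ! i) 1ℚ ■
         cong (_+ - (1ℚ * v ! i)) (sym (!-lin (c Sv) 1ℚ v i) ■ cong (_! i) (S-c (suc N) v) ■ !-lin Sv 1ℚ (c^ (suc N) v) i ■
         cong (λ z → Sv ! i + 1ℚ * z) (cong (_! i) per ■ !-lin v t δ i)) ■
       solve 4 (λ s v t d → s :+ con 1ℚ :* (v :+ t :* d) :+ (:- (con 1ℚ :* v)) := s :+ t :* d) refl (Sv ! i) (v ! i) t
           (δ ! i) ■ sym (!-lin Sv t δ i))
     fixd : c (Sv ⊹ (- t) ∙ γ) ≡ Sv ⊹ (- t) ∙ γ
     fixd = c-lin Sv (- t) γ ■ cong₂ (λ x y → x ⊹ (- t) ∙ y) cS (isγ ■ sym (⊹-def γ δ)) ■ vext (λ i →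
       !-lin (Sv ⊹ t ∙ δ) (- t) (γ ⊹ δ) i ■ cong₂ (λ x y → x + (- t) * y) (!-lin Sv t δ i) (!-⊹ γ δ i) ■
           solve 4 (λ s t d g → s :+ t :* d :+ (:- t) :* (g :+ d) := s :+ (:- t) :* g) refl (Sv ! i) t (δ ! i) (γ ! i) ■
           sym (!-lin Sv (- t) γ i))
     q = c-fix fixd
     os : ∃ λ x → Sv ≡ t ∙ γ ⊹ x ∙ δ
     os = proj₁ q , vext (λ i → solve 3 (λ s t g → s := t :* g :+ (s :+ (:- t) :* g)) refl (Sv ! i) t (γ ! i) ■
         cong (t * γ ! i +_) (sym (!-lin Sv (- t) γ i) ■ cong (_! i) (proj₂ q) ■ !-∙ (proj₁ q) δ i) ■
         cong (_+ proj₁ q * δ ! i) (sym (!-∙ t γ i)) ■ sym (!-lin (t ∙ γ) (proj₁ q) δ i))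
     dr : t * (- (D γ + D γ)) ≡ fromℕ (suc N) * g v
     dr = cong (t *_) (sym (Eδ γ)) ■ sym (E∙ʳ t γ δ) ■ sym (g-δ (t ∙ γ) (proj₁ os)) ■ cong g (sym (proj₂ os)) ■ g-S (suc N) v

  abstract
    periodic : ∀ {v} → RL v → Period v
    periodic = periodic′

  -DDγ<0 : - (D γ + D γ) < 0ℚ
  -DDγ<0 = neg-<0 (0<+ Dγ>0 (<⇒≤ Dγ>0))

  record PeriodU (v : V) : Set where
    field
      N : ℕ
      period : c^ (suc N) v ≡ v
      orbit-sum : Qδ (S (suc N) v)

  periodicU : ∀ {v} → RL v → g v ≡ 0ℚ → PeriodU v
  periodicU {v} r h = record { N = N ; period = (period ■ cong (λ z → v ⊹ z ∙ δ) t≡0 ■ ⊹0∙ v δ) ; orbit-sum = proj₁ orbit-sum ,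
      (proj₂ orbit-sum ■ cong (λ z → z ∙ γ ⊹ proj₁ orbit-sum ∙ δ) t≡0 ■ cong (_⊹ proj₁ orbit-sum ∙ δ) (0∙ γ) ■ 0⊹ _) }
    where
    open Period (periodic r)
    t≡0 : t ≡ 0ℚ
    t≡0 = *≡0 { - (D γ + D γ)} (*-comm (- (D γ + D γ)) t ■ drift ■ cong (fromℕ (suc N) *_) h ■ *-zeroʳ (fromℕ (suc N)))
        (λ e → <-irrefl e -DDγ<0)

  -- By `sign-change` evaluated at δ, an inversion of `c` has `g` equal to a product `δ ! k * d k`,
  -- which is positive; so none lies in `U`.
  c-pos : ∀ {y} → RL y → Positive y → g y ≡ 0ℚ → Positive (c y)
  c-pos {y} r p h = go (positive? (RL-c r))
    where
    go : Dec (Positive (c y)) → Positive (c y)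
    go (yes q) = q
    go (no ¬q) = ⊥-elim (pos⇒≢0 (0<* (δ>0 (proj₁ sc)) (d>0 (proj₁ sc))) (sym (proj₂ sc δ) ■ h))
      where sc = sign-change r p ¬q

  c^-pos : ∀ k {y} → RL y → Positive y → g y ≡ 0ℚ → Positive (c^ k y)
  c^-pos zero r p h = p
  c^-pos (suc k) {y} r p h = c-pos (RL-c^ k r) (c^-pos k r p h) (g-c^ k y ■ h)

  c^-period : ∀ {v t N} → c^ (suc N) v ≡ v ⊹ t ∙ δ → ∀ J → c^ (J ℕ.* suc N) v ≡ v ⊹ (fromℕ J * t) ∙ δ
  c^-period {v} {t} h zero = sym (cong (λ z → v ⊹ z ∙ δ) (*-zeroˡ t) ■ ⊹0∙ v δ)
  c^-period {v} {t} {N} h (suc J) = c^-+ (suc N) (J ℕ.* suc N) v ■ cong (c^ (suc N)) (c^-period {N = N} h J) ■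
      c^-δ (suc N) v (fromℕ J * t) ■ cong (_⊹ (fromℕ J * t) ∙ δ) h ■
    ⊹∙⊹∙ v t (fromℕ J * t) δ ■ cong (λ z → v ⊹ z ∙ δ) (solve 2 (λ j t → t :+ j :* t := (con 1ℚ :+ j) :* t) refl (fromℕ J) t ■
        cong (_* t) (sym (fromℕ-suc J)))

  -- Some c-translate of a positive b outside U with g b > 0 is an inversion of c.
  E≥0 : ∀ {b y} → RL b → 0ℚ < g b → RL y → Positive y → g y ≡ 0ℚ → 0ℚ ≤ E y b
  E≥0 {b} {y} rb gb ry py gy = subst (0ℚ ≤_) Eyb (subst (0ℚ ≤_) (E-c^ j y b′)
      (subst (0ℚ ≤_) (sym (proj₂ sc (c^ j y))) (0≤* (proj₁ (c^-pos j ry py gy) (proj₁ sc)) (<⇒≤ (d>0 (proj₁ sc))))))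
    where
    open Shift (D b)
    up = lift rb refl
    z = proj₁ up
    b′ = b ⊹ (z * κ) ∙ δ
    rb′ : RL b′
    rb′ = proj₁ (proj₂ (proj₂ up))
    Eyb : E y b′ ≡ E y b
    Eyb = Eʳ y b (z * κ) δ ■ cong (λ w → E y b + z * κ * w) (E-δʳ y ■ cong -_ gy) ■
        solve 2 (λ x w → x :+ w :* (:- con 0ℚ) := x) refl (E y b) (z * κ)
    open Period (periodic rb′)
    -- As `g b` is positive, the iterates of `b′` drift by a negative multiple of δ and eventually
    -- leave the positive roots. Where the orbit first crosses in this way, `sign-change` turns
    -- `E (c^ j y) (c^ j b′)` into a nonnegative coordinate of `c^ j y` times some `d k`.
    t<0 : t < 0ℚ
    t<0 = <0-neg (0<*⇒0< (0<+ Dγ>0 (<⇒≤ Dγ>0)) (subst (0ℚ <_) (sym drift ■ solve 2 (λ t D → t :* (:- D) := D :* (:- t)) refl t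
        (D γ + D γ)) (0<* (0<fromℕsuc N) (subst (0ℚ <_) (sym (g-δ b (z * κ))) gb))))
    ar = arch* (b′ ! i₀) (0<* (0<-neg t<0) (δ>0 i₀))
    J = proj₁ ar
    ¬pJ : ¬ Positive (c^ (J ℕ.* suc N) b′)
    ¬pJ q = <⇒≱' (proj₂ ar) (0≤-⇒≤ (subst (0ℚ ≤_) (cong (_! i₀) (c^-period {N = N} period J) ■ !-lin b′ (fromℕ J * t) δ i₀ ■
        solve 4 (λ b j t d → b :+ j :* t :* d := b :- j :* ((:- t) :* d)) refl (b′ ! i₀) (fromℕ J) t (δ ! i₀)) (proj₁ q i₀)))
    sw = switch {λ k → Positive (c^ k b′)} (λ k → positive? (RL-c^ k rb′)) (J ℕ.* suc N) (proj₂ (proj₂ (proj₂ up))) ¬pJ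
    j = proj₁ sw
    sc = sign-change (RL-c^ j rb′) (proj₁ (proj₂ sw)) (proj₂ (proj₂ sw))

-- Gallery folding.  A word of reflections whose product fixes X modulo δ traces a closed loop through X; a Hurwitz
-- move at a peak of the loop (for the distance h to X) lowers the peak, unless the two roots at the peak are parallel modulo δ.
module Folding (H : AffineData) where
  open AffineData H
  open Dynamics H public

  private
    cd₁ = common-denom (λ i → g (e i))
    cd₂ = common-denom (λ i → g (e i) * inv (d i))

  -- The first factor makes the pairing of `X` with integral vectors an integer, the second does the
  -- same for coroots. Heights along a gallery are then integers and the folding descent ends.
  scl : ℚ
  scl = proj₁ cd₁ * proj₁ cd₂

  scl>0 : 0ℚ < scl
  scl>0 = 0<* (proj₁ (proj₂ (proj₂ cd₁))) (proj₁ (proj₂ (proj₂ cd₂)))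

  X : V
  X = scl ∙ γ

  ⟪X⟫ : ∀ v → ⟪ X , v ⟫ ≡ - (scl * g v)
  ⟪X⟫ v = cong₂ _+_ (E∙ˡ scl γ v) (E∙ʳ scl γ v) ■ sym (*-distribˡ-+ scl (E γ v) (E v γ)) ■
      (solve 2 (λ s x → s :* x := :- (s :* (:- x))) refl scl ⟪ γ , v ⟫) ■ cong (λ z → - (scl * z)) (sym (Eδ v))

  g-exp : ∀ v → g v ≡ sumFin (λ i → v ! i * g (e i))
  g-exp v = E-expʳ δ v

  ⟪X⟫-Int : ∀ v → IntV v → Int ⟪ X , v ⟫
  ⟪X⟫-Int v p = subst Int (sym (⟪X⟫ v ■ cong -_ (cong (scl *_) (g-exp v) ■ sym (sum-* {n} scl _)))) (Int-neg (sum-Int {n} (λ i →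
    subst Int (solve 4 (λ a b x y → b :* (x :* (a :* y)) := a :* b :* (x :* y)) refl (proj₁ cd₁) (proj₁ cd₂) (v ! i) (g (e i)))
        (Int-* (proj₁ (proj₂ cd₂)) (Int-* (p i) (proj₂ (proj₂ (proj₂ cd₁)) i))))))

  CI : V → Set
  CI x = ∀ {β} → RL β → Int (coef β x)

  CI-X : CI X
  CI-X {β} r = subst Int eq (Int-neg (sum-Int {n} (λ i → Int-* (proj₁ (proj₂ cd₁))
      (Int-* (coint r i) (proj₂ (proj₂ (proj₂ cd₂)) i)))))
    where
    eq : - sumFin (λ i → proj₁ cd₁ * (d i * (inv (D β) ∙ β) ! i * (proj₁ cd₂ * (g (e i) * inv (d i))))) ≡ coef β X
    eq = cong -_ (sum-cong {n} (λ i → cong (λ z → proj₁ cd₁ * (d i * z * (proj₁ cd₂ * (g (e i) * inv (d i)))))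
        (!-∙ (inv (D β)) β i) ■
        solve 7 (λ a b d j x y k → a :* (d :* (j :* x) :* (b :* (y :* k))) := a :* b :* j :* (x :* y) :* (k :* d)) refl
            (proj₁ cd₁) (proj₁ cd₂) (d i) (inv (D β)) (β ! i) (g (e i)) (inv (d i)) ■
          cong (scl * inv (D β) * (β ! i * g (e i)) *_) (inv-* (pos⇒≢0 (d>0 i))) ■
              *-identityʳ (scl * inv (D β) * (β ! i * g (e i)))) ■ sum-* {n} (scl * inv (D β)) _ ■
              cong (scl * inv (D β) *_) (sym (g-exp β))) ■
      solve 3 (λ s j x → :- (s :* j :* x) := (:- (s :* x)) :* j) refl scl (inv (D β)) (g β) ■
          cong (_* inv (D β)) (sym (⟪X⟫ β) ■ ⟪⟫-comm X β)

  CI-refl : ∀ {η x} → RL η → CI x → CI (refl-by η x)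
  CI-refl {η} {x} r p {β} rβ = subst Int (sym (coef-lin β x (- coef η x) η))
      (Int-+ (p rβ) (Int-* (Int-neg (p r)) (coef-Int rβ (int r))))

  CI-act : ∀ {L} → All RL L → CI (actR L X)
  CI-act [] = CI-X
  CI-act (r ∷ rs) = CI-refl r (CI-act rs)

  -- On vectors of the same norm as `X` this equals `D (X - x)`, a squared distance that is affine
  -- in `x`.
  h : V → ℚ
  h x = D X + D X - ⟪ X , x ⟫

  h-step : ∀ x q v → h (x ⊹ q ∙ v) ≡ h x - q * ⟪ X , v ⟫
  h-step x q v = cong (λ z → D X + D X - z) (⟪⟫ʳ X x q v) ■
      (solve 4 (λ d x q v → d :- (x :+ q :* v) := d :- x :- q :* v) refl (D X + D X) ⟪ X , x ⟫ q ⟪ X , v ⟫)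

  h-refl : ∀ β x → h (refl-by β x) ≡ h x + coef β x * ⟪ X , β ⟫
  h-refl β x = h-step x (- coef β x) β ■ (solve 3 (λ h k v → h :- (:- k) :* v := h :+ k :* v) refl (h x) (coef β x) ⟪ X , β ⟫)

  D-act : ∀ {L} x → All RL L → D (actR L x) ≡ D x
  D-act x [] = refl
  D-act {β ∷ L} x (r ∷ rs) = refl-D (actR L x) (D≢0 r) ■ D-act x rs

  hX : h X ≡ 0ℚ
  hX = +-inverseʳ (D X + D X)

  h≥0 : ∀ {L} → All RL L → 0ℚ ≤ h (actR L X)
  h≥0 {L} rs = subst (0ℚ ≤_) (D-lin X (- 1ℚ) (actR L X) ■ cong (λ z → D X + (- 1ℚ) * ⟪ X , actR L X ⟫ + (- 1ℚ) * (- 1ℚ) * z)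
      (D-act X rs) ■
    (solve 2 (λ d y → d :+ con (- 1ℚ) :* y :+ con (- 1ℚ) :* con (- 1ℚ) :* d := d :+ d :- y) refl (D X) ⟪ X , actR L X ⟫))
        (D≥0 (X ⊹ (- 1ℚ) ∙ actR L X))

  h-Int : ∀ {L} → All RL L → Int (h (actR L X))
  h-Int [] = subst Int (sym hX) Int-0
  h-Int {β ∷ L} (r ∷ rs) = subst Int (sym (h-refl β (actR L X))) (Int-+ (h-Int rs) (Int-* (CI-act rs r) (⟪X⟫-Int β (int r))))

  -- Total height of the vertices of the gallery read from the right end of the word. A Hurwitz move
  -- of two adjacent letters changes only the vertex between them.
  μ : List V → ℚ
  μ [] = 0ℚ
  μ (β ∷ L) = h (actR (β ∷ L) X) + μ L

  μ≥0 : ∀ {L} → All RL L → 0ℚ ≤ μ L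
  μ≥0 [] = ≤-refl
  μ≥0 (r ∷ rs) = 0≤+ (h≥0 (r ∷ rs)) (μ≥0 rs)

  μ-Int : ∀ {L} → All RL L → Int (μ L)
  μ-Int [] = Int-0
  μ-Int (r ∷ rs) = Int-+ (h-Int (r ∷ rs)) (μ-Int rs)

  refl-conj : ∀ {β} η v → D β ≢ 0ℚ → refl-by (refl-by β η) (refl-by β v) ≡ refl-by β (refl-by η v)
  refl-conj {β} η v p = cong (λ z → refl-by β v ⊹ (- z) ∙ refl-by β η)
      (cong₂ (λ x y → x * inv y) (refl-iso η v p) (refl-D η p)) ■ sym (refl-lin β v (- coef η v) η)

  Perp : V → List V → Set
  Perp η = All (λ β → E η β ≡ 0ℚ)

  E-refl0 : ∀ {ζ β η} → E ζ β ≡ 0ℚ → E ζ η ≡ 0ℚ → E ζ (refl-by β η) ≡ 0ℚ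
  E-refl0 {ζ} {β} {η} p q = Eʳ ζ η (- coef β η) β ■ cong₂ (λ x y → x + (- coef β η) * y) q p ■
      solve 1 (λ k → con 0ℚ :+ k :* con 0ℚ := con 0ℚ) refl (- coef β η)

  E-refl0ˡ : ∀ {ζ β η} → E β ζ ≡ 0ℚ → E η ζ ≡ 0ℚ → E (refl-by β η) ζ ≡ 0ℚ
  E-refl0ˡ {ζ} {β} {η} p q = Eˡ η (- coef β η) β ζ ■ cong₂ (λ x y → x + (- coef β η) * y) q p ■
      solve 1 (λ k → con 0ℚ :+ k :* con 0ℚ := con 0ℚ) refl (- coef β η)

  record Parallel (β β′ : V) : Set where
    field
      t x : ℚ
      eq : β ≡ t ∙ β′ ⊹ x ∙ δ

  -- Ψ is a linear condition on the letters that survives Hurwitz moves: trivial in the first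
  -- folding, E-orthogonality to the parallel pair already found in the second.
  module Fold (Ψ : V → Set) (Ψ-lin : ∀ {u q v} → Ψ u → Ψ v → Ψ (u ⊹ q ∙ v)) where

    record Good (L : List V) : Set where
      constructor good
      field
        rl  : All RL L
        exc : Exc L
        ψ   : All Ψ L
    open Good

    -- what a sequence of Hurwitz moves preserves
    record _↝_ (L L′ : List V) : Set where
      constructor mk↝
      field
        good′ : Good L′
        same  : ∀ v → actR L′ v ≡ actR L v
        perp  : ∀ η → Perp η L → Perp η L′
    open _↝_

    ↝-refl : ∀ {L} → Good L → L ↝ L
    ↝-refl gd = mk↝ gd (λ _ → refl) (λ _ p → p)

    ↝-trans : ∀ {L M N} → L ↝ M → M ↝ N → L ↝ N
    ↝-trans a b = mk↝ (good′ b) (λ v → same b v ■ same a v) (λ η p → perp b η (perp a η p))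

    tail : ∀ {β L} → Good (β ∷ L) → Good L
    tail (good (_ ∷ r) (_ ∷ x) (_ ∷ y)) = good r x y

    ↝-∷ : ∀ {β L M} → Good (β ∷ L) → L ↝ M → (β ∷ L) ↝ (β ∷ M)
    ↝-∷ {β} (good (r ∷ _) (x ∷ _) (y ∷ _)) a = mk↝ (good (r ∷ rl (good′ a)) (perp a β x ∷ exc (good′ a)) (y ∷ ψ (good′ a)))
        (λ v → cong (refl-by β) (same a v)) (λ { η (p ∷ ps) → p ∷ perp a η ps })

    -- The product is kept because s_η s_β = s_β s_{s_β η}. The sequence stays exceptional because
    -- E(β, s_β η) = E(β, η) - ⟪β, η⟫ = -E(η, β).
    hopʳ : ∀ {η β L} → Good (η ∷ β ∷ L) → (η ∷ β ∷ L) ↝ (β ∷ refl-by β η ∷ L)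
    hopʳ {η} {β} {L} (good (r ∷ r′ ∷ rs) ((x ∷ xs) ∷ xs′ ∷ xss) (y ∷ y′ ∷ ys)) = mk↝
      (good (r′ ∷ RL-refl r′ r ∷ rs) ((skew ∷ xs′) ∷ go xs xs′ ∷ xss) (y′ ∷ Ψ-lin y y′ ∷ ys))
      (λ v → cong (refl-by β) (cong (refl-by (refl-by β η)) (sym (refl-invol (actR L v) (D≢0 r′))) ■
          refl-conj η (refl-by β (actR L v)) (D≢0 r′)) ■ refl-invol (refl-by η (refl-by β (actR L v))) (D≢0 r′))
      (λ { ζ (p ∷ p′ ∷ ps) → p′ ∷ E-refl0 p′ p ∷ ps })
      where
      skew : E β (refl-by β η) ≡ 0ℚ
      skew = Eʳ β η (- coef β η) β ■ solve 3 (λ a k b → a :+ (:- k) :* b := a :- k :* b) refl (E β η) (coef β η) (D β) ■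
          cong (λ z → E β η - z) (coef-* η (D≢0 r′)) ■ solve 2 (λ a b → a :- (a :+ b) := :- b) refl (E β η) (E η β) ■ cong -_ x
      go : ∀ {M} → Perp η M → Perp β M → Perp (refl-by β η) M
      go [] [] = []
      go (a ∷ as) (b ∷ bs) = E-refl0ˡ b a ∷ go as bs

    hopˡ : ∀ {η β L} → Good (η ∷ β ∷ L) → (η ∷ β ∷ L) ↝ (refl-by η β ∷ η ∷ L)
    hopˡ {η} {β} {L} (good (r ∷ r′ ∷ rs) ((x ∷ xs) ∷ xs′ ∷ xss) (y ∷ y′ ∷ ys)) = mk↝
      (good (RL-refl r r′ ∷ r ∷ rs) ((skew ∷ go xs′ xs) ∷ xs ∷ xss) (Ψ-lin y′ y ∷ y ∷ ys))
      (λ v → refl-conj β (actR L v) (D≢0 r))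
      (λ { ζ (p ∷ p′ ∷ ps) → E-refl0 p p′ ∷ p ∷ ps })
      where
      skew : E (refl-by η β) η ≡ 0ℚ
      skew = Eˡ β (- coef η β) η η ■ solve 3 (λ a k b → a :+ (:- k) :* b := a :- k :* b) refl (E β η) (coef η β) (D η) ■
          cong (λ z → E β η - z) (coef-* β (D≢0 r)) ■ solve 2 (λ a b → a :- (b :+ a) := :- b) refl (E β η) (E η β) ■ cong -_ x
      go : ∀ {M} → Perp β M → Perp η M → Perp (refl-by η β) M
      go [] [] = []
      go (a ∷ as) (b ∷ bs) = E-refl0ˡ b a ∷ go as bs

    record ParFront (L : List V) : Set where
      constructor parFront
      field
        β β′ : V
        M : List V
        moved : L ↝ (β ∷ β′ ∷ M)
        par : Parallel β β′
        gβ≢0 : g β ≢ 0ℚ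

    -- The gallery is read from its start `X` at the right end of the word: it has not moved
    -- (`flat`), or its latest step climbs (`up`). A non-climbing step after a climb makes a peak,
    -- which is lowered by a hop (`peak`) or has parallel roots, then brought to the front (`par`).
    data Scan (L : List V) : Set where
      flat : All (λ β → g β ≡ 0ℚ) L → Scan L
      peak : ∀ {L′} → L ↝ L′ → μ L′ < μ L → Scan L
      par  : ParFront L → Scan L
      up   : ∀ {β L₂} → L ≡ β ∷ L₂ → h (actR L₂ X) < h (actR L X) → Scan L

    flat-fix : ∀ {L} → All (λ β → g β ≡ 0ℚ) L → actR L X ≡ X
    flat-fix [] = refl
    flat-fix {β ∷ L} (p ∷ ps) = cong (refl-by β) (flat-fix ps) ■
        refl-orth (⟪⟫-comm β X ■ ⟪X⟫ β ■ cong (λ z → - (scl * z)) p ■ solve 1 (λ s → :- (s :* con 0ℚ) := con 0ℚ) refl scl)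

    -- The arithmetic of a peak; k k′ < 4 for roots that are not parallel modulo δ.
    module Peak {β β′ L} (gd : Good (β ∷ β′ ∷ L)) (asc : h (actR L X) < h (actR (β′ ∷ L) X))
        (desc : h (actR (β ∷ β′ ∷ L) X) ≤ h (actR (β′ ∷ L) X)) where
      private
        rβ : RL β
        rβ = All.head (rl gd)
        rβ′ : RL β′
        rβ′ = All.head (All.tail (rl gd))
        -- The vertices `x₀`, `pt`, `refl-by β pt` have heights `h pt - B`, `h pt`, `h pt - A₁`. The
        -- move `hopˡ` replaces `pt` by s_β x₀ (computed in `h₁`), the move `hopʳ` by s_β′ s_β pt
        -- (computed in `h₂`).
        x₀ = actR L X
        pt = refl-by β′ x₀
        l = coef β pt
        l′ = coef β′ x₀
        φ = ⟪ X , β ⟫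
        φ′ = ⟪ X , β′ ⟫
        k = coef β β′
        k′ = coef β′ β
        A₁ = - (l * φ)
        B = l′ * φ′

      B>0 : 0ℚ < B
      B>0 = subst (0ℚ <_) (cong (_- h x₀) (h-refl β′ x₀) ■ solve 2 (λ x y → x :+ y :- x := y) refl (h x₀) B) (0<- asc)

      A₁≥0 : 0ℚ ≤ A₁
      A₁≥0 = subst (0ℚ ≤_) (cong (λ z → h pt - z) (h-refl β pt) ■ solve 2 (λ x y → x :- (x :+ y) := :- y) refl (h pt) (l * φ))
          (0≤- desc)

      lx : coef β x₀ ≡ l + l′ * k
      lx = solve 3 (λ a l k → a := a :+ (:- l) :* k :+ l :* k) refl (coef β x₀) l′ k ■
          cong (_+ l′ * k) (sym (coef-lin β x₀ (- l′) β′))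

      h₁ : h (refl-by β x₀) ≡ h pt - (B - (l + l′ * k) * φ)
      h₁ = h-refl β x₀ ■ cong (λ z → h x₀ + z * φ) lx ■ solve 3 (λ h b z → h :+ z := h :+ b :- (b :- z)) refl (h x₀) B
          ((l + l′ * k) * φ) ■ cong (_- (B - (l + l′ * k) * φ)) (sym (h-refl β′ x₀))

      h₂ : h (refl-by β′ (refl-by β pt)) ≡ h pt - (A₁ + B + l * k′ * φ′)
      h₂ = h-refl β′ (refl-by β pt) ■ cong₂ (λ x y → x + y * φ′) (h-refl β pt) (coef-lin β′ pt (- l) β ■
          cong (_+ (- l) * k′) (coef-refl-by x₀ (D≢0 rβ′))) ■
        solve 6 (λ h l f m k f′ → h :+ l :* f :+ (:- m :+ (:- l) :* k) :* f′ := h :-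
            (:- (l :* f) :+ m :* f′ :+ l :* k :* f′)) refl (h pt) l φ l′ k′ φ′

      drop : ∀ {x y} → 0ℚ < y → h x ≡ h pt - y → h x < h pt
      drop {x} {y} p eq = by< p (cong (_+ y) eq ■ solve 2 (λ a b → a :- b :+ b := a) refl (h pt) y)

      opt₁ : 0ℚ < B - (l + l′ * k) * φ → μ (refl-by β β′ ∷ β ∷ L) < μ (β ∷ β′ ∷ L)
      opt₁ p = subst (λ z → h z + (h (refl-by β x₀) + μ L) < μ (β ∷ β′ ∷ L)) (sym (same (hopˡ gd) X))
          (+-monoʳ-< (h (refl-by β pt)) (+-monoˡ-< (μ L) (drop p h₁)))

      mid₂ : refl-by (refl-by β′ β) x₀ ≡ refl-by β′ (refl-by β pt)
      mid₂ = cong (refl-by (refl-by β′ β)) (sym (refl-invol x₀ (D≢0 rβ′))) ■ refl-conj β pt (D≢0 rβ′)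

      opt₂ : 0ℚ < A₁ + B + l * k′ * φ′ → μ (β′ ∷ refl-by β′ β ∷ L) < μ (β ∷ β′ ∷ L)
      opt₂ p = subst (λ z → h z + (h (refl-by (refl-by β′ β) x₀) + μ L) < μ (β ∷ β′ ∷ L)) (sym (same (hopʳ gd) X))
          (+-monoʳ-< (h (refl-by β pt)) (+-monoˡ-< (μ L) (subst (λ z → h z < h pt) (sym mid₂) (drop p h₂))))

      -- If neither hop lowers the peak, `u` and `w` are both at least A₁ + B, while their product
      -- is k k′ A₁ B. Comparison with (A₁ + B)² ≥ 4 A₁ B gives k k′ ≥ 4. Then β - (k′/2) β′, whose
      -- norm is (4 - k k′)/4 times `D β`, must be a multiple of δ.
      module Both (f₁ : B - (l + l′ * k) * φ ≤ 0ℚ) (f₂ : A₁ + B + l * k′ * φ′ ≤ 0ℚ) where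
        AB = A₁ + B
        AB>0 : 0ℚ < AB
        AB>0 = subst (0ℚ <_) (+-comm B A₁) (0<+ B>0 A₁≥0)
        u = l′ * k * φ
        w = - (l * k′ * φ′)
        u≥ : AB ≤ u
        u≥ = by≤ (0≤-neg f₁) (solve 5 (λ l f m k f′ → :- (l :* f) :+ m :* f′ :+ :-
            (m :* f′ :- (l :+ m :* k) :* f) := m :* k :* f) refl l φ l′ k φ′)
        w≥ : AB ≤ w
        w≥ = by≤ (0≤-neg f₂) (solve 2 (λ a z → a :+ :- (a :+ z) := :- z) refl AB (l * k′ * φ′))
        uw : u * w ≡ k * k′ * (A₁ * B)
        uw = solve 6 (λ l f m k k′ f′ → m :* k :* f :* (:- (l :* k′ :* f′)) := k :* k′ :*
            ((:- (l :* f)) :* (m :* f′))) refl l φ l′ k k′ φ′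
        sq : AB * AB ≤ u * w
        sq = by≤ (0≤+ (0≤* (0≤- u≥) (≤-trans (<⇒≤ AB>0) w≥)) (0≤* (<⇒≤ AB>0) (0≤- w≥)))
            (solve 3 (λ s u w → s :* s :+ ((u :- s) :* w :+ s :* (w :- s)) := u :* w) refl AB u w)
        AB>0′ : 0ℚ < A₁ * B
        AB>0′ = ≤∧≢⇒< (0≤* A₁≥0 (<⇒≤ B>0)) (λ e → <⇒≱' (0<* AB>0 AB>0) (≤-trans sq
            (≤-reflexive (uw ■ cong (k * k′ *_) e ■ *-zeroʳ (k * k′)))))
        kk′≥4 : 0ℚ ≤ k * k′ - 2ℚ * 2ℚ
        kk′≥4 = 0≤*⇒0≤ AB>0′ (subst (0ℚ ≤_) (solve 3 (λ K a b → (K :* (a :* b) :- (a :+ b) :* (a :+ b)) :+ (a :- b) :*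
            (a :- b) := a :* b :* (K :- con 2ℚ :* con 2ℚ)) refl (k * k′) A₁ B)
            (0≤+ (0≤- (≤-trans sq (≤-reflexive uw))) (sq≥0 (A₁ - B))))
        t = k′ * inv 2ℚ
        t2 : t * 2ℚ ≡ k′
        t2 = *-assoc k′ (inv 2ℚ) 2ℚ ■ cong (k′ *_) (inv-* (pos⇒≢0 0<2)) ■ *-identityʳ k′
        sym⟪⟫ : k * D β ≡ k′ * D β′
        sym⟪⟫ = coef-* β′ (D≢0 rβ) ■ ⟪⟫-comm β β′ ■ sym (coef-* β (D≢0 rβ′))
        -- 4 D (β - t β′) = (4 - k k′) D β
        four : 2ℚ * 2ℚ * D (β ⊹ (- t) ∙ β′) ≡ - ((k * k′ - 2ℚ * 2ℚ) * D β)
        four = cong (2ℚ * 2ℚ *_) (D-lin β (- t) β′ ■ cong (λ z → D β + (- t) * z + (- t) * (- t) * D β′)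
            (⟪⟫-comm β β′ ■ sym (coef-* β (D≢0 rβ′)))) ■
          solve 4 (λ t k x y → con 2ℚ :* con 2ℚ :* (x :+ (:- t) :* (k :* y) :+ (:- t) :*
              (:- t) :* y) := con 2ℚ :* con 2ℚ :* x :- con 2ℚ :* (t :* con 2ℚ) :* (k :* y) :+ (t :* con 2ℚ) :*
              (t :* con 2ℚ) :* y) refl t k′ (D β) (D β′) ■
          cong (λ z → 2ℚ * 2ℚ * D β - 2ℚ * z * (k′ * D β′) + z * z * D β′) t2 ■
          solve 3 (λ k x y → con 2ℚ :* con 2ℚ :* x :- con 2ℚ :* k :* (k :* y) :+ k :* k :* y := con 2ℚ :* con 2ℚ :* x :- k :*
              (k :* y)) refl k′ (D β) (D β′) ■
          cong (λ z → 2ℚ * 2ℚ * D β - k′ * z) (sym sym⟪⟫) ■ solve 3 (λ k k′ x → con 2ℚ :* con 2ℚ :* x :- k′ :* (k :* x) := :-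
              ((k :* k′ :- con 2ℚ :* con 2ℚ) :* x)) refl k k′ (D β)
        Dz : D (β ⊹ (- t) ∙ β′) ≡ 0ℚ
        Dz = ≤-antisym (≤0-neg (0≤*⇒0≤ (0<* 0<2 0<2) (subst (0ℚ ≤_) (sym (neg-neg _) ■ cong -_ (sym four) ■
            solve 1 (λ x → :- (con 2ℚ :* con 2ℚ :* x) := con 2ℚ :* con 2ℚ :* (:- x)) refl (D (β ⊹ (- t) ∙ β′)))
            (0≤* kk′≥4 (<⇒≤ (D>0 rβ)))))) (D≥0 _)
        prl : Parallel β β′
        prl = record { t = t ; x = proj₁ (null Dz) ; eq = vext
            (λ i → solve 3 (λ b t c → b := t :* c :+ (b :+ (:- t) :* c)) refl (β ! i) t (β′ ! i) ■
            cong₂ _+_ (sym (!-∙ t β′ i)) (sym (!-lin β (- t) β′ i) ■ cong (_! i) (proj₂ (null Dz)) ■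
            !-∙ (proj₁ (null Dz)) δ i) ■ sym (!-lin (t ∙ β′) (proj₁ (null Dz)) δ i)) }
        φ≢0 : φ ≢ 0ℚ
        φ≢0 e = <⇒≱' AB>0 (≤-trans u≥ (≤-reflexive (cong (l′ * k *_) e ■ *-zeroʳ (l′ * k))))
        gβ≢0 : g β ≢ 0ℚ
        gβ≢0 e = φ≢0 (⟪X⟫ β ■ cong (λ z → - (scl * z)) e ■ solve 1 (λ s → :- (s :* con 0ℚ) := con 0ℚ) refl scl)

      result : Scan (β ∷ β′ ∷ L)
      result with 0ℚ <? B - (l + l′ * k) * φ
      ... | yes p = peak (hopˡ gd) (opt₁ p)
      ... | no ¬p with 0ℚ <? A₁ + B + l * k′ * φ′
      ... | yes q = peak (hopʳ gd) (opt₂ q)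
      ... | no ¬q = par (parFront β β′ L (↝-refl gd) (Both.prl (≮⇒≥ ¬p) (≮⇒≥ ¬q)) (Both.gβ≢0 (≮⇒≥ ¬p) (≮⇒≥ ¬q)))

    scan : ∀ {L} → Good L → Scan L
    scan-∷ : ∀ {β L} → Good (β ∷ L) → Scan L → Scan (β ∷ L)
    scan {[]} gd = flat []
    scan {β ∷ L} gd = scan-∷ gd (scan (tail gd))
    scan-∷ {β} {L} gd (flat fs) = go (g β ≟ 0ℚ)
      where
      r = All.head (rl gd)
      go : Dec (g β ≡ 0ℚ) → Scan (β ∷ L)
      go (yes p) = flat (p ∷ fs)
      go (no ¬p) = up refl (by< pos-part (sym hk))
        where
        hk : h (refl-by β (actR L X)) ≡ h (actR L X) + D β * (coef β X * coef β X)
        hk = cong (λ z → h (refl-by β z)) (flat-fix fs) ■ h-refl β X ■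
            cong (λ z → h X + coef β X * z) (⟪⟫-comm X β ■ sym (coef-* X (D≢0 r))) ■
          solve 3 (λ h k d → h :+ k :* (k :* d) := h :+ d :* (k :* k)) refl (h X) (coef β X) (D β) ■
              cong (λ z → h z + D β * (coef β X * coef β X)) (sym (flat-fix fs))
        coef≢0 : coef β X ≢ 0ℚ
        coef≢0 e = *≢0 (pos⇒≢0 scl>0) ¬p (sym (neg-neg (scl * g β)) ■ cong -_ (sym (⟪X⟫ β) ■ ⟪⟫-comm X β ■
            sym (coef-* X (D≢0 r)) ■ cong (_* D β) e ■ *-zeroˡ (D β)))
        pos-part : 0ℚ < D β * (coef β X * coef β X)
        pos-part = 0<* (D>0 r) (≤∧≢⇒< (sq≥0 (coef β X)) (*≢0 coef≢0 coef≢0))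
    scan-∷ {β} {L} gd (peak {L′} a lt) = peak (↝-∷ gd a) (subst (λ z → h z + μ L′ < μ (β ∷ L)) (sym (same (↝-∷ gd a) X))
        (+-monoʳ-< (h (actR (β ∷ L) X)) lt))
    -- The new letter hops to the right over both members of the pair, which thereby come to the
    -- front unchanged.
    scan-∷ {η} gd (par (parFront β β′ M mv pl gb)) = par (parFront β β′ (refl-by β′ (refl-by β η) ∷ M)
        (↝-trans s₁ (↝-trans s₂ (↝-∷ (good′ s₂) (hopʳ (tail (good′ s₂)))))) pl gb)
      where
      s₁ = ↝-∷ gd mv
      s₂ = hopʳ (good′ s₁)
    scan-∷ {β} {β′ ∷ L} gd (up refl asc) with h (actR (β′ ∷ L) X) <? h (actR (β ∷ β′ ∷ L) X)
    ... | yes p = up refl p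
    ... | no ¬p = Peak.result gd asc (≮⇒≥ ¬p)

    data Outcome (L : List V) : Set where
      flatten : ∀ {L′} → L ↝ L′ → All (λ β → g β ≡ 0ℚ) L′ → Outcome L
      par     : ParFront L → Outcome L

    -- The loop ends at height 0, so its latest step cannot be a climb: the vertex before would have
    -- negative height. In the remaining undecided case `μ`, a nonnegative integer, drops.
    fold : ∀ {L} → Good L → h (actR L X) ≡ 0ℚ → Outcome L
    fold {L} gd h0 = go (proj₁ b) gd h0 (proj₂ b)
      where
      b = arch-suc (μ L)
      go : ∀ k {L} → Good L → h (actR L X) ≡ 0ℚ → μ L < fromℕ (suc k) → Outcome L
      step : ∀ k {L} → Good L → h (actR L X) ≡ 0ℚ → μ L < fromℕ (suc k) → Scan L → Outcome L
      after : ∀ {L M} → L ↝ M → Outcome M → Outcome L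
      after a (flatten b fs) = flatten (↝-trans a b) fs
      after a (par (parFront β β′ M mv pl gb)) = par (parFront β β′ M (↝-trans a mv) pl gb)
      go k gd h0 lt = step k gd h0 lt (scan gd)
      step k gd h0 lt (flat fs) = flatten (↝-refl gd) fs
      step k gd h0 lt (par x) = par x
      step k gd h0 lt (up {β} {L₂} refl asc) = ⊥-elim (<⇒≱' asc (≤-trans (≤-reflexive h0) (h≥0 {L₂} (All.tail (rl gd)))))
      step zero gd h0 lt (peak a dec) = ⊥-elim (<⇒≱' (Int-step zero (μ-Int (rl gd)) (μ-Int (rl (good′ a))) dec lt)
          (μ≥0 (rl (good′ a))))
      step (suc k) gd h0 lt (peak a dec) = after a (go k (good′ a) (cong h (same a X) ■ h0)
          (Int-step (suc k) (μ-Int (rl gd)) (μ-Int (rl (good′ a))) dec lt))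

  -- c = s_b s_b′ ∏R with b, b′ parallel modulo δ and R a list of roots of U.
  record Factorization : Set where
    field
      b    : V
      RL-b : RL b
      gb>0 : 0ℚ < g b
      R    : List V
      RL-R : All RL R
      g-R  : All (λ ρ → g ρ ≡ 0ℚ) R
      perp : All (λ ρ → E b ρ ≡ 0ℚ) R
      c≡R  : ∀ v → ∃ λ x → c v ≡ actR R v ⊹ x ∙ δ

  D-X>0 : 0ℚ < D X
  D-X>0 = subst (0ℚ <_) (sym (D∙ scl γ)) (0<* (0<* scl>0 scl>0) Dγ>0)

  -- Modulo δ the two roots are proportional and define the same reflection.
  refl-par : ∀ {β β′} → RL β → RL β′ → Parallel β β′ → ∀ v → ∃ λ x → refl-by β (refl-by β′ v) ≡ v ⊹ x ∙ δ
  refl-par {β} {β′} r r′ pl v = - (k * x) , (vext coords ■ refl)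
    where
    open Parallel pl
    u = refl-by β′ v
    k = coef β u
    l = coef β′ v
    Dβ : D β ≡ t * t * D β′
    Dβ = cong D eq ■ D-δshift (t ∙ β′) x ■ D∙ t β′
    ⟪β⟫ : ∀ w → ⟪ β , w ⟫ ≡ t * ⟪ β′ , w ⟫
    ⟪β⟫ w = cong (λ z → ⟪ z , w ⟫) eq ■ ⟪⟫ˡ (t ∙ β′) x δ w ■
        cong₂ (λ a b → a + x * b) (cong₂ _+_ (E∙ˡ t β′ w) (E∙ʳ t β′ w)) (⟪δ⟫ w) ■
        solve 4 (λ t a b x → t :* a :+ t :* b :+ x :* con 0ℚ := t :* (a :+ b)) refl t (E β′ w) (E w β′) x
    t≢0 : t ≢ 0ℚ
    t≢0 e = D≢0 r (Dβ ■ cong (λ z → z * z * D β′) e ■ solve 1 (λ d → con 0ℚ :* con 0ℚ :* d := con 0ℚ) refl (D β′))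
    tk : t * k ≡ - l
    tk = *-cancel {t * D β′} (*≢0 t≢0 (D≢0 r′)) (solve 3 (λ t d k → t :* d :* (t :* k) := k :* (t :* t :* d)) refl t (D β′) k ■
        cong (k *_) (sym Dβ) ■ coef-* u (D≢0 r) ■ ⟪β⟫ u ■ cong (t *_) (sym (coef-* u (D≢0 r′)) ■
        cong (_* D β′) (coef-refl-by v (D≢0 r′))) ■ solve 3 (λ t l d → t :* ((:- l) :* d) := t :* d :* (:- l)) refl t l (D β′))
    coords : ∀ i → refl-by β u ! i ≡ (v ⊹ (- (k * x)) ∙ δ) ! i
    coords i = !-lin u (- k) β i ■ cong₂ (λ a b → a + (- k) * b) (!-lin v (- l) β′ i)
        (cong (_! i) eq ■ !-lin (t ∙ β′) x δ i ■ cong (_+ x * δ ! i) (!-∙ t β′ i)) ■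
      solve 7 (λ v l b k t x d → v :+ (:- l) :* b :+ (:- k) :* (t :* b :+ x :* d) := v :+ (:- l :- t :* k) :* b :+
          (:- (k :* x)) :* d) refl (v ! i) l (β′ ! i) k t x (δ ! i) ■
      cong (λ z → v ! i + (- l - z) * β′ ! i + (- (k * x)) * δ ! i) tk ■
          solve 4 (λ v l b d → v :+ (:- l :- :- l) :* b :+ d := v :+ d) refl (v ! i) l (β′ ! i) ((- (k * x)) * δ ! i) ■
          sym (!-lin v (- (k * x)) δ i)

  private
    module F₁ = Fold (λ _ → ⊤) (λ _ _ → tt)

    good₁ : F₁.Good simples
    good₁ = F₁.good (RL-es (allFin n)) Exc-simples (All.universal (λ _ → tt) simples)

    cX : actR simples X ≡ X ⊹ scl ∙ δ
    cX = sym (c≡ X) ■ cong c (sym (0⊹ (scl ∙ γ))) ■ c-lin zeroV scl γ ■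
        vext (λ i → !-lin (c zeroV) scl (c γ) i ■ cong₂ (λ x y → x + scl * y) (cong (_! i) c-zero ■ !-zero i)
        (cong (_! i) (isγ ■ sym (⊹-def γ δ)) ■ !-⊹ γ δ i) ■
      solve 3 (λ s g d → con 0ℚ :+ s :* (g :+ d) := s :* g :+ s :* d) refl scl (γ ! i) (δ ! i) ■
          sym (!-lin X scl δ i ■ cong (_+ scl * δ ! i) (!-∙ scl γ i)))

    h-δ : ∀ x t → h (x ⊹ t ∙ δ) ≡ h x
    h-δ x t = h-step x t δ ■ cong (λ z → h x - t * z) (⟪⟫δ X) ■ solve 2 (λ h t → h :- t :* con 0ℚ := h) refl (h x) t

    not-flat : ∀ {L} → (∀ v → actR L v ≡ actR simples v) → All (λ β → g β ≡ 0ℚ) L → ⊥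
    not-flat {L} same fs = pos⇒≢0 D-X>0 (D-Qδ q)
      where q = c-fix (c≡ X ■ sym (same X) ■ F₁.flat-fix fs)

    -- Once the parallel pair is split off, the remaining word `M` still acts as `c` modulo δ, so
    -- its gallery is again a closed loop and can be folded. The orthogonality of its letters to the
    -- pair is recorded in Ψ.
    module Second (pf : F₁.ParFront simples) where
      open F₁.ParFront pf
      gd = F₁._↝_.good′ moved
      rβ : RL β
      rβ = All.head (F₁.Good.rl gd)
      rβ′ : RL β′
      rβ′ = All.head (All.tail (F₁.Good.rl gd))
      Ψ : V → Set
      Ψ η = E β η ≡ 0ℚ × E β′ η ≡ 0ℚ
      Ψ-lin : ∀ {u q v} → Ψ u → Ψ v → Ψ (u ⊹ q ∙ v)
      Ψ-lin {u} {q} {v} (a , b) (a′ , b′) = lem β a a′ , lem β′ b b′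
        where
        lem : ∀ z → E z u ≡ 0ℚ → E z v ≡ 0ℚ → E z (u ⊹ q ∙ v) ≡ 0ℚ
        lem z p r = Eʳ z u q v ■ cong₂ (λ x y → x + q * y) p r ■ solve 1 (λ q → con 0ℚ :+ q :* con 0ℚ := con 0ℚ) refl q
      module F₂ = Fold Ψ (λ {u} {q} {v} → Ψ-lin {u} {q} {v})

      c≡M : ∀ v → ∃ λ x → c v ≡ actR M v ⊹ x ∙ δ
      c≡M v = proj₁ rp , (c≡ v ■ sym (F₁._↝_.same moved v) ■ proj₂ rp)
        where rp = refl-par rβ rβ′ par (actR M v)

      good₂ : F₂.Good M
      good₂ with F₁.Good.exc gd
      ... | (_ ∷ xs) ∷ ys ∷ ex = F₂.good (All.tail (All.tail (F₁.Good.rl gd))) ex (All.zip (xs , ys))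

      h0 : h (actR M X) ≡ 0ℚ
      h0 = sym (h-δ (actR M X) (proj₁ (c≡M X))) ■ cong h (sym (proj₂ (c≡M X)) ■ c≡ X ■ cX) ■ h-δ X scl ■ hX

      -- Suppose η = tη′ + xδ is a second pair. Since `E β` kills η and η′ but not δ, x = 0; then
      -- `E η η′ = 0` reads t D η′ = 0, so t = 0 and `g η` vanishes.
      no-par : F₂.ParFront M → ⊥
      no-par (F₂.parFront η η′ M′ mv pl gη) = contra
        where
        open Parallel pl
        gd′ = F₂._↝_.good′ mv
        ψη = All.head (F₂.Good.ψ gd′)
        ψη′ = All.head (All.tail (F₂.Good.ψ gd′))
        rη′ : RL η′
        rη′ = All.head (All.tail (F₂.Good.rl gd′))
        Eηη′ : E η η′ ≡ 0ℚ
        Eηη′ = All.head (AllPairs.head (F₂.Good.exc gd′))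
        x≡0 : x ≡ 0ℚ
        x≡0 = *≡0 { - g β} (*-comm (- g β) x ■ cong (x *_) (sym (E-δʳ β)) ■
            solve 2 (λ t y → y := t :* con 0ℚ :+ y) refl t (x * E β δ) ■ cong (λ z → t * z + x * E β δ) (sym (proj₁ ψη′)) ■
            cong (_+ x * E β δ) (sym (E∙ʳ t η′ β)) ■ sym (Eʳ β (t ∙ η′) x δ) ■ cong (E β) (sym eq) ■ proj₁ ψη)
          (λ e → gβ≢0 (sym (neg-neg (g β)) ■ cong -_ e))
        t≡0 : t ≡ 0ℚ
        t≡0 = *≡0 {D η′} (*-comm (D η′) t ■ sym (E∙ˡ t η′ η′) ■
            cong (λ z → E z η′) (sym (eq ■ cong (λ z → t ∙ η′ ⊹ z ∙ δ) x≡0 ■ ⊹0∙ (t ∙ η′) δ)) ■ Eηη′) (D≢0 rη′)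
        contra : ⊥
        contra = gη (cong g eq ■ g-δ (t ∙ η′) x ■ cong (λ z → g (z ∙ η′)) t≡0 ■ E∙ʳ 0ℚ η′ δ ■ *-zeroˡ (g η′))

      factor : F₂.Outcome M → Factorization
      factor (F₂.par pf′) = ⊥-elim (no-par pf′)
      factor (F₂.flatten {L′} a fs) with <-cmp (g β) 0ℚ
      ... | tri≈ _ e _ = ⊥-elim (gβ≢0 e)
      ... | tri> _ _ p = record { b = β ; RL-b = rβ ; gb>0 = p ; R = L′ ; RL-R = F₂.Good.rl
          (F₂._↝_.good′ a) ; g-R = fs ; perp = All.map proj₁ (F₂.Good.ψ (F₂._↝_.good′ a)) ; c≡R = λ v → proj₁ (c≡M v) ,
          (proj₂ (c≡M v) ■ cong (_⊹ proj₁ (c≡M v) ∙ δ) (sym (F₂._↝_.same a v))) }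
      ... | tri< p _ _ = record { b = (- 1ℚ) ∙ β ; RL-b = RL-neg rβ ; gb>0 = subst (0ℚ <_)
          (solve 1 (λ x → :- x := con (- 1ℚ) :* x) refl (g β) ■ sym (E∙ʳ (- 1ℚ) β δ)) (0<-neg p) ; R = L′ ; RL-R = F₂.Good.rl
          (F₂._↝_.good′ a) ; g-R = fs
          ; perp = All.map (λ {ρ} q → E∙ˡ (- 1ℚ) β ρ ■ cong ((- 1ℚ) *_) (proj₁ q) ■ refl)
              (F₂.Good.ψ (F₂._↝_.good′ a)) ; c≡R = λ v → proj₁ (c≡M v) ,
              (proj₂ (c≡M v) ■ cong (_⊹ proj₁ (c≡M v) ∙ δ) (sym (F₂._↝_.same a v))) }

      result : Factorization
      result = factor (F₂.fold good₂ h0)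

    first : F₁.Outcome simples → Factorization
    first (F₁.flatten a fs) = ⊥-elim (not-flat (F₁._↝_.same a) fs)
    first (F₁.par pf) = Second.result pf

  abstract
    factorization : Factorization
    factorization = first (F₁.fold good₁ (cong h cX ■ h-δ X scl ■ hX))

-- The simple roots of Υ_c: extremality, signs, components.

module SimpleTubes (H : AffineData) where
  open AffineData H
  open Folding H public
  open import Relation.Binary.Construct.Closure.ReflexiveTransitive using (ε; _◅_; _◅◅_) renaming (reverse to reverseStar)

  lc : ∀ {k} → (Fin k → ℚ) → (Fin k → V) → V
  lc x f = tabulate (λ i → sumFin (λ j → x j * (f j ! i)))

  !-lc : ∀ {k} (x : Fin k → ℚ) f i → lc x f ! i ≡ sumFin (λ j → x j * (f j ! i))
  !-lc x f i = Vecₚ.lookup∘tabulate (λ i → sumFin (λ j → x j * (f j ! i))) i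

  lc-cong : ∀ {k} {x y : Fin k → ℚ} f → (∀ j → x j ≡ y j) → lc x f ≡ lc y f
  lc-cong f h = Vecₚ.tabulate-cong (λ i → sum-cong (λ j → cong (_* (f j ! i)) (h j)))

  lc-congʳ : ∀ {k} (x : Fin k → ℚ) {f f′} → (∀ j → f j ≡ f′ j) → lc x f ≡ lc x f′
  lc-congʳ x h = Vecₚ.tabulate-cong (λ i → sum-cong (λ j → cong (λ z → x j * (z ! i)) (h j)))

  lc-suc : ∀ {k} (x : Fin (suc k) → ℚ) f → lc x f ≡ lc (x ∘ Fin.suc) (f ∘ Fin.suc) ⊹ x Fin.zero ∙ f Fin.zero
  lc-suc x f = vext (λ i → !-lc x f i ■ +-comm (x Fin.zero * (f Fin.zero ! i))
      (sumFin (λ j → x (Fin.suc j) * (f (Fin.suc j) ! i))) ■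
      sym (!-lin (lc (x ∘ Fin.suc) (f ∘ Fin.suc)) (x Fin.zero) (f Fin.zero) i ■
      cong (_+ x Fin.zero * (f Fin.zero ! i)) (!-lc (x ∘ Fin.suc) (f ∘ Fin.suc) i)))

  lc-zero : (x : Fin 0 → ℚ) (f : Fin 0 → V) → lc x f ≡ zeroV
  lc-zero x f = vext (λ i → !-lc x f i ■ sym (!-zero i))

  E-lcˡ : ∀ {k} (x : Fin k → ℚ) f w → E (lc x f) w ≡ sumFin (λ j → x j * E (f j) w)
  E-lcˡ {zero} x f w = cong (λ z → E z w) (lc-zero x f) ■ E0ˡ w
  E-lcˡ {suc k} x f w = cong (λ z → E z w) (lc-suc x f) ■ Eˡ (lc (x ∘ Fin.suc) (f ∘ Fin.suc)) (x Fin.zero) (f Fin.zero) w ■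
      cong (_+ x Fin.zero * E (f Fin.zero) w) (E-lcˡ (x ∘ Fin.suc) (f ∘ Fin.suc) w) ■
      +-comm (sumFin (λ j → x (Fin.suc j) * E (f (Fin.suc j)) w)) (x Fin.zero * E (f Fin.zero) w)

  E-lcʳ : ∀ {k} (x : Fin k → ℚ) f w → E w (lc x f) ≡ sumFin (λ j → x j * E w (f j))
  E-lcʳ {zero} x f w = cong (E w) (lc-zero x f) ■ E0ʳ w
  E-lcʳ {suc k} x f w = cong (E w) (lc-suc x f) ■ Eʳ w (lc (x ∘ Fin.suc) (f ∘ Fin.suc)) (x Fin.zero) (f Fin.zero) ■
      cong (_+ x Fin.zero * E w (f Fin.zero)) (E-lcʳ (x ∘ Fin.suc) (f ∘ Fin.suc) w) ■
      +-comm (sumFin (λ j → x (Fin.suc j) * E w (f (Fin.suc j)))) (x Fin.zero * E w (f Fin.zero))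

  ⟪lc⟫ : ∀ {k} w (x : Fin k → ℚ) f → ⟪ w , lc x f ⟫ ≡ sumFin (λ j → x j * ⟪ w , f j ⟫)
  ⟪lc⟫ {k} w x f = cong₂ _+_ (E-lcʳ x f w) (E-lcˡ x f w) ■ sym (sum-+ {k} _ _) ■
      sum-cong {k} (λ j → sym (*-distribˡ-+ (x j) (E w (f j)) (E (f j) w)))

  lc-lin : ∀ {k} (x : Fin k → ℚ) q y f → lc (λ j → x j + q * y j) f ≡ lc x f ⊹ q ∙ lc y f
  lc-lin {k} x q y f = vext (λ i → !-lc (λ j → x j + q * y j) f i ■ sum-cong {k}
      (λ j → solve 4 (λ x q y f → (x :+ q :* y) :* f := x :* f :+ q :* (y :* f)) refl (x j) q (y j) (f j ! i)) ■
    sum-+ {k} _ _ ■ cong (sumFin (λ j → x j * (f j ! i)) +_) (sum-* {k} q _) ■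
        sym (!-lin (lc x f) q (lc y f) i ■ cong₂ (λ a b → a + q * b) (!-lc x f i) (!-lc y f i)))

  lc-∙ : ∀ {k} q (y : Fin k → ℚ) f → lc (λ j → q * y j) f ≡ q ∙ lc y f
  lc-∙ {k} q y f = vext (λ i → !-lc (λ j → q * y j) f i ■ sum-cong {k} (λ j → *-assoc q (y j) (f j ! i)) ■ sum-* {k} q _ ■
      sym (!-∙ q (lc y f) i ■ cong (q *_) (!-lc y f i)))

  lc-kron : ∀ {k} (j : Fin k) f → lc (kron j) f ≡ f j
  lc-kron j f = vext (λ i → !-lc (kron j) f i ■ sum-kron (λ l → f l ! i) j)

  lc-map : ∀ {F : V → V} → F zeroV ≡ zeroV → (∀ u q v → F (u ⊹ q ∙ v) ≡ F u ⊹ q ∙ F v) → ∀ {k} (x : Fin k → ℚ) f → F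
      (lc x f) ≡ lc x (F ∘ f)
  lc-map {F} F0 Fl {zero} x f = cong F (lc-zero x f) ■ F0 ■ sym (lc-zero x (F ∘ f))
  lc-map {F} F0 Fl {suc k} x f = cong F (lc-suc x f) ■ Fl (lc (x ∘ Fin.suc) (f ∘ Fin.suc)) (x Fin.zero) (f Fin.zero) ■
      cong (_⊹ x Fin.zero ∙ F (f Fin.zero)) (lc-map F0 Fl (x ∘ Fin.suc) (f ∘ Fin.suc)) ■ sym (lc-suc x (F ∘ f))

  lc-lc : ∀ {k l} (x : Fin k → ℚ) (y : Fin k → Fin l → ℚ) f → lc x (λ j → lc (y j) f) ≡ lc (λ q → sumFin (λ j → x j * y j q)) f
  lc-lc {k} {l} x y f = vext (λ i → !-lc x (λ j → lc (y j) f) i ■ sum-cong {k}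
      (λ j → cong (x j *_) (!-lc (y j) f i) ■ sym (sum-* {l} (x j) _)) ■ sum-swap {k} {l} _ ■
      sum-cong {l} (λ q → sum-cong {k} (λ j → sym (*-assoc (x j) (y j q) (f q ! i))) ■ sum-*ʳ {k} (f q ! i) _) ■
      sym (!-lc (λ q → sumFin (λ j → x j * y j q)) f i))

  Nonneg : ∀ {k} → (Fin k → ℚ) → Set
  Nonneg x = ∀ j → 0ℚ ≤ x j

  lc≡0 : ∀ {k} {z : Fin k → ℚ} {f} → Nonneg z → (∀ j → Positive (f j)) → lc z f ≡ zeroV → ∀ j → z j ≡ 0ℚ
  lc≡0 {k} {z} {f} nn ps eq j = *≡0 {f j ! proj₁ ne} (*-comm (f j ! proj₁ ne) (z j) ■
      sum≡0⇒ {k} (λ l → 0≤* (nn l) (proj₁ (ps l) (proj₁ ne)))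
      (sym (!-lc z f (proj₁ ne)) ■ cong (_! proj₁ ne) eq ■ !-zero (proj₁ ne)) j) (proj₂ ne)
    where ne = ≢zero (proj₂ (ps j))

  kron≥0 : ∀ {k} (j : Fin k) → Nonneg (kron j)
  kron≥0 j l with l Fin.≟ j
  ... | yes _ = <⇒≤ 0<1
  ... | no _ = ≤-refl

  P-pos : ∀ j → Positive (Pc j)
  P-pos j = proj₁ (proj₂ (proj₁ isΠc j))

  g-P : ∀ j → g (Pc j) ≡ 0ℚ
  g-P j = InU⇒ (proj₂ (proj₂ (proj₁ isΠc j)))

  RealP : Fin m → Set
  RealP j = RL (Pc j)

  -- An imaginary element of Π_c is possible: if `U` contains no real root, then Π_c consists of a
  -- single multiple of δ.
  data Kind (j : Fin m) : Set where
    real : RealP j → Kind j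
    imag : Qδ (Pc j) → Kind j

  kind : ∀ j → Kind j
  kind j = go (proj₁ (proj₁ isΠc j))
    where
    go : Root (Pc j) → Kind j
    go (inj₁ r) = real (RealRoot⇒RL r)
    go (inj₂ (k , _ , eq)) = imag (k / 1 , (eq ■ sym (∙-def (k / 1) δ)))

  ¬RL-Qδ : ∀ {v} → RL v → Qδ v → ⊥
  ¬RL-Qδ r q = D≢0 r (D-Qδ q)

  gen : ∀ {v} → RL v → Positive v → g v ≡ 0ℚ → ∃ λ k → Nonneg k × lc k Pc ≡ v
  gen {v} r p h = proj₁ (proj₂ (proj₂ isΠc)) v (inj₁ (RL⇒RealRoot r p) , p , ⇒InU h)

  -- Each simple root spans an extremal ray. If `z j < t`, the other simple roots generate `Pc j`,
  -- against minimality of Π_c. Otherwise `t ∙ Pc j` can be subtracted, and a nonnegative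
  -- combination of positive vectors that vanishes is trivial.
  extremal : ∀ {z j t} → Nonneg z → lc z Pc ≡ t ∙ Pc j → ∀ l → l ≢ j → z l ≡ 0ℚ
  extremal {z} {j} {t} nn eq with z j <? t
  ... | yes lt = ⊥-elim (proj₂ (proj₂ (proj₂ isΠc)) j redundant)
    where
    u = inv (t - z j)
    ut : u * (t - z j) ≡ 1ℚ
    ut = inv-* (pos⇒≢0 (0<- lt))
    redundant : ∀ v → InΥ⁺ v → ∃ λ k → Nonneg k × k j ≡ 0ℚ × lincomb k ≡ v
    redundant v vin = k′ , k′≥0 , k′j , (lc-cong Pc k′≡ ■ vext coords)
      where
      ex = proj₁ (proj₂ (proj₂ isΠc)) v vin
      k = proj₁ ex
      -- `Pc j` equals `u` times the part of `lc z Pc` away from `j`; substituting this in the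
      -- expansion `k` removes `Pc j` from it.
      k′ : Fin m → ℚ
      k′ l with l Fin.≟ j
      ... | yes _ = 0ℚ
      ... | no _ = k l + k j * u * z l
      k′≥0 : Nonneg k′
      k′≥0 l with l Fin.≟ j
      ... | yes _ = ≤-refl
      ... | no _ = 0≤+ (proj₁ (proj₂ ex) l) (0≤* (0≤* (proj₁ (proj₂ ex) j) (<⇒≤ (inv-pos (0<- lt)))) (nn l))
      k′j : k′ j ≡ 0ℚ
      k′j with j Fin.≟ j
      ... | yes _ = refl
      ... | no ne = ⊥-elim (ne refl)
      q = - (k j + k j * u * z j)
      k′≡ : ∀ l → k′ l ≡ (k l + k j * u * z l) + q * kron j l
      k′≡ l with l Fin.≟ j
      ... | yes refl = solve 1 (λ x → con 0ℚ := x :+ (:- x) :* con 1ℚ) refl (k l + k l * u * z l)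
      ... | no _ = solve 2 (λ x q → x := x :+ q :* con 0ℚ) refl (k l + k j * u * z l) q
      coords : ∀ i → lc (λ l → (k l + k j * u * z l) + q * kron j l) Pc ! i ≡ v ! i
      coords i = cong (_! i) (lc-lin (λ l → k l + k j * u * z l) q (kron j) Pc) ■ !-lin _ q (lc (kron j) Pc) i ■
          cong₂ (λ a b → a + q * b) (cong (_! i) (lc-lin k (k j * u) z Pc) ■ !-lin (lc k Pc) (k j * u) (lc z Pc) i ■
          cong₂ (λ a b → a + k j * u * b) (cong (_! i) (proj₂ (proj₂ ex))) (cong (_! i) eq ■ !-∙ t (Pc j) i))
          (cong (_! i) (lc-kron j Pc)) ■
        solve 6 (λ v k u t p z → v :+ k :* u :* (t :* p) :+ (:- (k :+ k :* u :* z)) :* p := v :+ k :* p :*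
            (u :* (t :- z) :- con 1ℚ)) refl (v ! i) (k j) u t (Pc j ! i) (z j) ■
            cong (λ w → v ! i + k j * (Pc j ! i) * (w - 1ℚ)) ut ■
            solve 2 (λ v y → v :+ y :* (con 1ℚ :- con 1ℚ) := v) refl (v ! i) (k j * (Pc j ! i))
  ... | no ¬lt = λ l ne → (solve 2 (λ z t → z := z :+ (:- t) :* con 0ℚ) refl (z l) t ■
      cong (λ w → z l + (- t) * w) (sym (kron-≢ ne)) ■ lc≡0 nn′ P-pos zero′ l)
    where
    nn′ : Nonneg (λ l → z l + (- t) * kron j l)
    nn′ l with l Fin.≟ j
    ... | yes refl = subst (0ℚ ≤_) (solve 2 (λ z t → z :- t := z :+ (:- t) :* con 1ℚ) refl (z l) t) (0≤- (≮⇒≥ ¬lt))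
    ... | no _ = subst (0ℚ ≤_) (solve 2 (λ z t → z := z :+ (:- t) :* con 0ℚ) refl (z l) t) (nn l)
    zero′ : lc (λ l → z l + (- t) * kron j l) Pc ≡ zeroV
    zero′ = lc-lin z (- t) (kron j) Pc ■ cong₂ (λ a b → a ⊹ (- t) ∙ b) eq (lc-kron j Pc) ■
        vext (λ i → !-lin (t ∙ Pc j) (- t) (Pc j) i ■ cong (_+ (- t) * (Pc j ! i)) (!-∙ t (Pc j) i) ■
        solve 2 (λ t p → t :* p :+ (:- t) :* p := con 0ℚ) refl t (Pc j ! i) ■ sym (!-zero i))

  g-refl : ∀ {β} v → g β ≡ 0ℚ → g (refl-by β v) ≡ g v
  g-refl {β} v h = g-lin v (- coef β v) β ■ cong (λ z → g v + (- coef β v) * z) h ■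
      solve 2 (λ x k → x :+ k :* con 0ℚ := x) refl (g v) (- coef β v)

  g-neg : ∀ {v} → g v ≡ 0ℚ → g ((- 1ℚ) ∙ v) ≡ 0ℚ
  g-neg {v} h = E∙ʳ (- 1ℚ) v δ ■ cong ((- 1ℚ) *_) h ■ refl

  -- If the difference is negative, its opposite has a nonnegative expansion, which together with
  -- `x` expands `q ∙ Pc j`; by extremality `x` lives on `j` alone.
  peel : ∀ {v q j x} → Nonneg x → lc x Pc ≡ v → RL ((v ⊹ (- q) ∙ Pc j)) → g v ≡ 0ℚ →
    Positive (v ⊹ (- q) ∙ Pc j) ⊎ (∀ l → l ≢ j → x l ≡ 0ℚ)
  peel {v} {q} {j} {x} nn eq r gv = go (coherent r)
    where
    w = v ⊹ (- q) ∙ Pc j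
    gw : g w ≡ 0ℚ
    gw = g-lin v (- q) (Pc j) ■ cong₂ (λ a b → a + (- q) * b) gv (g-P j) ■
        solve 1 (λ q → con 0ℚ :+ q :* con 0ℚ := con 0ℚ) refl (- q)
    go : Positive w ⊎ Positive ((- 1ℚ) ∙ w) → Positive w ⊎ (∀ l → l ≢ j → x l ≡ 0ℚ)
    go (inj₁ p) = inj₁ p
    go (inj₂ p) = inj₂ (λ l ne → +≡0 (nn l) (subst (0ℚ ≤_) (sym (*-identityˡ (y l))) (proj₁ (proj₂ gy) l))
        (extremal {λ l → x l + 1ℚ * y l} {j} {q} (λ l → 0≤+ (nn l) (subst (0ℚ ≤_) (sym (*-identityˡ (y l)))
        (proj₁ (proj₂ gy) l))) total l ne))
      where
      gy = gen (RL-neg r) p (g-neg gw)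
      y = proj₁ gy
      total : lc (λ l → x l + 1ℚ * y l) Pc ≡ q ∙ Pc j
      total = lc-lin x 1ℚ y Pc ■ cong₂ (λ a b → a ⊹ 1ℚ ∙ b) eq (proj₂ (proj₂ gy)) ■
          vext (λ i → !-lin v 1ℚ ((- 1ℚ) ∙ w) i ■ cong (λ z → v ! i + 1ℚ * z) (!-∙ (- 1ℚ) w i ■
          cong ((- 1ℚ) *_) (!-lin v (- q) (Pc j) i)) ■
        solve 3 (λ v q p → v :+ con 1ℚ :* (con (- 1ℚ) :* (v :+ (:- q) :* p)) := q :* p) refl (v ! i) q (Pc j ! i) ■
            sym (!-∙ q (Pc j) i))

  -- Were the pairing positive, `Pc l` would be its reflection in `Pc j` plus a positive multiple of
  -- `Pc j`. With `peel`, either sign of the reflected root contradicts extremality or the expansion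
  -- of `Pc l` by itself.
  offdiag : ∀ {j l} → l ≢ j → ⟪ Pc j , Pc l ⟫ ≤ 0ℚ
  offdiag {j} {l} ne = split (kind j) (kind l)
   where
   split : Kind j → Kind l → ⟪ Pc j , Pc l ⟫ ≤ 0ℚ
   split (imag q) _ = ≤-reflexive (⟪⟫-comm (Pc j) (Pc l) ■ ⟪Qδ⟫ (Pc l) q)
   split (real _) (imag q) = ≤-reflexive (⟪Qδ⟫ (Pc j) q)
   split (real r) (real r′) = ≮⇒≥ contra
    where
    k = coef (Pc j) (Pc l)
    contra : ¬ (0ℚ < ⟪ Pc j , Pc l ⟫)
    contra pos = go (peel {Pc l} {k} {j} (kron≥0 l) (lc-kron l Pc) rw (g-P l))
      where
      k>0 : 0ℚ < k
      k>0 = 0<* pos (inv-pos (D>0 r))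
      rw : RL (refl-by (Pc j) (Pc l))
      rw = RL-refl r r′
      go : Positive (refl-by (Pc j) (Pc l)) ⊎ (∀ i → i ≢ j → kron l i ≡ 0ℚ) → ⊥
      go (inj₂ h) = pos⇒≢0 0<1 (sym (kron-refl l) ■ h l ne)
      go (inj₁ p) = pos⇒≢0 (0<+ k>0 (proj₁ (proj₂ gx) j)) (solve 2 (λ k x → k :+ x := x :+ k :* con 1ℚ) refl k (x j) ■
          cong (λ z → x j + k * z) (sym (kron-refl j)) ■ extremal {λ i → x i + k * kron j i} {l} {1ℚ}
          (λ i → 0≤+ (proj₁ (proj₂ gx) i) (0≤* (<⇒≤ k>0) (kron≥0 j i))) total j (ne ∘ sym))
        where
        gx = gen rw p (g-refl (Pc l) (g-P j) ■ g-P l)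
        x = proj₁ gx
        total : lc (λ i → x i + k * kron j i) Pc ≡ 1ℚ ∙ Pc l
        total = lc-lin x k (kron j) Pc ■ cong₂ (λ a b → a ⊹ k ∙ b) (proj₂ (proj₂ gx)) (lc-kron j Pc) ■
            ⊹∙⊹∙ (Pc l) (- k) k (Pc j) ■ cong (λ z → Pc l ⊹ z ∙ Pc j) (+-inverseˡ k) ■ ⊹0∙ (Pc l) (Pc j) ■ sym (1∙ (Pc l))

  Link-sym : ∀ {j l} → Link j l → Link l j
  Link-sym {j} {l} h e0 = h (K≡E+E (Pc j) (Pc l) ■ ⟪⟫-comm (Pc j) (Pc l) ■ sym (K≡E+E (Pc l) (Pc j)) ■ e0)

  Comp-sym : ∀ {j l} → SameComp j l → SameComp l j
  Comp-sym = reverseStar (λ {j} {l} → Link-sym {j} {l})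

  mkLink : ∀ {j l} → ⟪ Pc j , Pc l ⟫ ≢ 0ℚ → Link j l
  mkLink {j} {l} h e0 = h (sym (K≡E+E (Pc j) (Pc l)) ■ e0)

  Link⇒ : ∀ {j l} → Link j l → ⟪ Pc j , Pc l ⟫ ≢ 0ℚ
  Link⇒ {j} {l} h e0 = h (K≡E+E (Pc j) (Pc l) ■ e0)

  Supported : (Fin m → ℚ) → Set
  Supported k = ∀ j l → k j ≢ 0ℚ → k l ≢ 0ℚ → SameComp j l

  factors≢0 : ∀ {x y} → x * y ≢ 0ℚ → x ≢ 0ℚ × y ≢ 0ℚ
  factors≢0 {x} {y} h = (λ e0 → h (cong (_* y) e0 ■ *-zeroˡ y)) , (λ e0 → h (cong (x *_) e0 ■ *-zeroʳ x))

  ht-P>0 : ∀ j → 0ℚ < ht (Pc j)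
  ht-P>0 j = ≤∧≢⇒< (ht≥0 (P-pos j)) (λ e0 → proj₂ (P-pos j) (vext (λ i → sum≡0⇒ {n} (proj₁ (P-pos j)) e0 i ■ sym (!-zero i))))

  record Expansion (α : V) : Set where
    constructor expansion
    field
      k    : Fin m → ℚ
      k≥0  : Nonneg k
      k-eq : lc k Pc ≡ α
      supp : Supported k

  -- Adding `Pc j` back to the expansion of the reflected root keeps the support in one component:
  -- the reflected root pairs nontrivially with `Pc j`, so `j` is linked to an element of its
  -- support.
  expand-step : ∀ {α x j} → RL α → g α ≡ 0ℚ → Nonneg x → lc x Pc ≡ α → RealP j → 0ℚ < ⟪ Pc j , α ⟫ →
    (Positive (refl-by (Pc j) α) → Expansion (refl-by (Pc j) α)) → Expansion α
  expand-step {α} {x} {j} r h nn xα rj pr>0 ih = either (peel {α} {q} {j} nn xα (RL-refl rj r) h)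
    where
    q = coef (Pc j) α
    q>0 : 0ℚ < q
    q>0 = 0<* pr>0 (inv-pos (D>0 rj))
    w = refl-by (Pc j) α
    extend : Expansion w → Expansion α
    extend (expansion k k≥0 eq sp) = expansion (λ l → k l + q * kron j l) (λ l → 0≤+ (k≥0 l) (0≤* (<⇒≤ q>0) (kron≥0 j l)))
        (lc-lin k q (kron j) Pc ■ cong₂ (λ a b → a ⊹ q ∙ b) eq (lc-kron j Pc) ■ ⊹∙⊹∙ α (- q) q (Pc j) ■
            cong (λ z → α ⊹ z ∙ Pc j) (+-inverseˡ q) ■ ⊹0∙ α (Pc j)) (λ a b na nb → Comp-sym (toJ a na) ◅◅ toJ b nb)
      where
      pw≢0 : ⟪ Pc j , w ⟫ ≢ 0ℚ
      pw≢0 e0 = *≢0 (pos⇒≢0 q>0) (D≢0 rj) (sym (neg-neg (q * D (Pc j))) ■ cong -_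
          (solve 2 (λ a b → :- (a :* b) := (:- a) :* b) refl q (D (Pc j)) ■
          cong (_* D (Pc j)) (sym (coef-refl-by α (D≢0 rj))) ■ coef-* w (D≢0 rj) ■ e0))
      hook : ∃ λ l → k l * ⟪ Pc j , Pc l ⟫ ≢ 0ℚ
      hook = sum-≢0⇒ {m} (λ l → k l * ⟪ Pc j , Pc l ⟫) (λ e0 → pw≢0 (cong (λ z → ⟪ Pc j , z ⟫) (sym eq) ■ ⟪lc⟫ (Pc j) k Pc ■
          e0))
      toJ : ∀ a → k a + q * kron j a ≢ 0ℚ → SameComp j a
      toJ a na with a Fin.≟ j
      ... | yes refl = ε
      ... | no _ = mkLink {j} {proj₁ hook} (proj₂ (factors≢0 {k (proj₁ hook)} {⟪ Pc j , Pc (proj₁ hook) ⟫} (proj₂ hook))) ◅ sp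
          (proj₁ hook) a (proj₁ (factors≢0 {k (proj₁ hook)} {⟪ Pc j , Pc (proj₁ hook) ⟫} (proj₂ hook)))
          (λ e0 → na (cong (_+ q * 0ℚ) e0 ■ cong (0ℚ +_) (*-zeroʳ q) ■ refl))
    either : Positive w ⊎ (∀ l → l ≢ j → x l ≡ 0ℚ) → Expansion α
    either (inj₁ pw) = extend (ih pw)
    either (inj₂ off) = expansion x nn xα (λ a b na nb → subst (λ z → SameComp z b) (sym (only a na))
        (subst (SameComp j) (sym (only b nb)) ε))
      where
      only : ∀ l → x l ≢ 0ℚ → l ≡ j
      only l ne with l Fin.≟ j
      ... | yes e0 = e0
      ... | no ne′ = ⊥-elim (ne (off l ne′))

  pairing-step : ∀ {α x} → RL α → Nonneg x → lc x Pc ≡ α → ∃ λ j → RealP j × 0ℚ < ⟪ Pc j , α ⟫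
  pairing-step {α} {x} r nn eq = finish (sum-pos⇒ {m} (λ j → x j * ⟪ α , Pc j ⟫)
      (subst (0ℚ <_) (cong (λ z → ⟪ α , z ⟫) (sym eq) ■ ⟪lc⟫ α x Pc) (0<+ (D>0 r) (D≥0 α))))
    where
    finish : (∃ λ j → 0ℚ < x j * ⟪ α , Pc j ⟫) → ∃ λ j → RealP j × 0ℚ < ⟪ Pc j , α ⟫
    finish (j , p) = j , isReal (kind j) , pr
      where
      pr : 0ℚ < ⟪ Pc j , α ⟫
      pr = subst (0ℚ <_) (⟪⟫-comm α (Pc j)) (0<*⇒0< {x j} {⟪ α , Pc j ⟫} (≤∧≢⇒< (nn j)
          (proj₁ (factors≢0 {x j} {⟪ α , Pc j ⟫} (pos⇒≢0 p)))) p)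
      isReal : Kind j → RealP j
      isReal (real rj) = rj
      isReal (imag q) = ⊥-elim (pos⇒≢0 pr (⟪⟫-comm (Pc j) α ■ ⟪Qδ⟫ α q))

  ht-smaller : ∀ {α j} → RealP j → 0ℚ < ⟪ Pc j , α ⟫ → ht (refl-by (Pc j) α) < ht α
  ht-smaller {α} {j} rj pr = by< (0<* (0<* pr (inv-pos (D>0 rj))) (ht-P>0 j))
      (cong (_+ coef (Pc j) α * ht (Pc j)) (ht-lin α (- coef (Pc j) α) (Pc j)) ■
      solve 3 (λ h q y → h :+ (:- q) :* y :+ q :* y := h) refl (ht α) (coef (Pc j) α) (ht (Pc j)))

  expand : ∀ {α} → RL α → Positive α → g α ≡ 0ℚ → Expansion α
  expand {α} r p h = go (proj₁ b) r p h (proj₂ b)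
    where
    b = arch-suc (ht α)
    go : ∀ N {α} → RL α → Positive α → g α ≡ 0ℚ → ht α < fromℕ (suc N) → Expansion α
    step : ∀ N {α x} → RL α → Positive α → g α ≡ 0ℚ → ht α < fromℕ (suc N) → Nonneg x → lc x Pc ≡ α →
        (∃ λ j → RealP j × 0ℚ < ⟪ Pc j , α ⟫) → Expansion α
    go N r p h lt = let x , nn , eq = gen r p h in step N r p h lt nn eq (pairing-step r nn eq)
    step N {α} r p h lt nn eq (j , rj , pr) = expand-step r h nn eq rj pr (lower N lt)
      where
      w = refl-by (Pc j) α
      lower : ∀ N → ht α < fromℕ (suc N) → Positive w → Expansion w
      lower zero lt pw = ⊥-elim (<⇒≱' (Int-step zero (ht-Int α (int r)) (ht-Int w (int (RL-refl rj r)))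
          (ht-smaller {α} rj pr) lt) (ht≥0 pw))
      lower (suc N) lt pw = go N (RL-refl rj r) pw (g-refl α (g-P j) ■ h)
          (Int-step (suc N) (ht-Int α (int r)) (ht-Int w (int (RL-refl rj r))) (ht-smaller {α} rj pr) lt)

  -- A null vector pairs to 0 with `Pc b`. When `y b` is 0 only nonpositive terms remain in that
  -- pairing, so `y` vanishes at every neighbour of `b`.
  null-prop : ∀ {y} → Nonneg y → D (lc y Pc) ≡ 0ℚ → ∀ {b a} → SameComp b a → y b ≡ 0ℚ → y a ≡ 0ℚ
  null-prop {y} nn Dy ε yb = yb
  null-prop {y} nn Dy {b} {a} (_◅_ {j = l} lk rest) yb = null-prop nn Dy rest yl
    where
    term : ∀ i → 0ℚ ≤ - (y i * ⟪ Pc b , Pc i ⟫)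
    term i with i Fin.≟ b
    ... | yes refl = ≤-reflexive (sym (cong -_ (cong (_* ⟪ Pc b , Pc b ⟫) yb ■ (*-zeroˡ ⟪ Pc b , Pc b ⟫))))
    ... | no ne = subst (0ℚ ≤_) (solve 2 (λ x y → x :* (:- y) := :- (x :* y)) refl (y i) ⟪ Pc b , Pc i ⟫)
        (0≤* (nn i) (0≤-neg (offdiag {b} {i} ne)))
    yl : y l ≡ 0ℚ
    yl = *≡0 {⟪ Pc b , Pc l ⟫} ((*-comm ⟪ Pc b , Pc l ⟫ (y l)) ■ sym (neg-neg _) ■
        cong -_ (sum≡0⇒ {m} term (sum-neg {m} _ ■ cong -_ (sym (⟪lc⟫ (Pc b) y Pc) ■ ⟪Qδ⟫ (Pc b) (null Dy))) l))
        (Link⇒ {b} {l} lk)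

  -- Split `w` into positive and negative parts. The norm of the difference is a sum of three
  -- nonnegative terms and is 0, so the positive part is null; its zero at `b` then spreads to `a`.
  relation-sign : ∀ {w} → Qδ (lc w Pc) → ∀ {a b} → SameComp b a → w b ≤ 0ℚ → 0ℚ < w a → ⊥
  relation-sign {w} q {a} {b} sc wb wa = pos⇒≢0 wa (sym (pos-id (<⇒≤ wa)) ■ null-prop {w⁺} (λ i → pos≥0 (w i)) D⁺ sc
      (p≤q⇒p⊔q≡q wb))
    where
    w⁺ w⁻ : Fin m → ℚ
    w⁺ i = pos (w i)
    w⁻ i = pos (- w i)
    disjoint : ∀ x → pos x * pos (- x) ≡ 0ℚ
    disjoint x with pos-disjoint x
    ... | inj₁ e0 = cong (_* pos (- x)) e0 ■ *-zeroˡ (pos (- x))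
    ... | inj₂ e0 = cong (pos x *_) e0 ■ *-zeroʳ (pos x)
    p⁺ = lc w⁺ Pc
    p⁻ = lc w⁻ Pc
    pw : lc w Pc ≡ p⁺ ⊹ (- 1ℚ) ∙ p⁻
    pw = lc-cong Pc (λ i → pos-split (w i)) ■ lc-lin w⁺ (- 1ℚ) w⁻ Pc
    term : ∀ i j → 0ℚ ≤ - (w⁺ i * (w⁻ j * ⟪ Pc j , Pc i ⟫))
    term i j with i Fin.≟ j
    ... | yes refl = ≤-reflexive (sym (cong -_ (sym (*-assoc (w⁺ i) (w⁻ i) ⟪ Pc i , Pc i ⟫) ■
        cong (_* ⟪ Pc i , Pc i ⟫) (disjoint (w i))) ■ cong -_ (*-zeroˡ ⟪ Pc i , Pc i ⟫)))
    ... | no ne = subst (0ℚ ≤_) (solve 3 (λ x y z → x :* (y :* (:- z)) := :- (x :* (y :* z))) refl (w⁺ i)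
        (w⁻ j) ⟪ Pc j , Pc i ⟫) (0≤* (pos≥0 (w i)) (0≤* (pos≥0 (- w j)) (0≤-neg (offdiag {j} {i} ne))))
    cross : 0ℚ ≤ - ⟪ p⁺ , p⁻ ⟫
    cross = subst (0ℚ ≤_) (sum-cong {m} (λ i → sum-neg {m} _ ■ cong -_ (sum-* {m} (w⁺ i) _ ■
        cong (w⁺ i *_) (sum-cong {m} (λ j → cong (w⁻ j *_) (⟪⟫-comm (Pc j) (Pc i))) ■ sym (⟪lc⟫ (Pc i) w⁻ Pc) ■
        ⟪⟫-comm (Pc i) p⁻))) ■ sum-neg {m} _ ■ cong -_ (sym (⟪lc⟫ p⁻ w⁺ Pc) ■ ⟪⟫-comm p⁻ p⁺))
        (sum-≥0 {m} (λ i → sum-≥0 {m} (λ j → term i j)))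
    D⁺ : D p⁺ ≡ 0ℚ
    D⁺ = +≡0 (D≥0 p⁺) (0≤+ (D≥0 p⁻) cross) ((solve 3 (λ a b c → a :+ (b :+ :- c) := a :+ con (- 1ℚ) :* c :+ con (- 1ℚ) :* con
        (- 1ℚ) :* b) refl (D p⁺) (D p⁻) ⟪ p⁺ , p⁻ ⟫) ■ sym (D-lin p⁺ (- 1ℚ) p⁻) ■ cong D (sym pw) ■ D-Qδ q)

-- The permutation of Π_c induced by c; its orbits are the components.

module TubeRotation (H : AffineData) where
  open AffineData H
  open SimpleTubes H public
  open import Relation.Binary.Construct.Closure.ReflexiveTransitive using (ε; _◅_; _◅◅_)
  open import Data.Nat.DivMod using (_%_; m%n<n; m≡m%n+[m/n]*n) renaming (_/_ to _quot_)

  c^-lin : ∀ k u q v → c^ k (u ⊹ q ∙ v) ≡ c^ k u ⊹ q ∙ c^ k v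
  c^-lin zero u q v = refl
  c^-lin (suc k) u q v = cong c (c^-lin k u q v) ■ c-lin (c^ k u) q (c^ k v)

  c^-zero : ∀ k → c^ k zeroV ≡ zeroV
  c^-zero zero = refl
  c^-zero (suc k) = cong c (c^-zero k) ■ c-zero

  c^-∙ : ∀ k q v → c^ k (q ∙ v) ≡ q ∙ c^ k v
  c^-∙ k q v = cong (c^ k) (sym (0⊹ (q ∙ v))) ■ c^-lin k zeroV q v ■ cong (_⊹ q ∙ c^ k v) (c^-zero k) ■ 0⊹ (q ∙ c^ k v)

  -- c P_j and its inverse image are nonnegative combinations, so extremality makes c P_j a simple root.
  private
    image-real : ∀ {j x} (N : ℕ) → RealP j → c^ N (c (Pc j)) ≡ Pc j → Nonneg x → lc x Pc ≡ c (Pc j) → ∃ λ l → c (Pc j) ≡ Pc l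
    image-real {j} {x} N rj back nn eq = finish l₀ (kind l₀) xl≢0
      where
      back-image : ∀ l → Kind l → ∃ λ y → Nonneg y × lc y Pc ≡ c^ N (Pc l)
      back-image l (real rl) = gen (RL-c^ N rl) (c^-pos N rl (P-pos l) (g-P l)) (g-c^ N (Pc l) ■ g-P l)
      back-image l (imag (t , q)) = kron l , kron≥0 l , (lc-kron l Pc ■ q ■ sym (0⊹ (t ∙ δ)) ■
          cong (_⊹ t ∙ δ) (sym (c^-zero N)) ■ sym (c^-δ N zeroV t) ■ cong (c^ N) (0⊹ (t ∙ δ) ■ sym q))
      y : Fin m → Fin m → ℚ
      y l = proj₁ (back-image l (kind l))
      y≥0 : ∀ l → Nonneg (y l)
      y≥0 l = proj₁ (proj₂ (back-image l (kind l)))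
      y-eq : ∀ l → lc (y l) Pc ≡ c^ N (Pc l)
      y-eq l = proj₂ (proj₂ (back-image l (kind l)))
      total : lc (λ q → sumFin (λ l → x l * y l q)) Pc ≡ 1ℚ ∙ Pc j
      total = sym (lc-lc x y Pc) ■ lc-congʳ x y-eq ■ sym (lc-map {c^ N} (c^-zero N) (c^-lin N) x Pc) ■ cong (c^ N) eq ■ back ■
          sym (1∙ (Pc j))
      off : ∀ q → q ≢ j → ∀ l → x l * y l q ≡ 0ℚ
      off q ne = sum≡0⇒ {m} (λ l → 0≤* (nn l) (y≥0 l q)) (extremal {λ q → sumFin (λ l → x l * y l q)} {j} {1ℚ}
          (λ q → sum-≥0 {m} (λ l → 0≤* (nn l) (y≥0 l q))) total q ne)
      ne-coord : ∃ λ i → c (Pc j) ! i ≢ 0ℚ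
      ne-coord = ≢zero (RL≢0 (RL-c rj))
      hit : ∃ λ l → x l * (Pc l ! proj₁ ne-coord) ≢ 0ℚ
      hit = sum-≢0⇒ {m} (λ l → x l * (Pc l ! proj₁ ne-coord))
          (λ e0 → proj₂ ne-coord (cong (_! proj₁ ne-coord) (sym eq) ■ !-lc x Pc (proj₁ ne-coord) ■ e0))
      l₀ = proj₁ hit
      xl≢0 : x l₀ ≢ 0ℚ
      xl≢0 = proj₁ (factors≢0 {x l₀} {Pc l₀ ! proj₁ ne-coord} (proj₂ hit))
      finish : ∀ l → Kind l → x l ≢ 0ℚ → ∃ λ l → c (Pc j) ≡ Pc l
      finish l kl xl = l , concl kl
        where
        t = y l j
        y-only : ∀ q → y l q ≡ t * kron j q
        y-only q with q Fin.≟ j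
        ... | yes refl = sym (*-identityʳ t)
        ... | no ne = *≡0 {x l} (off q ne l) xl ■ sym (*-zeroʳ t)
        Pl≡ : Pc l ≡ t ∙ c (Pc j)
        Pl≡ = c^-inj N (sym (y-eq l) ■ lc-cong Pc y-only ■ lc-∙ t (kron j) Pc ■ cong (t ∙_) (lc-kron j Pc ■ sym back) ■
            sym (c^-∙ N t (c (Pc j))))
        t>0 : 0ℚ < t
        t>0 = ≤∧≢⇒< (y≥0 l j) (λ e0 → proj₂ (P-pos l) (Pl≡ ■ cong (_∙ c (Pc j)) e0 ■ 0∙ (c (Pc j))))
        concl : Kind l → c (Pc j) ≡ Pc l
        concl (imag q) = ⊥-elim (*≢0 (*≢0 (pos⇒≢0 t>0) (pos⇒≢0 t>0)) (D≢0 (RL-c rj))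
            (sym (D∙ t (c (Pc j))) ■ cong D (sym Pl≡) ■ D-Qδ q))
        concl (real rl) = sym (1∙ (c (Pc j))) ■ cong (_∙ c (Pc j)) (sym (RL-prim {c (Pc j)} {t} (RL-c rj)
            (subst RL Pl≡ rl) t>0)) ■ sym Pl≡

    image : ∀ j → ∃ λ l → c (Pc j) ≡ Pc l
    image j = go (kind j)
      where
      go : Kind j → ∃ λ l → c (Pc j) ≡ Pc l
      go (imag q) = j , c-Qδ q
      go (real rj) = let x , nn , eq = gen (RL-c rj) (c-pos rj (P-pos j) (g-P j)) (g-c (Pc j) ■ g-P j) in
        image-real (PeriodU.N pu) rj (c^-suc (PeriodU.N pu) (Pc j) ■ PeriodU.period pu) nn eq
        where pu = periodicU rj (g-P j)

  abstract
    σ : Fin m → Fin m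
    σ j = proj₁ (image j)

    cP : ∀ j → c (Pc j) ≡ Pc (σ j)
    cP j = proj₂ (image j)

  σ^ : ℕ → Fin m → Fin m
  σ^ zero j = j
  σ^ (suc k) j = σ (σ^ k j)

  Pc-inj : ∀ {i j} → Pc i ≡ Pc j → i ≡ j
  Pc-inj {i} {j} = proj₁ (proj₂ isΠc) i j

  σ-inj : ∀ {i j} → σ i ≡ σ j → i ≡ j
  σ-inj {i} {j} h = Pc-inj (c-inj (cP i ■ cong Pc h ■ sym (cP j)))

  cP^ : ∀ k j → c^ k (Pc j) ≡ Pc (σ^ k j)
  cP^ zero j = refl
  cP^ (suc k) j = cong c (cP^ k j) ■ cP (σ^ k j)

  σ^-+ : ∀ k l j → σ^ (k ℕ.+ l) j ≡ σ^ k (σ^ l j)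
  σ^-+ zero l j = refl
  σ^-+ (suc k) l j = cong σ (σ^-+ k l j)

  σ^-suc : ∀ k j → σ^ k (σ j) ≡ σ (σ^ k j)
  σ^-suc zero j = refl
  σ^-suc (suc k) j = cong σ (σ^-suc k j)

  σ^-inj : ∀ k {i j} → σ^ k i ≡ σ^ k j → i ≡ j
  σ^-inj zero h = h
  σ^-inj (suc k) h = σ^-inj k (σ-inj h)

  Σℕ : ℕ → (ℕ → ℚ) → ℚ
  Σℕ zero f = 0ℚ
  Σℕ (suc k) f = Σℕ k f + f k

  E-Sˡ : ∀ k v w → E (S k v) w ≡ Σℕ k (λ i → E (c^ i v) w)
  E-Sˡ zero v w = E0ˡ w
  E-Sˡ (suc k) v w = Eˡ (S k v) 1ℚ (c^ k v) w ■ cong₂ _+_ (E-Sˡ k v w) (*-identityˡ (E (c^ k v) w))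

  E-Sʳ : ∀ k v w → E w (S k v) ≡ Σℕ k (λ i → E w (c^ i v))
  E-Sʳ zero v w = E0ʳ w
  E-Sʳ (suc k) v w = Eʳ w (S k v) 1ℚ (c^ k v) ■ cong₂ _+_ (E-Sʳ k v w) (*-identityˡ (E w (c^ k v)))

  Σℕ-cong : ∀ k {f h} → (∀ i → f i ≡ h i) → Σℕ k f ≡ Σℕ k h
  Σℕ-cong zero p = refl
  Σℕ-cong (suc k) p = cong₂ _+_ (Σℕ-cong k p) (p k)

  Σℕ≥0 : ∀ k {f} → (∀ i → 0ℚ ≤ f i) → 0ℚ ≤ Σℕ k f
  Σℕ≥0 zero p = ≤-refl
  Σℕ≥0 (suc k) p = 0≤+ (Σℕ≥0 k p) (p k)

  Σℕ≡0⇒ : ∀ k {f} → (∀ i → 0ℚ ≤ f i) → Σℕ k f ≡ 0ℚ → ∀ {i} → i ℕ.< k → f i ≡ 0ℚ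
  Σℕ≡0⇒ (suc k) {f} p e0 {i} lt with i ℕ.≟ k
  ... | yes refl = +≡0ʳ (Σℕ≥0 k p) (p k) e0
  ... | no ne = Σℕ≡0⇒ k p (+≡0 (Σℕ≥0 k p) (p k) e0) (ℕₚ.≤∧≢⇒< (ℕₚ.≤-pred lt) ne)

  Σℕ≢0⇒ : ∀ k {f} → Σℕ k f ≢ 0ℚ → ∃ λ i → f i ≢ 0ℚ
  Σℕ≢0⇒ zero ne = ⊥-elim (ne refl)
  Σℕ≢0⇒ (suc k) {f} ne with f k ≟ 0ℚ
  ... | no q = k , q
  ... | yes q = Σℕ≢0⇒ k (λ e0 → ne (cong₂ _+_ e0 q ■ refl))

  record OrbitData (j : Fin m) : Set where
    field
      N : ℕ
      per : σ^ (suc N) j ≡ j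
      sumδ : Qδ (S (suc N) (Pc j))

  private
   orbit′ : ∀ j → OrbitData j
   orbit′ j = go (kind j)
     where
     go : Kind j → OrbitData j
     go (real rj) = record { N = N ; per = Pc-inj (sym (cP^ (suc N) j) ■ period) ; sumδ = orbit-sum }
       where open PeriodU (periodicU rj (g-P j))
     go (imag (t , q)) = record { N = 0 ; per = Pc-inj (sym (cP j) ■ c-Qδ (t , q)) ; sumδ = t ,
         (0⊹ (1ℚ ∙ Pc j) ■ 1∙ (Pc j) ■ q) }

  abstract
    orbit : ∀ j → OrbitData j
    orbit = orbit′

  σ-imag : ∀ {j} → Qδ (Pc j) → σ j ≡ j
  σ-imag {j} q = Pc-inj (sym (cP j) ■ c-Qδ q)

  σ≢ : ∀ {j} → RealP j → σ j ≢ j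
  σ≢ {j} rj h = ¬RL-Qδ rj (c-fix (cP j ■ cong Pc h))

  real-σ^ : ∀ k {j} → RealP j → RealP (σ^ k j)
  real-σ^ k {j} rj = subst RL (cP^ k j) (RL-c^ k rj)

  sumδ≢0 : ∀ j → proj₁ (OrbitData.sumδ (orbit j)) ≢ 0ℚ
  sumδ≢0 j e0 = pos⇒≢0 (≤∧≢⇒< (proj₁ (P-pos (σ^ N j)) i) (proj₂ ne))
      (+≡0ʳ (S≥0 N) (proj₁ (P-pos (σ^ N j)) i) (sym (coord N) ■ cong (_! i) (proj₂ sumδ) ■ !-∙ (proj₁ sumδ) δ i ■
      cong (_* δ ! i) e0 ■ *-zeroˡ (δ ! i)))
    where
    open OrbitData (orbit j)
    ne = ≢zero (proj₂ (P-pos (σ^ N j)))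
    i = proj₁ ne
    coord : ∀ k → S (suc k) (Pc j) ! i ≡ S k (Pc j) ! i + Pc (σ^ k j) ! i
    coord k = !-lin (S k (Pc j)) 1ℚ (c^ k (Pc j)) i ■ cong (S k (Pc j) ! i +_) (*-identityˡ _ ■ cong (_! i) (cP^ k j))
    S≥0 : ∀ k → 0ℚ ≤ S k (Pc j) ! i
    S≥0 zero = ≤-reflexive (sym (!-zero i))
    S≥0 (suc k) = subst (0ℚ ≤_) (sym (coord k)) (0≤+ (S≥0 k) (proj₁ (P-pos (σ^ k j)) i))

  Orb : Fin m → Fin m → Set
  Orb j l = ∃ λ k → σ^ k j ≡ l

  Orb-trans : ∀ {i j l} → Orb i j → Orb j l → Orb i l
  Orb-trans {i} (a , refl) (b , refl) = b ℕ.+ a , σ^-+ b a i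

  σ^-mult : ∀ {j M} → σ^ M j ≡ j → ∀ q → σ^ (q ℕ.* M) j ≡ j
  σ^-mult h zero = refl
  σ^-mult {j} {M} h (suc q) = σ^-+ M (q ℕ.* M) j ■ cong (σ^ M) (σ^-mult {j} {M} h q) ■ h

  Orb-sym : ∀ {j l} → Orb j l → Orb l j
  Orb-sym {j} (k , refl) = k ℕ.* N , (sym (σ^-+ (k ℕ.* N) k j) ■ cong (λ z → σ^ z j)
      (ℕₚ.+-comm (k ℕ.* N) k ■ sym (ℕₚ.*-suc k N)) ■ σ^-mult {j} {suc N} per k)
    where open OrbitData (orbit j)

  σ^-mod : ∀ {j M} → σ^ (suc M) j ≡ j → ∀ k → σ^ k j ≡ σ^ (k % suc M) j
  σ^-mod {j} {M} h k = cong (λ z → σ^ z j) (m≡m%n+[m/n]*n k (suc M)) ■ σ^-+ (k % suc M) ((k quot suc M) ℕ.* suc M) j ■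
      cong (σ^ (k % suc M)) (σ^-mult {j} {suc M} h (k quot suc M))

  Orb? : ∀ j l → Dec (Orb j l)
  Orb? j l with Finₚ.any? (λ (i : Fin (suc (OrbitData.N (orbit j)))) → σ^ (toℕ i) j Fin.≟ l)
  ... | yes (i , h) = yes (toℕ i , h)
  ... | no ¬h = no (λ { (k , h) → ¬h (Fin.fromℕ< (m%n<n k (suc (OrbitData.N (orbit j)))) ,
      (cong (λ z → σ^ z j) (Finₚ.toℕ-fromℕ< (m%n<n k (suc (OrbitData.N (orbit j))))) ■
      sym (σ^-mod {j} {OrbitData.N (orbit j)} (OrbitData.per (orbit j)) k) ■ h)) })

  -- The orbit sum of `Pc j` is a multiple of δ and pairs to 0 with `Pc l`. For `l` outside the
  -- orbit every term is nonpositive, hence zero.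
  Link⇒Orb : ∀ {j l} → Link j l → Orb j l
  Link⇒Orb {j} {l} lk with Orb? j l
  ... | yes o = o
  ... | no ¬o = ⊥-elim (Link⇒ {j} {l} lk (sym (neg-neg _) ■ cong -_ (Σℕ≡0⇒ (suc N) {λ i → - ⟪ Pc (σ^ i j) , Pc l ⟫}
      (λ i → 0≤-neg (offdiag {σ^ i j} {l} (λ q → ¬o (i , sym q)))) total (s≤s z≤n))))
    where
    open OrbitData (orbit j)
    Σℕ-neg : ∀ k f → Σℕ k (λ i → - f i) ≡ - Σℕ k f
    Σℕ-neg zero f = refl
    Σℕ-neg (suc k) f = cong (_+ - f k) (Σℕ-neg k f) ■ solve 2 (λ a b → :- a :+ :- b := :- (a :+ b)) refl (Σℕ k f) (f k)
    Σℕ-+ : ∀ k f h → Σℕ k (λ i → f i + h i) ≡ Σℕ k f + Σℕ k h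
    Σℕ-+ zero f h = refl
    Σℕ-+ (suc k) f h = cong (_+ (f k + h k)) (Σℕ-+ k f h) ■
        solve 4 (λ a b c d → a :+ b :+ (c :+ d) := a :+ c :+ (b :+ d)) refl (Σℕ k f) (Σℕ k h) (f k) (h k)
    total : Σℕ (suc N) (λ i → - ⟪ Pc (σ^ i j) , Pc l ⟫) ≡ 0ℚ
    total = Σℕ-neg (suc N) _ ■ cong -_ (Σℕ-cong (suc N) (λ i → cong (λ z → ⟪ z , Pc l ⟫) (sym (cP^ i j))) ■ Σℕ-+ (suc N) _ _ ■
        cong₂ _+_ (sym (E-Sˡ (suc N) (Pc j) (Pc l))) (sym (E-Sʳ (suc N) (Pc j) (Pc l))) ■ ⟪⟫-comm (S (suc N) (Pc j)) (Pc l) ■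
        ⟪Qδ⟫ (Pc l) sumδ)

  Comp⇒Orb : ∀ {j l} → SameComp j l → Orb j l
  Comp⇒Orb ε = 0 , refl
  Comp⇒Orb (lk ◅ rest) = Orb-trans (Link⇒Orb lk) (Comp⇒Orb rest)

  τ : Fin m → Fin m
  τ l = σ^ (OrbitData.N (orbit l)) l

  στ : ∀ l → σ (τ l) ≡ l
  στ l = OrbitData.per (orbit l)

  τσ : ∀ l → τ (σ l) ≡ l
  τσ l = σ-inj (στ (σ l))

  E-σ : ∀ l w → E (Pc (σ l)) w ≡ - E w (Pc l)
  E-σ l w = cong (λ z → E z w) (sym (cP l)) ■ c-skew (Pc l) w

  E-P≥0 : ∀ {b} → RL b → 0ℚ < g b → ∀ l → 0ℚ ≤ E (Pc l) b
  E-P≥0 {b} rb gb l = go (kind l)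
    where
    go : Kind l → 0ℚ ≤ E (Pc l) b
    go (real rl) = E≥0 rb gb rl (P-pos l) (g-P l)
    go (imag (t , q)) = subst (0ℚ ≤_) (sym (E∙ˡ t δ b) ■ cong (λ z → E z b) (sym q))
        (0≤* (0≤*⇒0≤ (δ>0 i₀) (subst (0ℚ ≤_) (cong (_! i₀) q ■ !-∙ t δ i₀ ■ *-comm t (δ ! i₀)) (proj₁ (P-pos l) i₀)))
        (<⇒≤ gb))

  -- Skewness trades the arguments for a sign and a shift by `σ`, which reduces this to `E-P≥0`.
  E-P≤0 : ∀ {b} → RL b → 0ℚ < g b → ∀ l → E b (Pc l) ≤ 0ℚ
  E-P≤0 {b} rb gb l = ≤0-neg (subst (0ℚ ≤_) (E-σ l b) (E-P≥0 rb gb (σ l)))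

  open Factorization factorization renaming (b to b₀; RL-b to RL-b₀; gb>0 to gb₀>0) using (R; RL-R; g-R; perp; c≡R)

  record Reach (j : Fin m) (v : V) : Set where
    constructor reach
    field
      z : Fin m → ℚ
      z-eq : v ≡ Pc j ⊹ 1ℚ ∙ lc z Pc
      z-supp : ∀ l → z l ≢ 0ℚ → SameComp j l × E b₀ (Pc l) ≡ 0ℚ

  linked-to : ∀ {j v} (r : Reach j v) a → ⟪ v , Pc a ⟫ ≢ 0ℚ → SameComp j a
  linked-to {j} {v} (reach z z-eq zs) a ne = go (⟪ Pc j , Pc a ⟫ ≟ 0ℚ)
    where
    val : ⟪ v , Pc a ⟫ ≡ ⟪ Pc j , Pc a ⟫ + 1ℚ * sumFin (λ l → z l * ⟪ Pc a , Pc l ⟫)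
    val = cong (λ w → ⟪ w , Pc a ⟫) z-eq ■ ⟪⟫ˡ (Pc j) 1ℚ (lc z Pc) (Pc a) ■
        cong (λ w → ⟪ Pc j , Pc a ⟫ + 1ℚ * w) (⟪⟫-comm (lc z Pc) (Pc a) ■ ⟪lc⟫ (Pc a) z Pc)
    go : Dec (⟪ Pc j , Pc a ⟫ ≡ 0ℚ) → SameComp j a
    go (no h) = mkLink {j} {a} h ◅ ε
    go (yes h) = through (sum-≢0⇒ {m} (λ l → z l * ⟪ Pc a , Pc l ⟫) (λ e0 → ne (val ■ cong₂ (λ x y → x + 1ℚ * y) h e0 ■ refl)))
      where
      through : (∃ λ l → z l * ⟪ Pc a , Pc l ⟫ ≢ 0ℚ) → SameComp j a
      through (l , q) = let q₁ , q₂ = factors≢0 {z l} {⟪ Pc a , Pc l ⟫} q in proj₁ (zs l q₁) ◅◅ (mkLink {l} {a} (λ e0 → q₂ (⟪⟫-comm (Pc a) (Pc l) ■ e0)) ◅ ε)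

  -- Since `E b₀` is nonpositive on simple roots and kills ρ, it kills every simple root in the
  -- support of ρ. If the reflection moves `v`, that support meets the component of `j`, hence lies
  -- in it.
  reach-refl : ∀ {j v ρ} → RL ρ → g ρ ≡ 0ℚ → E b₀ ρ ≡ 0ℚ → Reach j v → Reach j (refl-by ρ v)
  reach-refl {j} {v} {ρ} r h p rv = decide (⟪ ρ , v ⟫ ≟ 0ℚ) (coherent r)
    where
    open Reach rv
    combine : ∀ q (x : Expansion (q ∙ ρ)) → q * q ≡ 1ℚ → ⟪ ρ , v ⟫ ≢ 0ℚ → Reach j (refl-by ρ v)
    combine q (expansion k k≥0 k-eq supp) qq ne = reach (λ l → z l + y * k l) eq′ sup′
      where
      y = - coef ρ v * q
      ρ≡ : ρ ≡ q ∙ lc k Pc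
      ρ≡ = sym (1∙ ρ) ■ cong (_∙ ρ) (sym qq) ■ sym (∙∙ q q ρ) ■ cong (q ∙_) (sym k-eq)
      eq′ : refl-by ρ v ≡ Pc j ⊹ 1ℚ ∙ lc (λ l → z l + y * k l) Pc
      eq′ = vext (λ i → !-lin v (- coef ρ v) ρ i ■ cong₂ (λ a b → a + (- coef ρ v) * b)
          (cong (_! i) z-eq ■ !-lin (Pc j) 1ℚ (lc z Pc) i) (cong (_! i) ρ≡ ■ !-∙ q (lc k Pc) i) ■
        solve 5 (λ p o z c w → p :+ o :* z :+ c :* w := p :+ (o :* z :+ c :* w)) refl (Pc j ! i) 1ℚ (lc z Pc ! i) (- coef ρ v)
            (q * lc k Pc ! i) ■ sym (!-lin (Pc j) 1ℚ (lc (λ l → z l + y * k l) Pc) i ■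
            cong (Pc j ! i +_) (cong (1ℚ *_) (cong (_! i) (lc-lin z y k Pc) ■ !-lin (lc z Pc) y (lc k Pc) i) ■
           solve 4 (λ z c q w → con 1ℚ :* (z :+ c :* q :* w) := con 1ℚ :* z :+ c :* (q :* w)) refl (lc z Pc ! i) (- coef ρ v) q
               (lc k Pc ! i))))
      hook : ∃ λ a → k a * ⟪ v , Pc a ⟫ ≢ 0ℚ
      hook = sum-≢0⇒ {m} (λ a → k a * ⟪ v , Pc a ⟫) (λ e0 → ne (⟪⟫-comm ρ v ■ cong (λ w → ⟪ v , w ⟫) ρ≡ ■
          cong₂ _+_ (E∙ʳ q (lc k Pc) v) (E∙ˡ q (lc k Pc) v) ■ sym (*-distribˡ-+ q (E v (lc k Pc)) (E (lc k Pc) v)) ■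
          cong (q *_) (⟪lc⟫ v k Pc ■ e0) ■ *-zeroʳ q))
      k-perp : ∀ l → k l ≢ 0ℚ → E b₀ (Pc l) ≡ 0ℚ
      k-perp l nz = *≡0 {k l} (sym (neg-neg _) ■ cong -_ (sum≡0⇒ {m} {λ l → - (k l * E b₀ (Pc l))}
          (λ l → subst (0ℚ ≤_) (solve 2 (λ x y → x :* (:- y) := :- (x :* y)) refl (k l) (E b₀ (Pc l)))
          (0≤* (k≥0 l) (0≤-neg (E-P≤0 RL-b₀ gb₀>0 l)))) (sum-neg {m} _ ■ cong -_
          (sym (E-lcʳ k Pc b₀) ■ cong (E b₀) k-eq ■ E∙ʳ q ρ b₀ ■ cong (q *_) p ■ *-zeroʳ q)) l)) nz
      comp-k : ∀ l → k l ≢ 0ℚ → SameComp j l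
      comp-k l nz = let q₁ , q₂ = factors≢0 {k (proj₁ hook)} {⟪ v , Pc (proj₁ hook) ⟫} (proj₂ hook) in linked-to rv (proj₁ hook) q₂ ◅◅ supp (proj₁ hook) l q₁ nz
      sup′ : ∀ l → z l + y * k l ≢ 0ℚ → SameComp j l × E b₀ (Pc l) ≡ 0ℚ
      sup′ l nz with k l ≟ 0ℚ
      ... | no kn = comp-k l kn , k-perp l kn
      ... | yes kz = z-supp l (λ e0 → nz (cong₂ (λ a b → a + y * b) e0 kz ■ solve 1
          (λ s → con 0ℚ :+ s :* con 0ℚ := con 0ℚ) refl y))
    decide : Dec (⟪ ρ , v ⟫ ≡ 0ℚ) → Positive ρ ⊎ Positive ((- 1ℚ) ∙ ρ) → Reach j (refl-by ρ v)
    decide (yes e0) _ = subst (Reach j) (sym (refl-orth e0)) rv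
    decide (no ne) (inj₁ pρ) = combine 1ℚ (subst Expansion (sym (1∙ ρ)) (expand r pρ h)) refl ne
    decide (no ne) (inj₂ pρ) = combine (- 1ℚ) (expand (RL-neg r) pρ (g-neg h)) refl ne

  reach-R : ∀ {j L} → All RL L → All (λ ρ → g ρ ≡ 0ℚ) L → All (λ ρ → E b₀ ρ ≡ 0ℚ) L → Reach j (actR L (Pc j))
  reach-R {j} [] [] [] = reach (λ _ → 0ℚ) (vext (λ i → sym (!-lin (Pc j) 1ℚ (lc (λ _ → 0ℚ) Pc) i ■
      cong (λ z → Pc j ! i + 1ℚ * z) (!-lc (λ _ → 0ℚ) Pc i ■ sum-cong {m} (λ l → *-zeroˡ (Pc l ! i)) ■ sum-0 m) ■
      solve 1 (λ p → p :+ con 1ℚ :* con 0ℚ := p) refl (Pc j ! i)))) (λ l nz → ⊥-elim (nz refl))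
  reach-R (r ∷ rs) (h ∷ hs) (p ∷ ps) = reach-refl r h p (reach-R rs hs ps)

  abstract
    -- Modulo δ, `c` is the product of the reflections in `R`, and each of them preserves `Reach j`.
    rotate : ∀ j → ∃₂ λ z x → Pc (σ j) ≡ Pc j ⊹ 1ℚ ∙ lc z Pc ⊹ x ∙ δ × (∀ l → z l ≢ 0ℚ → SameComp j l × E b₀ (Pc l) ≡ 0ℚ)
    rotate j = z , proj₁ cr , (sym (cP j) ■ proj₂ cr ■ cong (_⊹ proj₁ cr ∙ δ) z-eq) , z-supp
      where
      open Reach (reach-R {j} RL-R g-R perp)
      cr : ∃ λ x → c (Pc j) ≡ actR R (Pc j) ⊹ x ∙ δ
      cr = c≡R (Pc j)

  -- A real `Pc (σ j)` has nonzero pairing with itself, and modulo δ it is reached from `Pc j`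
  -- inside the component of `j`. With `Comp⇒Orb` this identifies components with σ-orbits.
  Comp-σ : ∀ j → SameComp j (σ j)
  Comp-σ j = go (kind j)
    where
    go : Kind j → SameComp j (σ j)
    go (imag q) = subst (SameComp j) (sym (σ-imag q)) ε
    go (real rj) = let z , x , eq , zs = rotate j in
      linked-to (reach z refl zs) (σ j) (λ e0 → pos⇒≢0 (0<+ (D>0 (real-σ^ 1 rj)) (<⇒≤ (D>0 (real-σ^ 1 rj))))
          (cong (λ w → ⟪ w , Pc (σ j) ⟫) eq ■ ⟪⟫ˡ (Pc j ⊹ 1ℚ ∙ lc z Pc) x δ (Pc (σ j)) ■
          cong₂ (λ a b → a + x * b) e0 (⟪δ⟫ (Pc (σ j))) ■ solve 1 (λ x → con 0ℚ :+ x :* con 0ℚ := con 0ℚ) refl x))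

  Orb⇒Comp : ∀ {j l} → Orb j l → SameComp j l
  Orb⇒Comp {j} (k , refl) = go k
    where
    go : ∀ k → SameComp j (σ^ k j)
    go zero = ε
    go (suc k) = go k ◅◅ Comp-σ (σ^ k j)

-- Positions of b in the orbits, and the Euler matrix of Π_c.

module Concentration (H : AffineData) where
  open AffineData H
  open TubeRotation H public
  open Factorization factorization renaming (b to b₀; RL-b to RL-b₀; gb>0 to gb₀>0) using ()

  -- Read `rotate` as a relation modulo δ. Its coefficient is 1 at `j`, since `z` vanishes wherever
  -- `E b₀` does not and σ j differs from `j`; at another such `l` it is nonpositive. This
  -- contradicts `relation-sign`.
  conc₀ : ∀ {j l} → RealP j → E b₀ (Pc j) ≢ 0ℚ → SameComp j l → E b₀ (Pc l) ≢ 0ℚ → l ≡ j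
  conc₀ {j} {l} rj nj sc nl with l Fin.≟ j
  ... | yes e0 = e0
  ... | no ne = ⊥-elim (contra (rotate j))
    where
    contra : (∃₂ λ z x → Pc (σ j) ≡ Pc j ⊹ 1ℚ ∙ lc z Pc ⊹ x ∙ δ × (∀ l → z l ≢ 0ℚ → SameComp j l × E b₀ (Pc l) ≡ 0ℚ)) → ⊥
    contra (z , x , eq , zs) = relation-sign {w} (- x , vext coords) (Comp-sym sc) wl wj
      where
      w : Fin m → ℚ
      w i = (kron j i + (- 1ℚ) * kron (σ j) i) + 1ℚ * z i
      vanish : ∀ {i} → E b₀ (Pc i) ≢ 0ℚ → z i ≡ 0ℚ
      vanish {i} ni with z i ≟ 0ℚ
      ... | yes e0 = e0
      ... | no nz = ⊥-elim (ni (proj₂ (zs i nz)))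
      coords : ∀ i → lc w Pc ! i ≡ ((- x) ∙ δ) ! i
      coords i = cong (_! i) (lc-lin (λ i → kron j i + (- 1ℚ) * kron (σ j) i) 1ℚ z Pc) ■
          !-lin (lc (λ i → kron j i + (- 1ℚ) * kron (σ j) i) Pc) 1ℚ (lc z Pc) i ■
        cong (_+ 1ℚ * lc z Pc ! i) (cong (_! i) (lc-lin (kron j) (- 1ℚ) (kron (σ j)) Pc ■
            cong₂ (λ a b → a ⊹ (- 1ℚ) ∙ b) (lc-kron j Pc) (lc-kron (σ j) Pc)) ■ !-lin (Pc j) (- 1ℚ) (Pc (σ j)) i ■
            cong (λ y → Pc j ! i + (- 1ℚ) * y) (cong (_! i) eq ■ !-lin (Pc j ⊹ 1ℚ ∙ lc z Pc) x δ i ■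
            cong (_+ x * δ ! i) (!-lin (Pc j) 1ℚ (lc z Pc) i))) ■
          solve 4 (λ p z x d → p :+ con (- 1ℚ) :* (p :+ con 1ℚ :* z :+ x :* d) :+ con 1ℚ :* z := (:- x) :* d) refl (Pc j ! i)
              (lc z Pc ! i) x (δ ! i) ■ sym (!-∙ (- x) δ i)
      wj : 0ℚ < w j
      wj = subst (0ℚ <_) (sym (cong₂ (λ a b → (a + (- 1ℚ) * b) + 1ℚ * z j) (kron-refl j) (kron-≢ (σ≢ rj ∘ sym)) ■
          cong (λ y → (1ℚ + (- 1ℚ) * 0ℚ) + 1ℚ * y) (vanish nj) ■ refl)) 0<1
      wl : w l ≤ 0ℚ
      wl = ≤0-neg (subst (0ℚ ≤_) (solve 1 (λ k → k := :- (con 0ℚ :+ con (- 1ℚ) :* k :+ con 1ℚ :* con 0ℚ)) refl (kron (σ j) l) ■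
          cong₂ (λ a b → - ((a + (- 1ℚ) * kron (σ j) l) + 1ℚ * b)) (sym (kron-≢ ne)) (sym (vanish nl))) (kron≥0 (σ j) l))

  -- The position of `b` in an orbit is the simple root on which `E b` does not vanish. Only
  -- uniqueness is recorded; existence follows from `g b > 0`.
  record Conc (b : V) : Set where
    constructor mkConc
    field
      rl   : RL b
      g>0  : 0ℚ < g b
      conc : ∀ j k → E b (Pc j) ≢ 0ℚ → E b (Pc (σ^ k j)) ≢ 0ℚ → σ^ k j ≡ j
  open Conc

  σ^-imag : ∀ {j} → Qδ (Pc j) → ∀ k → σ^ k j ≡ j
  σ^-imag q zero = refl
  σ^-imag {j} q (suc k) = cong σ (σ^-imag q k) ■ σ-imag q

  Conc₀ : Conc b₀
  Conc₀ = mkConc RL-b₀ gb₀>0 (λ j k nj nk → go j k nj nk (kind j))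
    where
    go : ∀ j k → E b₀ (Pc j) ≢ 0ℚ → E b₀ (Pc (σ^ k j)) ≢ 0ℚ → Kind j → σ^ k j ≡ j
    go j k nj nk (real rj) = conc₀ rj nj (Orb⇒Comp (k , refl)) nk
    go j k nj nk (imag q) = σ^-imag q k

  E-cb : ∀ b l → E (c b) (Pc l) ≡ E b (Pc (τ l))
  E-cb b l = cong (E (c b)) (cong Pc (sym (στ l)) ■ sym (cP (τ l))) ■ E-cc b (Pc (τ l))

  Conc-c : ∀ {b} → Conc b → Conc (c b)
  Conc-c {b} cb = mkConc (RL-c (rl cb)) (subst (0ℚ <_) (sym (g-c b)) (g>0 cb)) (λ j k nj nk →
    cong (σ^ k) (sym (στ j)) ■ σ^-suc k (τ j) ■ cong σ (conc cb (τ j) k (λ e0 → nj (E-cb b j ■ e0))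
        (λ e0 → nk (E-cb b (σ^ k j) ■ cong (λ z → E b (Pc z)) (cong τ (cong (σ^ k) (sym (στ j)) ■ σ^-suc k (τ j)) ■
        τσ (σ^ k (τ j))) ■ e0))) ■ στ j)

  Conc-c^ : ∀ k {b} → Conc b → Conc (c^ k b)
  Conc-c^ zero cb = cb
  Conc-c^ (suc k) cb = Conc-c (Conc-c^ k cb)

  -- Summed over a period of the orbit, `E b` gives a nonzero multiple of `E b δ`, which is `- g b`.
  position : ∀ {b} → 0ℚ < g b → ∀ j → ∃ λ k → E b (Pc (σ^ k j)) ≢ 0ℚ
  position {b} gb j = let k , ne = Σℕ≢0⇒ (suc N) total in k , (λ e0 → ne (cong (E b) (cP^ k j) ■ e0))
    where
    open OrbitData (orbit j)
    total : Σℕ (suc N) (λ i → E b (c^ i (Pc j))) ≢ 0ℚ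
    total e0 = *≢0 (sumδ≢0 j) (λ e1 → pos⇒≢0 gb (sym (neg-neg (g b)) ■ cong -_ e1))
        (cong (proj₁ sumδ *_) (sym (E-δʳ b)) ■ sym (E∙ʳ (proj₁ sumδ) δ b) ■ cong (E b) (sym (proj₂ sumδ)) ■
        E-Sʳ (suc N) (Pc j) b ■ e0)

  -- Applying `c` to `b₀` advances its position by `σ`, so a suitable iterate sits at `j`.
  at : ∀ j → ∃ λ b → Conc b × E b (Pc j) ≢ 0ℚ
  at j = let k , ne = position gb₀>0 j ; i , eq = Orb-sym {j} (k , refl) in
    c^ i b₀ , Conc-c^ i Conc₀ , (λ e0 → ne (sym (E-c^ i b₀ (Pc (σ^ k j))) ■ cong (E (c^ i b₀)) (cP^ i (σ^ k j) ■ cong Pc eq) ■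
        e0))

  τ≢ : ∀ {j} → RealP j → τ j ≢ j
  τ≢ {j} rj h = σ≢ rj (cong σ (sym h) ■ στ j)

  coef-at : ∀ {b j} → Conc b → RealP j → E b (Pc j) ≢ 0ℚ → coef (Pc j) b * D (Pc j) ≡ E b (Pc j)
  coef-at {b} {j} cb rj nj = coef-* b (D≢0 rj) ■ cong (_+ E b (Pc j)) Ejb ■ +-identityˡ (E b (Pc j))
    where
    off : E b (Pc (τ j)) ≡ 0ℚ
    off with E b (Pc (τ j)) ≟ 0ℚ
    ... | yes e0 = e0
    ... | no ne = ⊥-elim (τ≢ rj (conc cb j (OrbitData.N (orbit j)) nj ne))
    Ejb : E (Pc j) b ≡ 0ℚ
    Ejb = cong (λ z → E (Pc z) b) (sym (στ j)) ■ E-σ (τ j) b ■ cong -_ off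

  E-refl : ∀ j b w → E (refl-by (Pc j) b) w ≡ E b w - coef (Pc j) b * E (Pc j) w
  E-refl j b w = Eˡ b (- coef (Pc j) b) (Pc j) w ■ solve 3 (λ a k x → a :+ (:- k) :* x := a :- k :* x) refl (E b w)
      (coef (Pc j) b) (E (Pc j) w)

  -- Take `b` at position `j` and reflect it in `Pc j`. The sign rule `E-P≤0` applies to the
  -- reflected root, and elsewhere in the orbit its value is a positive multiple of the wanted
  -- entry.
  E-PP≤0 : ∀ {j} → RealP j → ∀ k → σ^ k j ≢ j → E (Pc j) (Pc (σ^ k j)) ≤ 0ℚ
  E-PP≤0 {j} rj k ne = go (at j)
    where
    go : (∃ λ b → Conc b × E b (Pc j) ≢ 0ℚ) → E (Pc j) (Pc (σ^ k j)) ≤ 0ℚ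
    go (b , cb , nj) = ≤0-neg
        (0≤*⇒0≤ κ>0 (subst (0ℚ ≤_) eq (0≤-neg (E-P≤0 (RL-refl rj (rl cb)) (subst (0ℚ <_) (sym (g-refl b (g-P j))) (g>0 cb))
        (σ^ k j)))))
      where
      κ = - coef (Pc j) b
      κ>0 : 0ℚ < κ
      κ>0 = 0<*⇒0< (D>0 rj) (subst (0ℚ <_) (cong -_ (sym (coef-at cb rj nj)) ■ solve 2
          (λ k d → :- (k :* d) := d :* (:- k)) refl (coef (Pc j) b) (D (Pc j)))
          (≤∧≢⇒< (0≤-neg (E-P≤0 (rl cb) (g>0 cb) j)) (λ e0 → nj (sym (neg-neg (E b (Pc j))) ■ cong -_ e0))))
      zero-there : E b (Pc (σ^ k j)) ≡ 0ℚ
      zero-there with E b (Pc (σ^ k j)) ≟ 0ℚ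
      ... | yes e0 = e0
      ... | no nz = ⊥-elim (ne (conc cb j k nj nz))
      eq : - E (refl-by (Pc j) b) (Pc (σ^ k j)) ≡ κ * - E (Pc j) (Pc (σ^ k j))
      eq = cong -_ (E-refl j b (Pc (σ^ k j)) ■ cong (_- coef (Pc j) b * E (Pc j) (Pc (σ^ k j))) zero-there) ■
          solve 2 (λ k x → :- (con 0ℚ :- k :* x) := (:- k) :* (:- x)) refl (coef (Pc j) b) (E (Pc j) (Pc (σ^ k j)))

  D-σ : ∀ l → D (Pc (σ l)) ≡ D (Pc l)
  D-σ l = cong D (sym (cP l)) ■ E-cc (Pc l) (Pc l)

  E-PP-pred : ∀ {j l} → σ l ≡ j → E (Pc j) (Pc l) ≡ - D (Pc j)
  E-PP-pred {l = l} refl = E-σ l (Pc l) ■ cong -_ (sym (D-σ l))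

  -- The row of `E` at `Pc j` sums to 0 over a period of the orbit. The entries at `j` and its
  -- predecessor are `D (Pc j)` and its opposite and cancel; what is left is nonpositive with sum 0.
  E-PP-orb : ∀ {j} → RealP j → ∀ k → σ^ k j ≢ j → σ^ (suc k) j ≢ j → E (Pc j) (Pc (σ^ k j)) ≡ 0ℚ
  E-PP-orb {j} rj k n₁ n₂ = cong (λ z → E (Pc j) (Pc z)) (σ^-mod {j} {N} per k) ■ sym (u-out i₁ (n₁ ∘ back k) (n₂ ∘ back′)) ■
      sym (neg-neg (u i₁)) ■ cong -_ (Σℕ≡0⇒ (suc N) {λ i → - u i} (λ i → 0≤-neg (u≤0 i)) total (m%n<n k (suc N)))
    where
    open import Data.Nat.DivMod using (_%_; m%n<n)
    open OrbitData (orbit j)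
    i₁ = k % suc N
    back : ∀ k → σ^ (k % suc N) j ≡ j → σ^ k j ≡ j
    back k h = σ^-mod {j} {N} per k ■ h
    back′ : σ^ (suc i₁) j ≡ j → σ^ (suc k) j ≡ j
    back′ h = cong σ (σ^-mod {j} {N} per k) ■ h
    -- `u` is the row with its two exceptional entries removed. `suc N` need not be the least
    -- period, so they are removed by indicators, which telescope over any period.
    f ind u : ℕ → ℚ
    f i = E (Pc j) (Pc (σ^ i j))
    ind i = kron j (σ^ i j)
    u i = f i - D (Pc j) * ind i + D (Pc j) * ind (suc i)
    u-out : ∀ i → σ^ i j ≢ j → σ^ (suc i) j ≢ j → u i ≡ f i
    u-out i a b = cong₂ (λ x y → f i - D (Pc j) * x + D (Pc j) * y) (kron-≢ a) (kron-≢ b) ■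
        solve 2 (λ f d → f :- d :* con 0ℚ :+ d :* con 0ℚ := f) refl (f i) (D (Pc j))
    u≤0 : ∀ i → u i ≤ 0ℚ
    u≤0 i = go (σ^ i j Fin.≟ j) (σ^ (suc i) j Fin.≟ j)
      where
      go : Dec (σ^ i j ≡ j) → Dec (σ^ (suc i) j ≡ j) → u i ≤ 0ℚ
      go (yes a) (yes b) = ⊥-elim (σ≢ rj (cong σ (sym a) ■ b))
      go (yes a) (no b) = ≤-reflexive (cong₂ (λ x y → x - D (Pc j) * y + D (Pc j) * ind (suc i))
          (cong (λ z → E (Pc j) (Pc z)) a) (cong (kron j) a ■ kron-refl j) ■
          cong (λ y → D (Pc j) - D (Pc j) * 1ℚ + D (Pc j) * y) (kron-≢ b) ■
          solve 1 (λ d → d :- d :* con 1ℚ :+ d :* con 0ℚ := con 0ℚ) refl (D (Pc j)))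
      go (no a) (yes b) = ≤-reflexive (cong₂ (λ x y → x - D (Pc j) * y + D (Pc j) * ind (suc i)) (E-PP-pred b) (kron-≢ a) ■
          cong (λ y → - D (Pc j) - D (Pc j) * 0ℚ + D (Pc j) * y) (cong (kron j) b ■ kron-refl j) ■
          solve 1 (λ d → :- d :- d :* con 0ℚ :+ d :* con 1ℚ := con 0ℚ) refl (D (Pc j)))
      go (no a) (no b) = ≤-trans (≤-reflexive (u-out i a b)) (E-PP≤0 rj i a)
    telescope : ∀ M → Σℕ M (λ i → - u i) ≡ - Σℕ M f + D (Pc j) * ind 0 - D (Pc j) * ind M
    telescope zero = solve 1 (λ x → con 0ℚ := :- con 0ℚ :+ x :- x) refl (D (Pc j) * ind 0)
    telescope (suc M) = cong (_+ - u M) (telescope M) ■ solve 5 (λ s f x y z → :- s :+ x :- y :+ :- (f :- y :+ z) := :-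
        (s :+ f) :+ x :- z) refl (Σℕ M f) (f M) (D (Pc j) * ind 0) (D (Pc j) * ind M) (D (Pc j) * ind (suc M))
    total : Σℕ (suc N) (λ i → - u i) ≡ 0ℚ
    total = telescope (suc N) ■ cong₂ (λ x y → - x + D (Pc j) * ind 0 - D (Pc j) * y) Σf (cong (kron j) per) ■
        solve 1 (λ x → :- con 0ℚ :+ x :- x := con 0ℚ) refl (D (Pc j) * ind 0)
      where
      Σf : Σℕ (suc N) f ≡ 0ℚ
      Σf = Σℕ-cong (suc N) (λ i → cong (E (Pc j)) (sym (cP^ i j))) ■ sym (E-Sʳ (suc N) (Pc j) (Pc j)) ■
          cong (E (Pc j)) (proj₂ sumδ) ■ E∙ʳ (proj₁ sumδ) δ (Pc j) ■ cong (proj₁ sumδ *_) (E-δʳ (Pc j) ■ cong -_ (g-P j)) ■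
          *-zeroʳ (proj₁ sumδ)

  -- All symmetric pairings between the two orbits vanish, so skewness makes
  -- `E (Pc (σ^ i j)) (Pc l)` independent of `i`. Its sum over a period is a multiple of `g (Pc l)`,
  -- which is 0.
  E-PP-other : ∀ {j l} → ¬ Orb j l → E (Pc j) (Pc l) ≡ 0ℚ
  E-PP-other {j} {l} no-orb = *≡0 {fromℕ (suc N)} (sym (const-sum (suc N)) ■ sym (E-Sˡ (suc N) (Pc j) (Pc l)) ■
      cong (λ z → E z (Pc l)) (proj₂ sumδ) ■ E∙ˡ (proj₁ sumδ) δ (Pc l) ■ cong (proj₁ sumδ *_) (g-P l) ■
      *-zeroʳ (proj₁ sumδ)) (pos⇒≢0 (0<fromℕsuc N))
    where
    open OrbitData (orbit j)
    pair0 : ∀ i → ⟪ Pc (σ^ i j) , Pc l ⟫ ≡ 0ℚ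
    pair0 i with ⟪ Pc (σ^ i j) , Pc l ⟫ ≟ 0ℚ
    ... | yes e0 = e0
    ... | no ne = ⊥-elim (no-orb (Orb-trans (i , refl) (Link⇒Orb (mkLink {σ^ i j} {l} ne))))
    const : ∀ i → E (c^ i (Pc j)) (Pc l) ≡ E (Pc j) (Pc l)
    const zero = refl
    const (suc i) = cong (λ z → E z (Pc l)) (cP^ (suc i) j) ■ E-σ (σ^ i j) (Pc l) ■
        solve 2 (λ a b → :- b := a :- (a :+ b)) refl (E (Pc (σ^ i j)) (Pc l)) (E (Pc l) (Pc (σ^ i j))) ■
        cong (λ y → E (Pc (σ^ i j)) (Pc l) - y) (pair0 i) ■ solve 1 (λ a → a :- con 0ℚ := a) refl (E (Pc (σ^ i j)) (Pc l)) ■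
        cong (λ z → E z (Pc l)) (sym (cP^ i j)) ■ const i
    const-sum : ∀ k → Σℕ k (λ i → E (c^ i (Pc j)) (Pc l)) ≡ fromℕ k * E (Pc j) (Pc l)
    const-sum zero = sym (*-zeroˡ (E (Pc j) (Pc l)))
    const-sum (suc k) = cong₂ _+_ (const-sum k) (const k) ■
        solve 2 (λ k x → k :* x :+ x := (con 1ℚ :+ k) :* x) refl (fromℕ k) (E (Pc j) (Pc l)) ■
        cong (_* E (Pc j) (Pc l)) (sym (fromℕ-suc k))

  E-PP : ∀ {j} → RealP j → ∀ l → l ≢ j → σ l ≢ j → E (Pc j) (Pc l) ≡ 0ℚ
  E-PP {j} rj l n₁ n₂ with Orb? j l
  ... | yes (k , refl) = E-PP-orb rj k n₁ n₂
  ... | no ¬o = E-PP-other ¬o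

  -- Reflecting in P_j moves the position of b from j to τ j.
  record Moved (b : V) (z : Fin m) : Set where
    constructor moved
    field
      b′ : V
      conc′ : Conc b′
      pos′ : E b′ (Pc z) ≢ 0ℚ
      unmoved : ∀ l → ¬ Orb z l → E b′ (Pc l) ≡ E b (Pc l)

  -- The only nonzero entries in the row of `E` at `Pc j` are those at `j` and `τ j`. Hence the
  -- value at `j` is cancelled, reappears at `τ j`, and all other values stay.
  move : ∀ {b j} → Conc b → RealP j → E b (Pc j) ≢ 0ℚ → Moved b (τ j)
  move {b} {j} cb rj nj = moved b′ (mkConc (RL-refl rj (rl cb)) (subst (0ℚ <_) (sym (g-refl b (g-P j))) (g>0 cb)) conc-b′) at-τ
      (λ l ν → other l (λ e0 → ν (subst (Orb (τ j)) (sym e0) (1 , στ j))) (λ e0 → ν (0 , (cong τ (sym e0) ■ τσ l))))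
    where
    b′ = refl-by (Pc j) b
    k = coef (Pc j) b
    kD = coef-at cb rj nj
    at-j : E b′ (Pc j) ≡ 0ℚ
    at-j = E-refl j b (Pc j) ■ cong (λ z → E b (Pc j) - z) kD ■ +-inverseʳ (E b (Pc j))
    other : ∀ l → l ≢ j → σ l ≢ j → E b′ (Pc l) ≡ E b (Pc l)
    other l n₁ n₂ = E-refl j b (Pc l) ■ cong (λ z → E b (Pc l) - k * z) (E-PP rj l n₁ n₂) ■
        solve 2 (λ a k → a :- k :* con 0ℚ := a) refl (E b (Pc l)) k
    zero-off : ∀ i → σ^ i j ≢ j → E b (Pc (σ^ i j)) ≡ 0ℚ
    zero-off i ne with E b (Pc (σ^ i j)) ≟ 0ℚ
    ... | yes e0 = e0
    ... | no nz = ⊥-elim (ne (conc cb j i nj nz))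
    at-τ : E b′ (Pc (τ j)) ≢ 0ℚ
    at-τ e0 = nj (sym kD ■ solve 3 (λ k d a → k :* d := (a :- k :* (:- d)) :- a) refl k (D (Pc j)) (E b (Pc (τ j))) ■
        cong (_- E b (Pc (τ j))) (cong (λ z → E b (Pc (τ j)) - k * z) (sym (E-PP-pred (στ j))) ■ sym (E-refl j b (Pc (τ j))) ■
        e0) ■ cong (λ z → 0ℚ - z) (zero-off (OrbitData.N (orbit j)) (τ≢ rj)) ■ refl)
    data Where (l : Fin m) : Set where
      here  : l ≡ τ j → Where l
      there : ¬ Orb j l → E b (Pc l) ≢ 0ℚ → Where l
    locate : ∀ l → E b′ (Pc l) ≢ 0ℚ → Where l
    locate l nz = go (l Fin.≟ τ j)
      where
      n₁ : l ≢ j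
      n₁ e0 = nz (cong (λ z → E b′ (Pc z)) e0 ■ at-j)
      go : Dec (l ≡ τ j) → Where l
      go (yes e0) = here e0
      go (no ne) = there (λ { (i , refl) → nb (zero-off i n₁) }) nb
        where
        nb : E b (Pc l) ≢ 0ℚ
        nb e0 = nz (other l n₁ (λ e1 → ne (sym (τσ l) ■ cong τ e1)) ■ e0)
    conc-b′ : ∀ i k → E b′ (Pc i) ≢ 0ℚ → E b′ (Pc (σ^ k i)) ≢ 0ℚ → σ^ k i ≡ i
    conc-b′ i k ni nk = go (locate i ni) (locate (σ^ k i) nk)
      where
      go : Where i → Where (σ^ k i) → σ^ k i ≡ i
      go (here a) (here b) = b ■ sym a
      go (here a) (there ν _) = ⊥-elim (ν (Orb-trans (OrbitData.N (orbit j) , sym a) (k , refl)))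
      go (there ν _) (here b) = ⊥-elim (ν (Orb-trans (OrbitData.N (orbit j) , sym b) (Orb-sym (k , refl))))
      go (there _ a) (there _ b) = conc cb i k a b

  moves : ∀ t {b z} → Conc b → RealP z → E b (Pc (σ^ t z)) ≢ 0ℚ → Moved b z
  moves zero {b} cb rz nz = moved b cb nz (λ l _ → refl)
  moves (suc t) {b} {z} cb rz nz = go (move cb (real-σ^ (suc t) rz) nz)
    where
    go : Moved b (τ (σ^ (suc t) z)) → Moved b z
    go (moved b₁ c₁ p₁ u₁) = go₂ (moves t c₁ rz (subst (λ y → E b₁ (Pc y) ≢ 0ℚ) (τσ (σ^ t z)) p₁))
      where
      go₂ : Moved b₁ z → Moved b z
      go₂ (moved b₂ c₂ p₂ u₂) = moved b₂ c₂ p₂ (λ l ν → u₂ l ν ■ u₁ l (λ o → ν (Orb-trans (t , sym (τσ (σ^ t z))) o)))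

  -- Avoidance quantifies over an arbitrary predicate, so it is never decided; the construction of
  -- `b` is made under this modality.
  ¬¬_ : Set → Set
  ¬¬ A = ¬ ¬ A

  module Target (Avoid : Fin m → Set) (choice : ∀ x → RealP x → ¬¬ (∃ λ k → Avoid (σ^ k x)))
      (imag-ok : ∀ x → Qδ (Pc x) → Avoid x) where

    Cover : V → List (Fin m) → Set
    Cover b = All (λ x → ∀ k → E b (Pc (σ^ k x)) ≢ 0ℚ → Avoid (σ^ k x))

    -- Orbits are treated one at a time. Moving `b` inside the orbit of `x` does not change `E b` on
    -- the others (`off`), so what was covered stays covered; members of `xs` in the orbit of `x`
    -- itself share the new position (`on`).
    cover : ∀ xs → ¬¬ (∃ λ b → Conc b × Cover b xs)
    cover [] ν = ν (b₀ , Conc₀ , [])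
    cover (x ∷ xs) ν = cover xs (λ { (b , cb , cov) → step b cb cov (kind x) })
      where
      step : ∀ b → Conc b → Cover b xs → Kind x → ⊥
      step b cb cov (imag q) = ν (b , cb , (λ k _ → subst Avoid (sym (σ^-imag q k)) (imag-ok x q)) ∷ cov)
      step b cb cov (real rx) = choice x rx (λ { (k , av) → place k av })
        where
        place : ∀ k → Avoid (σ^ k x) → ⊥
        place k av = finish (moves (proj₁ there-to) cb (real-σ^ k rx)
            (subst (λ y → E b (Pc y) ≢ 0ℚ) (sym (proj₂ there-to)) (proj₂ here)))
          where
          p = σ^ k x
          here : ∃ λ i → E b (Pc (σ^ i x)) ≢ 0ℚ
          here = position (g>0 cb) x
          there-to : Orb p (σ^ (proj₁ here) x)
          there-to = Orb-trans (Orb-sym {x} (k , refl)) (proj₁ here , refl)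
          finish : Moved b p → ⊥
          finish (moved b′ cb′ pos′ un) = ν (b′ , cb′ , (λ i → on (Orb-trans (Orb-sym {x} (k , refl)) (i , refl))) ∷ All.map
              (λ old i nz → off i nz old (Orb? p (σ^ i _))) cov)
            where
            on : ∀ {l} → Orb p l → E b′ (Pc l) ≢ 0ℚ → Avoid l
            on (i , refl) nz = subst Avoid (sym (conc cb′ p i pos′ nz)) av
            off : ∀ {y} i → E b′ (Pc (σ^ i y)) ≢ 0ℚ → (∀ k → E b (Pc (σ^ k y)) ≢ 0ℚ → Avoid (σ^ k y)) → Dec
                (Orb p (σ^ i y)) → Avoid (σ^ i y)
            off i nz old (yes o) = on o nz
            off {y} i nz old (no ¬o) = old i (λ e0 → nz (un (σ^ i y) ¬o ■ e0))

    target : ¬¬ (∃ λ b → Conc b × (∀ l → E b (Pc l) ≢ 0ℚ → Avoid l))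
    target ν = cover (allFin m) (λ { (b , cb , cov) → ν (b , cb , (λ l → All.lookup cov (Mem.∈-allFin l) 0)) })
      where import Data.List.Membership.Propositional.Properties as Mem

-- Tube roots as arcs of σ-orbits, and arcs of maximal size.

module Arcs (H : AffineData) where
  open AffineData H
  open Concentration H public
  open import Relation.Binary.Construct.Closure.ReflexiveTransitive using (ε; _◅_; _◅◅_)

  private
    one-comp : ∀ {z a} → lc z Pc ≡ zeroV → (∀ i → z i ≢ 0ℚ → SameComp a i) → ∀ l → ¬ (0ℚ < z l)
    one-comp {z} {a} z0 sup l zl = pos⇒≢0 zl (lc≡0 nn P-pos z0 l)
      where
      nn : Nonneg z
      nn i = ≮⇒≥ (λ zi → relation-sign {z} (0ℚ , (z0 ■ sym (0∙ δ))) {l} {i}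
          (Comp-sym (sup i (<⇒≢ zi)) ◅◅ sup l (λ e0 → pos⇒≢0 zl e0)) (<⇒≤ zi) zl)

  -- Every orbit sum is a multiple of δ, so Π_c may be linearly dependent and the one-component
  -- condition matters. Pairing with β puts both supports in the same component; there a relation
  -- with sum 0 can have no positive coefficient.
  uniq : ∀ {β k k′} → D β ≢ 0ℚ → Supported k → lc k Pc ≡ β → Supported k′ → lc k′ Pc ≡ β → ∀ l → k l ≡ k′ l
  uniq {β} {k} {k′} Dβ sk eq sk′ eq′ = anchored anchor
    where
    hook₁ : ∃ λ b → k′ b * ⟪ β , Pc b ⟫ ≢ 0ℚ
    hook₁ = sum-≢0⇒ {m} (λ b → k′ b * ⟪ β , Pc b ⟫) (λ e0 → Dβ (half (cong (λ z → ⟪ β , z ⟫) (sym eq′) ■ ⟪lc⟫ β k′ Pc ■ e0)))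
    b₁ = proj₁ hook₁
    hook₂ : ∃ λ a → k a * ⟪ Pc b₁ , Pc a ⟫ ≢ 0ℚ
    hook₂ = sum-≢0⇒ {m} (λ a → k a * ⟪ Pc b₁ , Pc a ⟫) (λ e0 → proj₂ (factors≢0 {k′ b₁} {⟪ β , Pc b₁ ⟫} (proj₂ hook₁))
        (⟪⟫-comm β (Pc b₁) ■ cong (λ z → ⟪ Pc b₁ , z ⟫) (sym eq) ■ ⟪lc⟫ (Pc b₁) k Pc ■ e0))
    anchor : ∃ λ a → (∀ l → k l ≢ 0ℚ → SameComp a l) × (∀ l → k′ l ≢ 0ℚ → SameComp a l)
    anchor = proj₁ hook₂ , (λ l nz → sk (proj₁ hook₂) l (proj₁ fa) nz) ,
        (λ l nz → Comp-sym (mkLink {b₁} {proj₁ hook₂} (proj₂ fa) ◅ ε) ◅◅ sk′ b₁ l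
        (proj₁ (factors≢0 {k′ b₁} {⟪ β , Pc b₁ ⟫} (proj₂ hook₁))) nz)
      where fa = factors≢0 {k (proj₁ hook₂)} {⟪ Pc b₁ , Pc (proj₁ hook₂) ⟫} (proj₂ hook₂)
    anchored : (∃ λ a → (∀ l → k l ≢ 0ℚ → SameComp a l) × (∀ l → k′ l ≢ 0ℚ → SameComp a l)) → ∀ l → k l ≡ k′ l
    anchored (a , s₁ , s₂) l = ≤-antisym (0≤-⇒≤ (nneg {k l} {k′ l} (one-comp {λ i → k i + (- 1ℚ) * k′ i} (diff k k′ eq eq′)
        (sup k k′ s₁ s₂) l))) (0≤-⇒≤ (nneg {k′ l} {k l} (one-comp {λ i → k′ i + (- 1ℚ) * k i} (diff k′ k eq′ eq)
        (sup k′ k s₂ s₁) l)))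
      where
      nneg : ∀ {x y} → ¬ (0ℚ < x + (- 1ℚ) * y) → 0ℚ ≤ y - x
      nneg {x} {y} h = subst (0ℚ ≤_) (solve 2 (λ x y → :- (x :+ con (- 1ℚ) :* y) := y :- x) refl x y) (0≤-neg (≮⇒≥ h))
      diff : ∀ u v → lc u Pc ≡ β → lc v Pc ≡ β → lc (λ i → u i + (- 1ℚ) * v i) Pc ≡ zeroV
      diff u v hu hv = lc-lin u (- 1ℚ) v Pc ■ cong₂ (λ a b → a ⊹ (- 1ℚ) ∙ b) hu hv ■
          vext (λ i → !-lin β (- 1ℚ) β i ■ solve 1 (λ x → x :+ con (- 1ℚ) :* x := con 0ℚ) refl (β ! i) ■ sym (!-zero i))
      sup : ∀ u v → (∀ l → u l ≢ 0ℚ → SameComp a l) → (∀ l → v l ≢ 0ℚ → SameComp a l) → ∀ i → u i +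
          (- 1ℚ) * v i ≢ 0ℚ → SameComp a i
      sup u v su sv i nz with u i ≟ 0ℚ
      ... | no nu = su i nu
      ... | yes zu = sv i (λ e0 → nz (cong₂ (λ x y → x + (- 1ℚ) * y) zu e0 ■ refl))

  sum-τ : ∀ (f : Fin m → ℚ) → sumFin (λ l → f (τ l)) ≡ sumFin f
  sum-τ f = sum-cong {m} (λ l → sym (sum-kron {m} f (τ l))) ■ sum-swap {m} {m} _ ■
      sum-cong {m} (λ a → sum-*ʳ {m} (f a) _ ■ cong (_* f a) (sum-cong {m} (λ l → flip-kron a l ■
      sym (*-identityʳ (kron (σ a) l))) ■ sum-kron {m} (λ _ → 1ℚ) (σ a)) ■ *-identityˡ (f a))
    where
    flip-kron : ∀ a l → kron (τ l) a ≡ kron (σ a) l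
    flip-kron a l with a Fin.≟ τ l | l Fin.≟ σ a
    ... | yes _ | yes _ = refl
    ... | no _ | no _ = refl
    ... | yes p | no q = ⊥-elim (q (sym (στ l) ■ cong σ (sym p)))
    ... | no p | yes q = ⊥-elim (p (sym (τσ a) ■ cong τ (sym q)))

  D-τ : ∀ l → D (Pc (τ l)) ≡ D (Pc l)
  D-τ l = sym (D-σ (τ l)) ■ cong (λ z → D (Pc z)) (στ l)

  D-Orb : ∀ {j l} → Orb j l → D (Pc j) ≡ D (Pc l)
  D-Orb {j} (k , refl) = sym (E-c^ k (Pc j) (Pc j)) ■ cong D (cP^ k j)

  τ-imag : ∀ {l} → Qδ (Pc l) → τ l ≡ l
  τ-imag {l} q = cong τ (sym (σ-imag q)) ■ τσ l

  -- By the shape of the Euler matrix, `E (Pc l)` reads off the jump of the coefficient function on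
  -- entering `l` along its cycle.
  E-P-lc : ∀ {α k} → lc k Pc ≡ α → g α ≡ 0ℚ → ∀ l → E (Pc l) α ≡ D (Pc l) * (k l - k (τ l))
  E-P-lc {α} {k} eq gα l = go (kind l)
    where
    go : Kind l → E (Pc l) α ≡ D (Pc l) * (k l - k (τ l))
    go (imag (t , q)) = cong (λ z → E z α) q ■ E∙ˡ t δ α ■ cong (t *_) gα ■ *-zeroʳ t ■
        sym (cong (_* (k l - k (τ l))) (D-Qδ (t , q)) ■ *-zeroˡ (k l - k (τ l)))
    go (real rl) = cong (E (Pc l)) (sym eq) ■ E-lcʳ k Pc (Pc l) ■
        sum-cong {m} (λ a → cong (k a *_) (cartan-row a) ■ solve 4 (λ k d x y → k :* (d :* (x :- y)) := d :*
        (x :* k :+ con (- 1ℚ) :* (y :* k))) refl (k a) (D (Pc l)) (kron l a) (kron (τ l) a)) ■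
        sum-* {m} (D (Pc l)) _ ■ cong (D (Pc l) *_) (sum-+ {m} _ _ ■ cong₂ _+_ (sum-kron {m} k l)
            (sum-* {m} (- 1ℚ) _ ■ cong ((- 1ℚ) *_) (sum-kron {m} k (τ l))) ■
            solve 2 (λ x y → x :+ con (- 1ℚ) :* y := x :- y) refl (k l) (k (τ l)))
      where
      cartan-row : ∀ a → E (Pc l) (Pc a) ≡ D (Pc l) * (kron l a - kron (τ l) a)
      cartan-row a = cases (a Fin.≟ l) (a Fin.≟ τ l)
        where
        cases : Dec (a ≡ l) → Dec (a ≡ τ l) → E (Pc l) (Pc a) ≡ D (Pc l) * (kron l a - kron (τ l) a)
        cases (yes refl) _ = sym (cong₂ (λ x y → D (Pc l) * (x - y)) (kron-refl l) (kron-≢ (τ≢ rl ∘ sym)) ■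
            solve 1 (λ d → d :* (con 1ℚ :- con 0ℚ) := d) refl (D (Pc l)))
        cases (no ne) (yes refl) = E-PP-pred (στ l) ■ sym (cong₂ (λ x y → D (Pc l) * (x - y)) (kron-≢ ne) (kron-refl (τ l)) ■
            solve 1 (λ d → d :* (con 0ℚ :- con 1ℚ) := :- d) refl (D (Pc l)))
        cases (no n₁) (no n₂) = E-PP rl a n₁ (λ e0 → n₂ (sym (τσ a) ■ cong τ e0)) ■
            sym (cong₂ (λ x y → D (Pc l) * (x - y)) (kron-≢ n₁) (kron-≢ n₂) ■
            solve 1 (λ d → d :* (con 0ℚ :- con 0ℚ) := con 0ℚ) refl (D (Pc l)))

  NotFull : (Fin m → ℚ) → Set
  NotFull k = ∀ j → k j ≢ 0ℚ → ∃ λ l → Orb j l × k l ≡ 0ℚ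

  -- The tube support of a root is an arc of its σ-orbit: e is its first element and p the first element after it.
  record Arc (k : Fin m → ℚ) : Set where
    field
      e⁺ p⁺ : Fin m
      jump : ∀ l → k l - k (τ l) ≡ kron e⁺ l - kron p⁺ l
      zero-one : ∀ l → k l ≡ 0ℚ ⊎ k l ≡ 1ℚ
      kp : k p⁺ ≡ 0ℚ
      ke : k e⁺ ≡ 1ℚ
      orb : Orb p⁺ e⁺
      arc-orb : ∀ l → k l ≢ 0ℚ → Orb p⁺ l

  private
    Int-inverse : ∀ {x y} → Int x → Int y → 0ℚ < x → 0ℚ < y → x * y ≡ 1ℚ → x ≡ 1ℚ
    Int-inverse {x} {y} ix iy px py e0 = ≤-antisym (by≤ (0≤* (<⇒≤ px) (0≤- (Int-pos iy py)))
        (solve 2 (λ x y → x :+ x :* (y :- con 1ℚ) := x :* y) refl x y ■ e0)) (Int-pos ix px)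

  -- `E (Pc l) α` is divisible by the norms of both roots, so the jump `h′` and its rescaling `r′`
  -- are integers of equal sign. Their products sum to 2, and the jumps weighted by norms sum to 0.
  -- So there is a rise and a fall; each uses up at least 1, which leaves exactly one rise by 1 and
  -- one fall by 1.
  arc : ∀ {α k} → RL α → g α ≡ 0ℚ → Nonneg k → Supported k → lc k Pc ≡ α → NotFull k → Arc k
  arc {α} {k} r gα nn sup eq nf = build positive-jump
    where
    h′ : Fin m → ℚ
    h′ l = k l - k (τ l)
    Dα = D α
    iD = inv Dα
    r′ : Fin m → ℚ
    r′ l = D (Pc l) * h′ l * iD
    E≡ : ∀ l → E (Pc l) α ≡ D (Pc l) * h′ l
    E≡ = E-P-lc {α} {k} eq gα
    h-imag : ∀ {l} → Qδ (Pc l) → h′ l ≡ 0ℚ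
    h-imag {l} q = cong (λ z → k l - k z) (τ-imag q) ■ +-inverseʳ (k l)
    h-Int′ : ∀ l → Int (h′ l)
    h-Int′ l = go (kind l)
      where
      go : Kind l → Int (h′ l)
      go (imag q) = subst Int (sym (h-imag q)) Int-0
      go (real rl) = subst Int (cong (_* inv (D (Pc l))) (E≡ l) ■ solve 3 (λ d h i → d :* h :* i := i :* d :* h) refl
          (D (Pc l)) (h′ l) (inv (D (Pc l))) ■ cong (_* h′ l) (inv-* (D≢0 rl)) ■ *-identityˡ (h′ l)) (E/D-Int rl (int r))
    r-Int′ : ∀ l → Int (r′ l)
    r-Int′ l = go (kind l)
      where
      go : Kind l → Int (r′ l)
      go (imag q) = subst Int (sym (cong (λ z → D (Pc l) * z * iD) (h-imag q) ■
          solve 2 (λ d i → d :* con 0ℚ :* i := con 0ℚ) refl (D (Pc l)) iD)) Int-0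
      go (real rl) = subst Int (cong (_* iD) (E≡ l)) (E/D-Intʳ r (int rl))
    hr≥0 : ∀ l → 0ℚ ≤ h′ l * r′ l
    hr≥0 l = subst (0ℚ ≤_) (solve 3 (λ d h i → d :* (h :* h) :* i := h :* (d :* h :* i)) refl (D (Pc l)) (h′ l) iD)
        (0≤* (0≤* (D≥0 (Pc l)) (sq≥0 (h′ l))) (<⇒≤ (inv-pos (D>0 r))))
    Dα≡ : sumFin (λ l → k l * (D (Pc l) * h′ l)) ≡ Dα
    Dα≡ = sum-cong {m} (λ l → cong (k l *_) (sym (E≡ l))) ■ sym (E-lcˡ k Pc α) ■ cong (λ z → E z α) eq
    telescoped : ∀ (f : Fin m → ℚ) → sumFin (λ l → D (Pc l) * (f l - f (τ l))) ≡ 0ℚ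
    telescoped f = sum-cong {m} (λ l → solve 3 (λ d x y → d :* (x :- y) := d :* x :+ :- (d :* y)) refl (D (Pc l)) (f l)
        (f (τ l)) ■ cong (λ d → D (Pc l) * f l + - (d * f (τ l))) (sym (D-τ l))) ■ sum-+ {m} _ _ ■
        cong (sumFin (λ l → D (Pc l) * f l) +_) (sum-neg {m} _ ■ cong -_ (sum-τ (λ l → D (Pc l) * f l))) ■
        +-inverseʳ (sumFin (λ l → D (Pc l) * f l))
    sum-Dh : sumFin (λ l → D (Pc l) * h′ l) ≡ 0ℚ
    sum-Dh = telescoped k
    -- Write (x - y)² as 2x(x - y) - (x² - y²). The first part sums to twice `D α`; the second
    -- telescopes round the cycles, as norms are constant on orbits.
    sum-hr : sumFin (λ l → h′ l * r′ l) ≡ 2ℚ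
    sum-hr = sum-cong {m} (λ l → solve 4 (λ d x y i → (x :- y) :* (d :* (x :- y) :* i) := con 2ℚ :* i :*
        (x :* (d :* (x :- y))) :+ (:- i) :* (d :* (x :* x :- y :* y))) refl (D (Pc l)) (k l) (k (τ l)) iD) ■
      sum-+ {m} _ _ ■ cong₂ _+_ (sum-* {m} (2ℚ * iD) _ ■ cong (2ℚ * iD *_) Dα≡)
          (sum-* {m} (- iD) _ ■ cong ((- iD) *_) (telescoped (λ l → k l * k l))) ■
        solve 2 (λ i d → con 2ℚ :* i :* d :+ (:- i) :* con 0ℚ := con 2ℚ :* (i :* d)) refl iD Dα ■
            cong (2ℚ *_) (inv-* (D≢0 r)) ■ refl
    nonzero-jump : ∃ λ l → h′ l * r′ l ≢ 0ℚ
    nonzero-jump = sum-≢0⇒ {m} (λ l → h′ l * r′ l) (λ e0 → pos⇒≢0 0<2 (sym sum-hr ■ e0))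
    -- Cancelling the term at `a` in `- f` leaves the total `f a`, which is positive; hence another
    -- term is positive.
    opposite : ∀ (f : Fin m → ℚ) → sumFin f ≡ 0ℚ → ∀ a → 0ℚ < f a → ∃ λ b → 0ℚ < - f b
    opposite f f0 a fa = finish (sum-pos⇒ {m} (λ l → kron a l * f l + - f l) (subst (0ℚ <_)
        (sym (sum-+ {m} _ _ ■ cong₂ _+_ (sum-kron {m} f a) (sum-neg {m} f ■ cong -_ f0) ■ +-identityʳ (f a))) fa))
      where
      finish : (∃ λ b → 0ℚ < kron a b * f b + - f b) → ∃ λ b → 0ℚ < - f b
      finish (b , q) with b Fin.≟ a
      ... | yes refl = ⊥-elim (pos⇒≢0 q (solve 1 (λ x → con 1ℚ :* x :+ :- x := con 0ℚ) refl (f b)))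
      ... | no _ = b , subst (0ℚ <_) (solve 1 (λ x → con 0ℚ :* x :+ :- x := :- x) refl (f b)) q
    Dh-sign : ∀ {l} → 0ℚ < D (Pc l) * h′ l → 0ℚ < h′ l
    Dh-sign {l} q = 0<*⇒0< (≤∧≢⇒< (D≥0 (Pc l)) (proj₁ (factors≢0 {D (Pc l)} {h′ l} (pos⇒≢0 q)))) q
    Dh-sign⁻ : ∀ {l} → 0ℚ < - (D (Pc l) * h′ l) → 0ℚ < - h′ l
    Dh-sign⁻ {l} q = 0<*⇒0< (≤∧≢⇒< (D≥0 (Pc l)) (λ e0 → pos⇒≢0 q (cong -_ (cong (_* h′ l) e0 ■ *-zeroˡ (h′ l)))))
        (subst (0ℚ <_) (solve 2 (λ d h → :- (d :* h) := d :* (:- h)) refl (D (Pc l)) (h′ l)) q)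
    positive-jump : ∃₂ λ e p → 0ℚ < D (Pc e) * h′ e × 0ℚ < - (D (Pc p) * h′ p)
    positive-jump = go (<-cmp (D (Pc l) * h′ l) 0ℚ)
      where
      l = proj₁ nonzero-jump
      Dh≢0 : D (Pc l) * h′ l ≢ 0ℚ
      Dh≢0 e0 = proj₂ nonzero-jump (cong (λ z → h′ l * (z * iD)) e0 ■ solve 2 (λ h i → h :* (con 0ℚ :* i) := con 0ℚ) refl
          (h′ l) iD)
      go : _ → ∃₂ λ e p → 0ℚ < D (Pc e) * h′ e × 0ℚ < - (D (Pc p) * h′ p)
      go (tri≈ _ e0 _) = ⊥-elim (Dh≢0 e0)
      go (tri> _ _ q) = let b , q′ = opposite (λ l → D (Pc l) * h′ l) sum-Dh l q in l , b , q , q′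
      go (tri< q _ _) = let b , q′ = opposite (λ l → - (D (Pc l) * h′ l)) (sum-neg {m} _ ■ cong -_ sum-Dh) l (0<-neg q) in b , l , subst (0ℚ <_) (neg-neg (D (Pc b) * h′ b)) q′ , 0<-neg q
    build : (∃₂ λ e p → 0ℚ < D (Pc e) * h′ e × 0ℚ < - (D (Pc p) * h′ p)) → Arc k
    build (e₁ , p₁ , qe , qp) = record
        { e⁺ = e₁ ; p⁺ = p₁ ; jump = jump ; zero-one = zero-one ; kp = kp ; ke = ke ; orb = comp p₁ e₁ kp-near ke≢0 ; arc-orb = λ l nz → comp p₁ l kp-near nz }
      where
      he>0 : 0ℚ < h′ e₁
      he>0 = Dh-sign {e₁} qe
      hp<0 : 0ℚ < - h′ p₁
      hp<0 = Dh-sign⁻ {p₁} qp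
      re>0 : 0ℚ < r′ e₁
      re>0 = 0<* qe (inv-pos (D>0 r))
      rp<0 : 0ℚ < - r′ p₁
      rp<0 = subst (0ℚ <_) (solve 2 (λ x i → (:- x) :* i := :- (x :* i)) refl (D (Pc p₁) * h′ p₁) iD) (0<* qp (inv-pos (D>0 r)))
      ne : e₁ ≢ p₁
      ne refl = <⇒≱' he>0 (<⇒≤ (<0-neg hp<0))
      rest : Fin m → ℚ
      rest l = h′ l * r′ l + - (kron e₁ l + kron p₁ l)
      hr-pair : ∀ {x y} → (- x) * (- y) ≡ x * y
      hr-pair {x} {y} = solve 2 (λ x y → (:- x) :* (:- y) := x :* y) refl x y
      rest≥0 : ∀ l → 0ℚ ≤ rest l
      rest≥0 l = cases (l Fin.≟ e₁) (l Fin.≟ p₁)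
        where
        cases : Dec (l ≡ e₁) → Dec (l ≡ p₁) → 0ℚ ≤ rest l
        cases (yes refl) _ = subst (0ℚ ≤_) (solve 1 (λ x → x :- con 1ℚ := x :+ :- (con 1ℚ :+ con 0ℚ)) refl (h′ l * r′ l) ■
            cong₂ (λ x y → h′ l * r′ l + - (x + y)) (sym (kron-refl l)) (sym (kron-≢ ne)))
            (0≤- (Int-pos (Int-* (h-Int′ l) (r-Int′ l)) (0<* he>0 re>0)))
        cases (no n₁) (yes refl) = subst (0ℚ ≤_) (solve 1 (λ x → x :- con 1ℚ := x :+ :- (con 0ℚ :+ con 1ℚ)) refl
            (h′ l * r′ l) ■ cong₂ (λ x y → h′ l * r′ l + - (x + y)) (sym (kron-≢ n₁)) (sym (kron-refl l)))
            (0≤- (Int-pos (Int-* (h-Int′ l) (r-Int′ l)) (subst (0ℚ <_) (hr-pair {h′ l} {r′ l}) (0<* hp<0 rp<0))))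
        cases (no n₁) (no n₂) = subst (0ℚ ≤_) (solve 1 (λ x → x := x :+ :- (con 0ℚ :+ con 0ℚ)) refl (h′ l * r′ l) ■
            cong₂ (λ x y → h′ l * r′ l + - (x + y)) (sym (kron-≢ n₁)) (sym (kron-≢ n₂))) (hr≥0 l)
      sum-one : ∀ a → sumFin (kron {m} a) ≡ 1ℚ
      sum-one a = sum-cong {m} (λ l → sym (*-identityʳ (kron a l))) ■ sum-kron {m} (λ _ → 1ℚ) a
      rest≡0 : ∀ l → rest l ≡ 0ℚ
      rest≡0 = sum≡0⇒ {m} rest≥0 (sum-+ {m} _ _ ■ cong₂ _+_ sum-hr (sum-neg {m} _ ■
          cong -_ (sum-+ {m} _ _ ■ cong₂ _+_ (sum-one e₁) (sum-one p₁))) ■ refl)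
      hr : ∀ l → h′ l * r′ l ≡ kron e₁ l + kron p₁ l
      hr l = solve 2 (λ x y → x := (x :+ :- y) :+ y) refl (h′ l * r′ l) (kron e₁ l + kron p₁ l) ■
          cong (_+ (kron e₁ l + kron p₁ l)) (rest≡0 l) ■ +-identityˡ (kron e₁ l + kron p₁ l)
      jump : ∀ l → h′ l ≡ kron e₁ l - kron p₁ l
      jump l = cases (l Fin.≟ e₁) (l Fin.≟ p₁)
        where
        cases : Dec (l ≡ e₁) → Dec (l ≡ p₁) → h′ l ≡ kron e₁ l - kron p₁ l
        cases (yes refl) _ = Int-inverse (h-Int′ l) (r-Int′ l) he>0 re>0 (hr l ■ cong₂ _+_ (kron-refl l) (kron-≢ ne)) ■
            sym (cong₂ _-_ (kron-refl l) (kron-≢ ne))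
        cases (no n₁) (yes refl) = sym (neg-neg (h′ l)) ■ cong -_ (Int-inverse (Int-neg (h-Int′ l))
            (Int-neg (r-Int′ l)) hp<0 rp<0 (hr-pair {h′ l} {r′ l} ■ hr l ■ cong₂ _+_ (kron-≢ n₁) (kron-refl l))) ■
            sym (cong₂ _-_ (kron-≢ n₁) (kron-refl l))
        cases (no n₁) (no n₂) = go (kind l) ■ sym (cong₂ _-_ (kron-≢ n₁) (kron-≢ n₂))
          where
          hr0 : h′ l * r′ l ≡ 0ℚ
          hr0 = hr l ■ cong₂ _+_ (kron-≢ n₁) (kron-≢ n₂)
          go : Kind l → h′ l ≡ 0ℚ
          go (imag q) = h-imag q
          go (real rl) with h′ l ≟ 0ℚ
          ... | yes e0 = e0
          ... | no nz = ⊥-elim (*≢0 nz (*≢0 {D (Pc l) * h′ l} (*≢0 (D≢0 rl) nz) (pos⇒≢0 (inv-pos (D>0 r)))) hr0)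
      ke-pos : 0ℚ < k e₁
      ke-pos = by< {0ℚ} {k e₁} {h′ e₁ + k (τ e₁)} (0<+ he>0 (nn (τ e₁)))
          (+-identityˡ _ ■ solve 2 (λ x y → x :- y :+ y := x) refl (k e₁) (k (τ e₁)))
      ke≢0 : k e₁ ≢ 0ℚ
      ke≢0 = pos⇒≢0 ke-pos
      Near : Fin m → Set
      Near l = SameComp e₁ l
      comp : ∀ a l → Near a → k l ≢ 0ℚ → Orb a l
      comp a l na nz = Comp⇒Orb (Comp-sym na ◅◅ sup e₁ l ke≢0 nz)
      kτp≢0 : k (τ p₁) ≢ 0ℚ
      kτp≢0 = pos⇒≢0 (by< {0ℚ} {k (τ p₁)} {(- h′ p₁) + k p₁} (0<+ hp<0 (nn p₁))
          (+-identityˡ _ ■ solve 2 (λ x y → :- (x :- y) :+ x := y) refl (k p₁) (k (τ p₁))))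
      kp-near : Near p₁
      kp-near = sup e₁ (τ p₁) ke≢0 kτp≢0 ◅◅ subst (SameComp (τ p₁)) (στ p₁) (Comp-σ (τ p₁))
      base : ∃ λ l → Orb e₁ l × k l ≡ 0ℚ
      base = nf e₁ ke≢0
      hσ : ∀ l → k (σ l) ≡ k l + (kron e₁ (σ l) - kron p₁ (σ l))
      hσ l = solve 2 (λ x y → x := y :+ (x :- y)) refl (k (σ l)) (k l) ■
          cong (k l +_) (cong (λ z → k (σ l) - k z) (sym (τσ l)) ■ jump (σ l))
      -- From the fall at `p₁` on, the coefficient keeps the value `k p₁`, becomes `k p₁ + 1` at the
      -- rise at `e₁`, and keeps that until `p₁` returns. A zero in the orbit then forces `k p₁` to
      -- be 0.
      Q : Fin m → Set
      Q l = k l ≡ k p₁ ⊎ (k l ≡ k p₁ + 1ℚ × k e₁ ≡ k p₁ + 1ℚ)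
      Q-step : ∀ l → Q l → Q (σ l)
      Q-step l q = cases (σ l Fin.≟ p₁) (σ l Fin.≟ e₁) q
        where
        cases : Dec (σ l ≡ p₁) → Dec (σ l ≡ e₁) → Q l → Q (σ l)
        cases (yes e0) _ _ = inj₁ (cong k e0)
        cases (no n₁) (no n₂) (inj₁ a) = inj₁ (same n₁ n₂ ■ a)
          where
          same : σ l ≢ p₁ → σ l ≢ e₁ → k (σ l) ≡ k l
          same n₁ n₂ = hσ l ■ cong₂ (λ x y → k l + (x - y)) (kron-≢ n₂) (kron-≢ n₁) ■
              solve 1 (λ x → x :+ (con 0ℚ :- con 0ℚ) := x) refl (k l)
        cases (no n₁) (no n₂) (inj₂ (a , b)) = inj₂ ((hσ l ■ cong₂ (λ x y → k l + (x - y)) (kron-≢ n₂) (kron-≢ n₁) ■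
            solve 1 (λ x → x :+ (con 0ℚ :- con 0ℚ) := x) refl (k l) ■ a) , b)
        cases (no n₁) (yes e0) q = climb q
          where
          step : k e₁ ≡ k l + 1ℚ
          step = cong k (sym e0) ■ hσ l ■ cong₂ (λ x y → k l + (x - y)) (cong (kron e₁) e0 ■ kron-refl e₁) (kron-≢ n₁)
          climb : Q l → Q (σ l)
          climb (inj₁ a) = inj₂ ((cong k e0 ■ step ■ cong (_+ 1ℚ) a) , (step ■ cong (_+ 1ℚ) a))
          climb (inj₂ (a , b)) = ⊥-elim (pos⇒≢0 0<1 (solve 1 (λ x → con 1ℚ := (x :+ con 1ℚ) :- x) refl (k p₁ + 1ℚ) ■
              cong (_- (k p₁ + 1ℚ)) (cong (_+ 1ℚ) (sym a) ■ sym step ■ b) ■ +-inverseʳ (k p₁ + 1ℚ)))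
      Q-all : ∀ t → Q (σ^ t p₁)
      Q-all zero = inj₁ refl
      Q-all (suc t) = Q-step (σ^ t p₁) (Q-all t)
      Q-orb : ∀ {l} → Orb p₁ l → Q l
      Q-orb (t , refl) = Q-all t
      kp : k p₁ ≡ 0ℚ
      kp = settle (Q-orb (Orb-trans (Comp⇒Orb (Comp-sym kp-near)) (proj₁ (proj₂ base))))
        where
        settle : Q (proj₁ base) → k p₁ ≡ 0ℚ
        settle (inj₁ a) = sym a ■ proj₂ (proj₂ base)
        settle (inj₂ (a , _)) = ⊥-elim (pos⇒≢0 (0<+ 0<1 (nn p₁)) (+-comm 1ℚ (k p₁) ■ sym a ■ proj₂ (proj₂ base)))
      zero-one : ∀ l → k l ≡ 0ℚ ⊎ k l ≡ 1ℚ
      zero-one l with k l ≟ 0ℚ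
      ... | yes e0 = inj₁ e0
      ... | no nz = settle (Q-orb (comp p₁ l kp-near nz))
        where
        settle : Q l → k l ≡ 0ℚ ⊎ k l ≡ 1ℚ
        settle (inj₁ a) = inj₁ (a ■ kp)
        settle (inj₂ (a , _)) = inj₂ (a ■ cong (_+ 1ℚ) kp)
      ke : k e₁ ≡ 1ℚ
      ke = go (zero-one e₁)
        where
        go : k e₁ ≡ 0ℚ ⊎ k e₁ ≡ 1ℚ → k e₁ ≡ 1ℚ
        go (inj₁ e0) = ⊥-elim (ke≢0 e0)
        go (inj₂ e0) = e0

  module ArcProperties {k} (ar : Arc k) where
    open Arc ar

    kσ : ∀ l → k (σ l) ≡ k l + (kron e⁺ (σ l) - kron p⁺ (σ l))
    kσ l = solve 2 (λ x y → x := y :+ (x :- y)) refl (k (σ l)) (k l) ■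
        cong (k l +_) (cong (λ z → k (σ l) - k z) (sym (τσ l)) ■ jump (σ l))

    k-same : ∀ {l} → σ l ≢ e⁺ → σ l ≢ p⁺ → k (σ l) ≡ k l
    k-same {l} n₁ n₂ = kσ l ■ cong₂ (λ x y → k l + (x - y)) (kron-≢ n₁) (kron-≢ n₂) ■
        solve 1 (λ x → x :+ (con 0ℚ :- con 0ℚ) := x) refl (k l)

    -- Induction along the arc: `k` rises only at `e⁺`, so any other point of the arc is preceded by
    -- a point of the arc.
    along : ∀ (Q : Fin m → Set) → Q e⁺ → (∀ l → k (σ l) ≡ 1ℚ → Q l → Q (σ l)) → ∀ x → k x ≡ 1ℚ → Q x
    along Q qe step x kx = go (proj₁ o) (subst (λ z → k z ≡ 1ℚ) (sym (proj₂ o)) kx) ⟨to⟩ proj₂ o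
      where
      _⟨to⟩_ : ∀ {y} → Q y → y ≡ x → Q x
      q ⟨to⟩ refl = q
      o : Orb e⁺ x
      o = Orb-trans (Orb-sym orb) (arc-orb x (λ e0 → pos⇒≢0 0<1 (sym kx ■ e0)))
      go : ∀ t → k (σ^ t e⁺) ≡ 1ℚ → Q (σ^ t e⁺)
      go zero _ = qe
      go (suc t) h = cases (σ^ (suc t) e⁺ Fin.≟ e⁺)
        where
        cases : Dec (σ^ (suc t) e⁺ ≡ e⁺) → Q (σ^ (suc t) e⁺)
        cases (yes e0) = subst Q (sym e0) qe
        cases (no ne) = step (σ^ t e⁺) h (go t (sym (k-same ne (λ e0 → pos⇒≢0 0<1 (sym h ■ cong k e0 ■ kp))) ■ h))

    off-arc : ∀ (Q : Fin m → Set) → Q p⁺ → (∀ l → k (σ l) ≡ 0ℚ → Q l → Q (σ l)) → ∀ x → Orb p⁺ x → k x ≡ 0ℚ → Q x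
    off-arc Q qp step x (t₀ , refl) kx = go t₀ kx
      where
      go : ∀ t → k (σ^ t p⁺) ≡ 0ℚ → Q (σ^ t p⁺)
      go zero _ = qp
      go (suc t) h = cases (σ^ (suc t) p⁺ Fin.≟ p⁺)
        where
        cases : Dec (σ^ (suc t) p⁺ ≡ p⁺) → Q (σ^ (suc t) p⁺)
        cases (yes e0) = subst Q (sym e0) qp
        cases (no ne) = step (σ^ t p⁺) h (go t (sym (k-same (λ e0 → pos⇒≢0 0<1 (sym ke ■ cong k (sym e0) ■ h)) ne) ■ h))

    -- Only the two jumps of the arc of α contribute. When β is an arc too, `0 ≤ E β α` says that an
    -- arc containing `p⁺` also contains `e⁺`.
    E-arc : ∀ {α β kβ} → lc k Pc ≡ α → g α ≡ 0ℚ → lc kβ Pc ≡ β → E β α ≡ D (Pc e⁺) * (kβ e⁺ - kβ p⁺)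
    E-arc {α} {β} {kβ} eq gα eqβ = cong (λ z → E z α) (sym eqβ) ■ E-lcˡ kβ Pc α ■
        sum-cong {m} (λ l → cong (kβ l *_) (E-P-lc {α} {k} eq gα l ■ cong (D (Pc l) *_) (jump l)) ■
        solve 4 (λ b d x y → b :* (d :* (x :- y)) := x :* (d :* b) :+ :- (y :* (d :* b))) refl (kβ l) (D (Pc l)) (kron e⁺ l)
        (kron p⁺ l)) ■
      sum-+ {m} _ _ ■ cong₂ _+_ (sum-kron {m} (λ l → D (Pc l) * kβ l) e⁺)
          (sum-neg {m} _ ■ cong -_ (sum-kron {m} (λ l → D (Pc l) * kβ l) p⁺)) ■
          cong (λ d → D (Pc e⁺) * kβ e⁺ + - (d * kβ p⁺)) (D-Orb orb) ■
          solve 3 (λ d x y → d :* x :+ :- (d :* y) := d :* (x :- y)) refl (D (Pc e⁺)) (kβ e⁺) (kβ p⁺)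

  module ArcNorm where
    De>0 : ∀ {κ} (ar : Arc κ) → 0ℚ < D (Pc (Arc.e⁺ ar))
    De>0 {κ} ar = go (kind e⁺)
      where
      open Arc ar
      e≢p : e⁺ ≢ p⁺
      e≢p e0 = pos⇒≢0 0<1 (sym ke ■ cong κ e0 ■ kp)
      one : κ e⁺ - κ (τ e⁺) ≡ 1ℚ
      one = jump e⁺ ■ cong₂ _-_ (kron-refl e⁺) (kron-≢ e≢p) ■ refl
      go : Kind e⁺ → 0ℚ < D (Pc e⁺)
      go (real r) = D>0 r
      go (imag q) = ⊥-elim (pos⇒≢0 0<1 (sym one ■ cong (λ z → κ e⁺ - κ z) (τ-imag q) ■ +-inverseʳ (κ e⁺)))

  record IsTube (α : V) : Set where
    field
      rl : RL α
      ps : Positive α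
      gz : g α ≡ 0ℚ
      nf : ∀ k → Supported k → lc k Pc ≡ α → NotFull k

  Joint-full : V → V → Set
  Joint-full α β = ∃₂ λ kα kβ → (Supported kα × lc kα Pc ≡ α) × (Supported kβ × lc kβ Pc ≡ β) ×
      (∃ λ j → ∀ l → SameComp j l → kα l ≢ 0ℚ ⊎ kβ l ≢ 0ℚ)

  -- The element of a σ-orbit following an arc of maximal size is avoided by all arcs compatible with that arc.
  module Choice (C : V → Set) (tube : ∀ {α} → C α → IsTube α)
    (compat : ∀ {α β} → C α → C β → α ≢ β → 0ℚ ≤ E β α × ¬ Joint-full α β) where

    Avoid : Fin m → Set
    Avoid p = ∀ α → C α → ∀ k → Supported k → lc k Pc ≡ α → k p ≡ 0ℚ

    open Expansion

    abstract
      exp : ∀ {α} → C α → Expansion α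
      exp cα = expand (IsTube.rl (tube cα)) (IsTube.ps (tube cα)) (IsTube.gz (tube cα))

      the-arc : ∀ {α} (cα : C α) → Arc (k (exp cα))
      the-arc cα = arc (IsTube.rl (tube cα)) (IsTube.gz (tube cα)) (k≥0 (exp cα)) (supp (exp cα)) (k-eq (exp cα))
          (IsTube.nf (tube cα) (k (exp cα)) (supp (exp cα)) (k-eq (exp cα)))

    size : ∀ {α} → C α → ℚ
    size cα = sumFin (k (exp cα))

    sum≤ : ∀ {M} (f : Fin M → ℚ) → (∀ l → f l ≤ 1ℚ) → sumFin f ≤ fromℕ M
    sum≤ {zero} f h = ≤-refl
    sum≤ {suc M} f h = ≤-trans (+-mono-≤ (h Fin.zero) (sum≤ (f ∘ Fin.suc) (h ∘ Fin.suc))) (≤-reflexive (sym (fromℕ-suc M)))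

    size≤ : ∀ {α} (cα : C α) → size cα ≤ fromℕ m
    size≤ cα = sum≤ (k (exp cα)) (λ l → go (Arc.zero-one (the-arc cα) l))
      where
      go : ∀ {x} → x ≡ 0ℚ ⊎ x ≡ 1ℚ → x ≤ 1ℚ
      go (inj₁ refl) = <⇒≤ 0<1
      go (inj₂ refl) = ≤-refl

    module Pair {α β} (cα : C α) (cβ : C β) (ne : α ≢ β) (hit : k (exp cβ) (Arc.p⁺ (the-arc cα)) ≢ 0ℚ) where
      kα = k (exp cα)
      kβ = k (exp cβ)
      module A = Arc (the-arc cα)
      module B = Arc (the-arc cβ)
      module PA = ArcProperties (the-arc cα)
      module PB = ArcProperties (the-arc cβ)

      to1 : ∀ l → kβ l ≢ 0ℚ → kβ l ≡ 1ℚ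
      to1 l nz = go (B.zero-one l)
        where
        go : kβ l ≡ 0ℚ ⊎ kβ l ≡ 1ℚ → kβ l ≡ 1ℚ
        go (inj₁ e0) = ⊥-elim (nz e0)
        go (inj₂ e0) = e0

      hit1 : kβ A.p⁺ ≡ 1ℚ
      hit1 = to1 A.p⁺ hit

      cp = compat cα cβ ne

      open ArcNorm

      βe : kβ A.e⁺ ≡ 1ℚ
      βe = to1 A.e⁺ (λ e0 → <⇒≱' (neg-<0 0<1) (subst (0ℚ ≤_) (cong₂ _-_ e0 hit1 ■ refl)
          (0≤*⇒0≤ (De>0 (the-arc cα)) (subst (0ℚ ≤_) (PA.E-arc {α} {β} {kβ} (k-eq (exp cα)) (IsTube.gz (tube cα))
          (k-eq (exp cβ))) (proj₁ cp)))))

      keep : ∀ l → σ l ≢ B.p⁺ → kβ l ≡ 1ℚ → kβ (σ l) ≡ 1ℚ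
      keep l n h = cases (σ l Fin.≟ B.e⁺)
        where
        cases : Dec (σ l ≡ B.e⁺) → kβ (σ l) ≡ 1ℚ
        cases (yes e0) = cong kβ e0 ■ B.ke
        cases (no n′) = PB.k-same n′ n ■ h

      -- If β's arc ended inside α's, then, going from `A.p⁺` through the complement of α's arc, one
      -- would never leave β's arc, and the two supports would cover the component.
      not-inside : kα B.p⁺ ≢ 1ℚ
      not-inside h = proj₂ cp (kα , kβ , (supp (exp cα) , k-eq (exp cα)) , (supp (exp cβ) , k-eq (exp cβ)) , A.p⁺ , full)
        where
        full : ∀ l → SameComp A.p⁺ l → kα l ≢ 0ℚ ⊎ kβ l ≢ 0ℚ
        full l sc with kα l ≟ 0ℚ
        ... | no nz = inj₁ nz
        ... | yes z = inj₂ (λ e0 → pos⇒≢0 0<1 (sym (PA.off-arc (λ l → kβ l ≡ 1ℚ) hit1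
            (λ l h0 q → keep l (λ e1 → pos⇒≢0 0<1 (sym h ■ cong kα (sym e1) ■ h0)) q) l (Comp⇒Orb sc) z) ■ e0))

      contained : ∀ x → kα x ≡ 1ℚ → kβ x ≡ 1ℚ
      contained = PA.along (λ l → kβ l ≡ 1ℚ) βe (λ l h1 q → keep l (λ e1 → not-inside (cong kα (sym e1) ■ h1)) q)

      -- β's arc contains α's and in addition the element `A.p⁺` that follows it.
      larger : size cα + 1ℚ ≤ size cβ
      larger = by≤ (0≤- gap) (solve 3 (λ a b s → a :+ con 1ℚ :+ (s :- con 1ℚ) := a :+ s) refl (size cα) (size cβ)
          (sumFin diff) ■ cong (size cα +_) total ■ solve 2 (λ a b → a :+ (b :- a) := b) refl (size cα) (size cβ))
        where
        diff : Fin m → ℚ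
        diff l = kβ l + - kα l
        total : sumFin diff ≡ size cβ - size cα
        total = sum-+ {m} kβ (λ l → - kα l) ■ cong (size cβ +_) (sum-neg {m} kα)
        diff≥0 : ∀ l → 0ℚ ≤ diff l
        diff≥0 l = go (A.zero-one l)
          where
          go : kα l ≡ 0ℚ ⊎ kα l ≡ 1ℚ → 0ℚ ≤ diff l
          go (inj₁ z) = subst (λ y → 0ℚ ≤ kβ l + - y) (sym z) (subst (0ℚ ≤_) (solve 1 (λ x → x := x :+ :- con 0ℚ) refl (kβ l))
              (k≥0 (exp cβ) l))
          go (inj₂ o) = ≤-reflexive (sym (cong₂ (λ x y → x + - y) (contained l o) o ■ refl))
        gap : 1ℚ ≤ sumFin diff
        gap = ≤-trans (≤-reflexive (sym (cong₂ (λ x y → x + - y) hit1 A.kp ■ refl))) (term≤sum {m} diff≥0 A.p⁺)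

    choice : ∀ x → RealP x → ¬¬ (∃ λ i → Avoid (σ^ i x))
    choice x rx none = none (0 , λ α cα k′ sk eq → dec cα k′ sk eq (k′ x ≟ 0ℚ))
      where
      -- Starting from an arc through `x`, replace it by a larger one whenever the element following
      -- it is hit; the larger arc still passes through `x`. Sizes are at most `m`, and the fuel `B`
      -- counts the growth still possible. If no arc passes through `x`, then `x` itself is avoided.
      go : ∀ B {α} (cα : C α) → k (exp cα) x ≢ 0ℚ → fromℕ m < size cα + fromℕ B → ⊥
      go zero cα nz lt = <⇒≱' lt (≤-trans (≤-reflexive (+-identityʳ (size cα))) (size≤ cα))
      go (suc B) {α} cα nz lt = none (subst′ (Orb-trans (Orb-sym (Arc.arc-orb (the-arc cα) x nz)) (0 , refl)))
        where
        av : Avoid (Arc.p⁺ (the-arc cα))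
        av β cβ k′ sk eq with k′ (Arc.p⁺ (the-arc cα)) ≟ 0ℚ | α ≟ⱽ β
        ... | yes z | _ = z
        ... | no nz′ | yes refl = ⊥-elim (nz′ (uniq (D≢0 (IsTube.rl (tube cβ))) sk eq (supp (exp cα)) (k-eq (exp cα)) _ ■
            Arc.kp (the-arc cα)))
        ... | no nz′ | no ne = ⊥-elim
            (go B cβ touch (<-≤-trans lt (≤-trans (≤-reflexive (cong (size cα +_) (fromℕ-suc B) ■
            sym (+-assoc (size cα) 1ℚ (fromℕ B)))) (+-monoˡ-≤ (fromℕ B) larger))))
          where
          hit : k (exp cβ) (Arc.p⁺ (the-arc cα)) ≢ 0ℚ
          hit e0 = nz′ (uniq (D≢0 (IsTube.rl (tube cβ))) sk eq (supp (exp cβ)) (k-eq (exp cβ)) _ ■ e0)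
          open Pair cα cβ ne hit
          touch : k (exp cβ) x ≢ 0ℚ
          touch e0 = pos⇒≢0 0<1 (sym (contained x (one (Arc.zero-one (the-arc cα) x))) ■ e0)
            where
            one : k (exp cα) x ≡ 0ℚ ⊎ k (exp cα) x ≡ 1ℚ → k (exp cα) x ≡ 1ℚ
            one (inj₁ z) = ⊥-elim (nz z)
            one (inj₂ o) = o
        subst′ : Orb x (Arc.p⁺ (the-arc cα)) → ∃ λ i → Avoid (σ^ i x)
        subst′ (i , e0) = i , subst Avoid (sym e0) av
      dec : ∀ {α} (cα : C α) k′ → Supported k′ → lc k′ Pc ≡ α → Dec (k′ x ≡ 0ℚ) → k′ x ≡ 0ℚ
      dec cα k′ sk eq (yes z) = z
      dec cα k′ sk eq (no nz) = ⊥-elim (go (suc m) cα (λ e0 → nz (uniq (D≢0 (IsTube.rl (tube cα))) sk eq (supp (exp cα))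
          (k-eq (exp cα)) x ■ e0)) (by< {fromℕ m} (0<+ 0<1 (sum-≥0 {m} (k≥0 (exp cα))))
          (solve 2 (λ a b → b :+ (con 1ℚ :+ a) := a :+ (con 1ℚ :+ b)) refl (size cα) (fromℕ m) ■
          cong (size cα +_) (sym (fromℕ-suc m)))))

    avoid-imag : ∀ x → Qδ (Pc x) → Avoid x
    avoid-imag x q α cα k′ sk eq with k′ x ≟ 0ℚ
    ... | yes z = z
    ... | no nz with IsTube.nf (tube cα) k′ sk eq x nz
    ... | l , (i , o) , z = cong k′ (sym (σ^-imag q i) ■ o) ■ z

-- Compatibility degrees in terms of E, and the contradiction with maximality.

module Compatibility (H : AffineData) where
  open AffineData H
  open Arcs H public
  open import Data.Fin.Subset using (Subset; _∈_; _∪_; _∩_; ∁; ∣_∣; ⁅_⁆; inside)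
  import Data.Fin.Subset.Properties as Subsetₚ
  open import Relation.Nullary using (¬?)
  open import Relation.Binary.Construct.Closure.ReflexiveTransitive using (ε; _◅_; _◅◅_)

  suppOf : (Fin m → ℚ) → Subset m
  suppOf k = tabulate (λ j → ⌊ ¬? (k j ≟ 0ℚ) ⌋)

  ∈suppOf : ∀ {k l} → k l ≢ 0ℚ → l ∈ suppOf k
  ∈suppOf {k} {l} nz = Vecₚ.lookup⇒[]= l (suppOf k) (Vecₚ.lookup∘tabulate _ l ■ go (k l ≟ 0ℚ))
    where
    go : (q : Dec (k l ≡ 0ℚ)) → ⌊ ¬? q ⌋ ≡ inside
    go (yes z) = ⊥-elim (nz z)
    go (no _) = refl

  suppOf∈ : ∀ {k l} → l ∈ suppOf k → k l ≢ 0ℚ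
  suppOf∈ {k} {l} mem z = go (k l ≟ 0ℚ) (sym (Vecₚ.lookup∘tabulate _ l) ■ Vecₚ.[]=⇒lookup mem)
    where
    go : (q : Dec (k l ≡ 0ℚ)) → ⌊ ¬? q ⌋ ≡ inside → ⊥
    go (yes _) ()
    go (no nz) _ = nz z

  tubeOf : ∀ {α} → ΦTre α → IsTube α
  tubeOf {α} (rr , ps , inU , nonfull) = record { rl = RealRoot⇒RL rr ; ps = ps ; gz = InU⇒ inU ; nf = nf }
    where
    nf : ∀ k → Supported k → lc k Pc ≡ α → NotFull k
    nf k sk eq j nz with Finₚ.any? (λ i → zero-at? i)
      where
      zero-at? : ∀ i → Dec (Orb j i × k i ≡ 0ℚ)
      zero-at? i with Orb? j i | k i ≟ 0ℚ
      ... | yes o | yes z = yes (o , z)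
      ... | no ¬o | _ = no (λ p → ¬o (proj₁ p))
      ... | yes _ | no ¬z = no (λ p → ¬z (proj₂ p))
    ... | yes (l , o , z) = l , o , z
    ... | no none = ⊥-elim (nonfull (suppOf k) (k , sk , eq , refl)
        (j , λ l sc → ∈suppOf {k} (λ z → none (l , Comp⇒Orb sc , z))))

  lc-τ : ∀ k → c (lc k Pc) ≡ lc (k ∘ τ) Pc
  lc-τ k = lc-map c-zero c-lin k Pc ■ vext (λ i → !-lc k (c ∘ Pc) i ■ sym (sum-τ (λ l → k l * (c (Pc l) ! i))) ■
      sum-cong {m} (λ l → cong (λ z → k (τ l) * (z ! i)) (cP (τ l) ■ cong Pc (στ l))) ■ sym (!-lc (k ∘ τ) Pc i))

  lc-σ : ∀ k → c⁻¹ (lc k Pc) ≡ lc (k ∘ σ) Pc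
  lc-σ k = cong c⁻¹ (sym (lc-τ (k ∘ σ) ■ lc-cong Pc (λ l → cong k (στ l)))) ■ c⁻¹-c (lc (k ∘ σ) Pc)

  Supported-τ : ∀ {k} → Supported k → Supported (k ∘ τ)
  Supported-τ sk j l nj nl = Comp-sym (up j) ◅◅ (sk (τ j) (τ l) nj nl ◅◅ up l)
    where
    up : ∀ l → SameComp (τ l) l
    up l = subst (SameComp (τ l)) (στ l) (Comp-σ (τ l))

  Supported-σ : ∀ {k} → Supported k → Supported (k ∘ σ)
  Supported-σ sk j l nj nl = Comp-σ j ◅◅ (sk (σ j) (σ l) nj nl ◅◅ Comp-sym (Comp-σ l))

  -- Two non-full supports covering a component are adjacent: follow σ from inside one support until it is left.
  tube-case-impossible : ∀ {α β} → TubeCase α β → AdjZero α β → ⊥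
  tube-case-impossible {α} {β} (tα , tβ , _ , _ , (kα , sα , eqα , refl) , (kβ , sβ , eqβ , refl) , j , full) adj = start
      (kβ j ≟ 0ℚ)
    where
    covered : ∀ l → Orb j l → kα l ≡ 0ℚ → kβ l ≢ 0ℚ
    covered l o z e0 with Subsetₚ.x∈p∪q⁻ (suppOf kα) (suppOf kβ) (full l (Orb⇒Comp o))
    ... | inj₁ h = suppOf∈ {kα} h z
    ... | inj₂ h = suppOf∈ {kβ} h e0
    walk : ∀ x → Orb j x → kα x ≢ 0ℚ → ⊥
    walk x ox nx = leave (IsTube.nf (tubeOf tα) kα sα eqα x nx)
      where
      leave : (∃ λ y → Orb x y × kα y ≡ 0ℚ) → ⊥
      leave (_ , (t , refl) , zy) = found (switch {λ i → kα (σ^ i x) ≢ 0ℚ} (λ i → ¬? (kα (σ^ i x) ≟ 0ℚ)) t nx (λ ny → ny zy))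
        where
        found : (∃ λ i → kα (σ^ i x) ≢ 0ℚ × ¬ (kα (σ^ (suc i) x) ≢ 0ℚ)) → ⊥
        found (i , ni , ¬ns) = ℕₚ.<⇒≱ (s≤s z≤n) (ℕₚ.≤-trans (ℕₚ.≤-reflexive (sym (Subsetₚ.∣⁅x⁆∣≡1 l)))
            (ℕₚ.≤-trans (Subsetₚ.p⊆q⇒∣p∣≤∣q∣ (λ {y} h → subst (_∈ T) (sym (Subsetₚ.x∈⁅y⁆⇒x≡y l h)) l∈))
            (ℕₚ.≤-reflexive (adj (suppOf kα) (suppOf kβ) (suppOf (kα ∘ τ)) (suppOf (kα ∘ σ))
            (kα , sα , eqα , refl) (kβ , sβ , eqβ , refl) (kα ∘ τ , Supported-τ sα , (sym (lc-τ kα) ■ cong c eqα) , refl)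
                (kα ∘ σ , Supported-σ sα , (sym (lc-σ kα) ■ cong c⁻¹ eqα) , refl)))))
          where
          l = σ^ (suc i) x
          zl : kα l ≡ 0ℚ
          zl with kα l ≟ 0ℚ
          ... | yes z = z
          ... | no nz = ⊥-elim (¬ns nz)
          T = suppOf kβ ∩ ((suppOf (kα ∘ τ) ∪ suppOf (kα ∘ σ)) ∩ ∁ (suppOf kα))
          l∈ : l ∈ T
          l∈ = Subsetₚ.x∈p∩q⁺ (∈suppOf {kβ} (covered l (Orb-trans ox (suc i , refl)) zl) , Subsetₚ.x∈p∩q⁺
              (Subsetₚ.x∈p∪q⁺ (inj₁ (∈suppOf {kα ∘ τ} (λ e0 → ni (cong kα (sym (τσ (σ^ i x))) ■ e0)))) , Subsetₚ.x∉p⇒x∈∁p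
              (λ h → suppOf∈ {kα} h zl)))
    start : Dec (kβ j ≡ 0ℚ) → ⊥
    start (yes zβ) = walk j (0 , refl) (λ z → covered j (0 , refl) z zβ)
    start (no nβ) = let l , o , z = IsTube.nf (tubeOf tβ) kβ sβ eqβ j nβ in walk l o (λ zα → covered l o zα z)

  corootC-≢ : ∀ {α} → α ≢ δ → ∀ i → D α ≢ 0ℚ → corootC α ! i ≡ d i * (α ! i * inv (D α))
  corootC-≢ {α} ne i nz with Vecₚ.≡-dec _≟_ α δ
  ... | yes e0 = ⊥-elim (ne e0)
  ... | no _ = Vecₚ.lookup∘tabulate _ i ■ cong (d i *_) (*-cancel {K α α} K≢0
      (*-comm (K α α) (div (2ℚ * α ! i) (K α α)) ■ div-* (2ℚ * α ! i) (K α α) K≢0 ■ sym double))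
    where
    double : K α α * (α ! i * inv (D α)) ≡ 2ℚ * α ! i
    double = cong (_* (α ! i * inv (D α))) (K-diag α) ■ solve 3 (λ D a i → (D :+ D) :* (a :* i) := con 2ℚ :* a :*
        (i :* D)) refl (D α) (α ! i) (inv (D α)) ■ cong (2ℚ * α ! i *_) (inv-* nz) ■ *-identityʳ (2ℚ * α ! i)
    K≢0 : K α α ≢ 0ℚ
    K≢0 e0 = nz (half (sym (K-diag α) ■ e0))

  private
    if-mul : ∀ b x y z → (if b then x * y * z else 0ℚ) ≡ (if b then x else 0ℚ) * y * z
    if-mul true x y z = refl
    if-mul false x y z = sym (solve 2 (λ y z → con 0ℚ :* y :* z := con 0ℚ) refl y z)

  module Directed {α β} (x : Fin n → ℚ) (cor : ∀ i → corootC α ! i ≡ x i) (x≥0 : ∀ i → 0ℚ ≤ x i) (β≥0 : ∀ i → 0ℚ ≤ β ! i) where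

    -- On nonnegative coordinates the truncations disappear, and the diagonal and triangular sums
    -- merge into one bilinear form. The two choices of `test` give `E` with its arguments in either
    -- order, divided by the norm of α.
    shape : ∀ (test : Fin n → Fin n → _) → ((- sumFin (λ i → (corootC α ! i) * (β ! i))) - sumFin
        (λ i → sumFin (λ j → if test i j then a i j * pos (corootC α ! i) * pos (β ! j) else 0ℚ)))
      ≡ - sumFin (λ i → sumFin (λ j → (kron i j + (if test i j then a i j else 0ℚ)) * x i * (β ! j)))
    shape test = cong₂ (λ u v → (- u) - v) (sum-cong {n} (λ i → cong (_* β ! i) (cor i) ■
        sym (sum-kron {n} (λ j → x i * (β ! j)) i)))
        (sum-cong {n} (λ i → sum-cong {n} (λ j → if-mul (test i j) (a i j) (pos (corootC α ! i)) (pos (β ! j)) ■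
            cong₂ (λ u v → (if test i j then a i j else 0ℚ) * u * v) (cong pos (cor i) ■ pos-id (x≥0 i)) (pos-id (β≥0 j))))) ■
      solve 2 (λ u v → :- u :- v := :- (u :+ v)) refl (sumFin U) (sumFin W) ■
          cong -_ (sym (sum-+ {n} U W) ■ sum-cong {n} (λ i → sym (combine i)))
      where
      U W : Fin n → ℚ
      U i = sumFin (λ j → kron i j * (x i * (β ! j)))
      W i = sumFin (λ j → (if test i j then a i j else 0ℚ) * x i * (β ! j))
      combine : ∀ i → sumFin (λ j → (kron i j + (if test i j then a i j else 0ℚ)) * x i * (β ! j)) ≡ U i + W i
      combine i = sum-cong {n} (λ j → solve 4 (λ k t x b → (k :+ t) :* x :* b := k :* (x :* b) :+ t :* x :* b) refl (kron i j)
          (if test i j then a i j else 0ℚ) (x i) (β ! j)) ■ sum-+ {n} (λ j → kron i j * (x i * (β ! j)))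
          (λ j → (if test i j then a i j else 0ℚ) * x i * (β ! j))

  compR≡ : ∀ {α β} → RL α → Positive α → (∀ i → 0ℚ ≤ β ! i) → compR α β ≡ - (E α β * inv (D α))
  compR≡ {α} {β} r p β≥0 = shape (λ i j → ⌊ toℕ j ℕ.<? toℕ i ⌋) ■
      cong -_ (sum-cong {n} (λ i → sum-cong {n} (λ j → solve 5 (λ k d a i b → k :*
      (d :* (a :* i)) :* b := d :* k :* a :* b :* i) refl (kron i j + low i j) (d i) (α ! i) (inv (D α)) (β ! j)) ■
      sum-*ʳ {n} (inv (D α)) _) ■ sum-*ʳ {n} (inv (D α)) _ ■ cong (_* inv (D α)) (sym (E-def α β)))
    where open Directed {α} {β} (λ i → d i * (α ! i * inv (D α))) (λ i → corootC-≢ (λ e0 → D≢0 r (cong D e0 ■ Dδ)) i (D≢0 r)) (λ i → 0≤* (<⇒≤ (d>0 i)) (0≤* (proj₁ p i) (<⇒≤ (inv-pos (D>0 r))))) β≥0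

  compL≡ : ∀ {α β} → RL α → Positive α → (∀ i → 0ℚ ≤ β ! i) → compL α β ≡ - (E β α * inv (D α))
  compL≡ {α} {β} r p β≥0 = shape (λ i j → ⌊ toℕ i ℕ.<? toℕ j ⌋) ■
      cong -_ (sum-cong {n} (λ i → sum-cong {n} (λ j → cong (λ z → (z + (if ⌊ toℕ i ℕ.<? toℕ j ⌋ then a i j else 0ℚ)) *
      (d i * (α ! i * inv (D α))) * (β ! j)) (kron-sym i j) ■
      solve 5 (λ k d a i b → k :* (d :* (a :* i)) :* b := d :* k :* b :* a :* i) refl
      (kron j i + (if ⌊ toℕ i ℕ.<? toℕ j ⌋ then a i j else 0ℚ)) (d i) (α ! i) (inv (D α)) (β ! j) ■
      cong (λ z → z * (β ! j) * (α ! i) * inv (D α)) (sym (euler′ j i))) ■ sum-*ʳ {n} (inv (D α)) _) ■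
      sum-*ʳ {n} (inv (D α)) _ ■ cong (_* inv (D α)) (sum-swap {n} {n} (λ i j → euler j i * (β ! j) * (α ! i)) ■
          sym (E-def β α)))
    where open Directed {α} {β} (λ i → d i * (α ! i * inv (D α))) (λ i → corootC-≢ (λ e0 → D≢0 r (cong D e0 ■ Dδ)) i (D≢0 r)) (λ i → 0≤* (<⇒≤ (d>0 i)) (0≤* (proj₁ p i) (<⇒≤ (inv-pos (D>0 r))))) β≥0

  ⊔≡0⇒ : ∀ {x y} → x ⊔ y ≡ 0ℚ → x ≤ 0ℚ × y ≤ 0ℚ
  ⊔≡0⇒ {x} {y} h = subst (x ≤_) h (p≤p⊔q x y) , subst (y ≤_) h (p≤q⊔p x y)

  ¬ΦTre-δ : ¬ ΦTre δ
  ¬ΦTre-δ (rr , _) = D≢0 (RealRoot⇒RL rr) Dδ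

  E≥0-from : ∀ {α x} → RL α → - (x * inv (D α)) ≤ 0ℚ → 0ℚ ≤ x
  E≥0-from {α} {x} r h = 0≤*⇒0≤ (inv-pos (D>0 r)) (subst (0ℚ ≤_) (neg-neg (x * inv (D α)) ■ *-comm x (inv (D α))) (0≤-neg h))

  Compat⇒ : ∀ {α β} → RL α → Positive α → (∀ i → 0ℚ ≤ β ! i) → compR α β ⊔ compL α β ≡ 0ℚ → 0ℚ ≤ E α β × 0ℚ ≤ E β α
  Compat⇒ {α} {β} r p nn h = E≥0-from r (subst (_≤ 0ℚ) (compR≡ r p nn) (proj₁ (⊔≡0⇒ {compR α β} {compL α β} h))) , E≥0-from r
      (subst (_≤ 0ℚ) (compL≡ r p nn) (proj₂ (⊔≡0⇒ {compR α β} {compL α β} h)))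

  -- The coroot of a negative simple root has no positive coordinate, so the triangular sum vanishes
  -- and the degree is at least `δ ! i`.
  ¬Compat-neg : ∀ i → ¬ Compat (neg (e i)) δ
  ¬Compat-neg i (inj₁ ((_ , tδ , _) , _)) = ¬ΦTre-δ tδ
  ¬Compat-neg i (inj₂ (_ , h)) = <⇒≱' (δ>0 i) (≤-trans (≤-reflexive (sym val)) (proj₁ (⊔≡0⇒ {compR α δ} {compL α δ} h)))
    where
    α = neg (e i)
    α≡ : ∀ k → α ! k ≡ - kron i k
    α≡ k = !-neg (e i) k ■ cong -_ (!-e i k)
    Dα : D α ≡ d i
    Dα = cong D (neg≡ (e i)) ■ D∙ (- 1ℚ) (e i) ■ *-identityˡ (D (e i)) ■ E-diag i
    ne : α ≢ δ
    ne e0 = <⇒≱' (δ>0 i) (subst (_≤ 0ℚ) (sym (α≡ i) ■ cong (_! i) e0) (neg-≤0 (kron≥0 i i)))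
    x : Fin n → ℚ
    x k = - (kron i k * (d k * inv (d i)))
    cor : ∀ k → corootC α ! k ≡ x k
    cor k = corootC-≢ ne k (λ e0 → pos⇒≢0 (d>0 i) (sym Dα ■ e0)) ■ cong₂ (λ u v → d k * (u * inv v)) (α≡ k) Dα ■
        solve 3 (λ d k i → d :* ((:- k) :* i) := :- (k :* (d :* i))) refl (d k) (kron i k) (inv (d i))
    pos0 : ∀ k → pos (corootC α ! k) ≡ 0ℚ
    pos0 k = cong pos (cor k) ■ p≤q⇒p⊔q≡q (neg-≤0 (0≤* (kron≥0 i k) (0≤* (<⇒≤ (d>0 k)) (<⇒≤ (inv-pos (d>0 i))))))
    second : ∀ k j → (if ⌊ toℕ j ℕ.<? toℕ k ⌋ then a k j * pos (corootC α ! k) * pos (δ ! j) else 0ℚ) ≡ 0ℚ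
    second k j with toℕ j ℕ.<? toℕ k
    ... | no _ = refl
    ... | yes _ = cong (λ z → a k j * z * pos (δ ! j)) (pos0 k) ■
        solve 2 (λ a p → a :* con 0ℚ :* p := con 0ℚ) refl (a k j) (pos (δ ! j))
    val : compR α δ ≡ δ ! i
    val = cong₂ (λ u v → (- u) - v) (sum-cong {n} (λ k → cong (_* δ ! k) (cor k) ■
        solve 4 (λ k d i y → :- (k :* (d :* i)) :* y := k :* (:- (i :* d :* y))) refl (kron i k) (d k) (inv (d i)) (δ ! k)) ■
        sum-kron {n} (λ k → - (inv (d i) * d k * δ ! k)) i ■ cong (λ z → - (z * δ ! i)) (inv-* (pos⇒≢0 (d>0 i))))
        (sum-cong {n} (λ k → sum-cong {n} (λ j → second k j) ■ sum-0 n) ■ sum-0 n) ■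
      solve 1 (λ y → :- (:- (con 1ℚ :* y)) :- con 0ℚ := y) refl (δ ! i)

  -- For a positive real root, `E α δ` and `E δ α` are opposite numbers; compatibility makes both
  -- nonnegative, hence `g α` is 0 and α lies in `U`.
  compat-δ⇒ΦTre : ∀ {α} → Φcre α → Compat α δ → ΦTre α
  compat-δ⇒ΦTre (inj₁ (i , refl) , _) h = ⊥-elim (¬Compat-neg i h)
  compat-δ⇒ΦTre (inj₂ (inj₂ (inj₁ t)) , _) h = t
  compat-δ⇒ΦTre (inj₂ (inj₂ (inj₂ e0)) , ne) h = ⊥-elim (ne e0)
  compat-δ⇒ΦTre (inj₂ (inj₁ (root , p , ¬u)) , _) (inj₁ ((_ , tδ , _) , _)) = ⊥-elim (¬ΦTre-δ tδ)
  compat-δ⇒ΦTre {α} (inj₂ (inj₁ (inj₂ (k , _ , eq) , p , ¬u)) , _) (inj₂ _) = ⊥-elim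
      (¬u (⇒InU (g-Qδ (k / 1 , (eq ■ sym (∙-def (k / 1) δ))))))
  compat-δ⇒ΦTre {α} (inj₂ (inj₁ (inj₁ rr , p , ¬u)) , _) (inj₂ (_ , h)) = ⊥-elim
      (¬u (⇒InU (≤-antisym (≤0-neg (subst (0ℚ ≤_) (E-δʳ α) (proj₁ es))) (proj₂ es))))
    where
    es : 0ℚ ≤ E α δ × 0ℚ ≤ E δ α
    es = Compat⇒ (RealRoot⇒RL rr) p (λ i → <⇒≤ (δ>0 i)) h

  module _ (C : Pred V 0ℓ) (maximal : MaximalCompatIn Φcre C) (compat-δ : ∀ {α} → C α → Compat α δ) where
    private
      tre : ∀ {α} → C α → ΦTre α
      tre cα = compat-δ⇒ΦTre (proj₁ maximal cα) (compat-δ cα)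

      tube : ∀ {α} → C α → IsTube α
      tube cα = tubeOf (tre cα)

      compat : ∀ {α β} → C α → C β → α ≢ β → 0ℚ ≤ E β α × ¬ Joint-full α β
      compat {α} {β} cα cβ ne = go (proj₁ (proj₂ maximal) α β cα cβ ne)
        where
        go : Compat α β → 0ℚ ≤ E β α × ¬ Joint-full α β
        go (inj₁ (tc , adj)) = ⊥-elim (tube-case-impossible tc adj)
        go (inj₂ (¬tc , h)) = proj₂ (Compat⇒ (IsTube.rl (tube cα)) (IsTube.ps (tube cα)) (proj₁ (IsTube.ps (tube cβ))) h) ,
          λ { (kα , kβ , (sα , eα) , (sβ , eβ) , j , full) → ¬tc
              (tre cα , tre cβ , suppOf kα , suppOf kβ , (kα , sα , eα , refl) ,
              (kβ , sβ , eβ , refl) , j , λ l sc → Subsetₚ.x∈p∪q⁺ (member (full l sc))) }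
          where
          member : ∀ {kα kβ l} → kα l ≢ 0ℚ ⊎ kβ l ≢ 0ℚ → l ∈ suppOf kα ⊎ l ∈ suppOf kβ
          member {kα} (inj₁ nz) = inj₁ (∈suppOf {kα} nz)
          member {kβ = kβ} (inj₂ nz) = inj₂ (∈suppOf {kβ} nz)

      module Ch = Choice C tube (λ {α} {β} → compat {α} {β})
      module Tg = Target Ch.Avoid Ch.choice Ch.avoid-imag

      -- With all positions avoided by `C`, `E b` kills `C`. A positive translate `b′` along δ is
      -- then compatible with `C` in both orders: one Euler value is 0 and the other nonnegative, so
      -- the maximum of their negatives is 0. Maximality puts `b′` into `C`, hence into a tube,
      -- although `g b′` is positive.
      extend : ∀ b → Conc b → (∀ l → E b (Pc l) ≢ 0ℚ → Ch.Avoid l) → ⊥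
      extend b cb ok = ¬u (proj₁ (proj₂ (proj₂ (tre (proj₂ (proj₂ maximal) D′ inj₁ D′⊆ D′-pw (inj₂ refl))))))
        where
        open Shift (D b)
        up = lift (Conc.rl cb) refl
        t = proj₁ up * κ
        b′ : V
        b′ = b ⊹ t ∙ δ
        rb : RL b′
        rb = proj₁ (proj₂ (proj₂ up))
        pb : Positive b′
        pb = proj₂ (proj₂ (proj₂ up))
        gb : 0ℚ < g b′
        gb = subst (0ℚ <_) (sym (g-δ b t)) (Conc.g>0 cb)
        ¬u : ¬ InU b′
        ¬u h = pos⇒≢0 gb (InU⇒ h)
        Eαb : ∀ {α} → C α → 0ℚ ≤ E α b′
        Eαb cα = E≥0 rb gb (IsTube.rl (tube cα)) (IsTube.ps (tube cα)) (IsTube.gz (tube cα))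
        Ebα : ∀ {α} → C α → E b′ α ≡ 0ℚ
        Ebα {α} cα = Eˡ b t δ α ■ cong₂ (λ x y → x + t * y) Eb0 (IsTube.gz (tube cα)) ■
            solve 1 (λ t → con 0ℚ :+ t :* con 0ℚ := con 0ℚ) refl t
          where
          open Expansion (Ch.exp cα)
          term : ∀ l → k l * E b (Pc l) ≡ 0ℚ
          term l with E b (Pc l) ≟ 0ℚ
          ... | yes z = cong (k l *_) z ■ *-zeroʳ (k l)
          ... | no nz = cong (_* E b (Pc l)) (ok l nz α cα k supp k-eq) ■ *-zeroˡ (E b (Pc l))
          Eb0 : E b α ≡ 0ℚ
          Eb0 = cong (E b) (sym k-eq) ■ E-lcʳ k Pc b ■ sum-cong {m} term ■ sum-0 m
        max0ˡ : ∀ {x y} → x ≡ 0ℚ → y ≤ 0ℚ → x ⊔ y ≡ 0ℚ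
        max0ˡ refl h = p≥q⇒p⊔q≡p h
        max0ʳ : ∀ {x y} → x ≤ 0ℚ → y ≡ 0ℚ → x ⊔ y ≡ 0ℚ
        max0ʳ h refl = p≤q⇒p⊔q≡q h
        neg-term : ∀ {x w} → RL w → 0ℚ ≤ x → - (x * inv (D w)) ≤ 0ℚ
        neg-term rw h = neg-≤0 (0≤* h (<⇒≤ (inv-pos (D>0 rw))))
        zero-term : ∀ {x} w → x ≡ 0ℚ → - (x * inv (D w)) ≡ 0ℚ
        zero-term w refl = cong -_ (*-zeroˡ (inv (D w)))
        b-α : ∀ {α} → C α → Compat b′ α
        b-α {α} cα = inj₂ ((λ tc → ¬u (proj₁ (proj₂ (proj₂ (proj₁ tc))))) , max0ˡ (compR≡ rb pb αn ■ zero-term b′ (Ebα cα))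
            (≤-trans (≤-reflexive (compL≡ rb pb αn)) (neg-term rb (Eαb cα))))
          where αn = proj₁ (IsTube.ps (tube cα))
        α-b : ∀ {α} → C α → Compat α b′
        α-b {α} cα = inj₂ ((λ tc → ¬u (proj₁ (proj₂ (proj₂ (proj₁ (proj₂ tc)))))) , max0ʳ
            (≤-trans (≤-reflexive (compR≡ rα (IsTube.ps (tube cα)) (proj₁ pb))) (neg-term rα (Eαb cα)))
            (compL≡ rα (IsTube.ps (tube cα)) (proj₁ pb) ■ zero-term α (Ebα cα)))
          where rα = IsTube.rl (tube cα)
        D′ : Pred V 0ℓ
        D′ v = C v ⊎ v ≡ b′
        D′⊆ : ∀ {v} → D′ v → Φcre v
        D′⊆ (inj₁ cv) = proj₁ maximal cv
        D′⊆ (inj₂ refl) = inj₂ (inj₁ (inj₁ (RL⇒RealRoot rb pb) , pb , ¬u)) , (λ e0 → D≢0 rb (cong D e0 ■ Dδ))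
        D′-pw : PairwiseCompat D′
        D′-pw x y (inj₁ cx) (inj₁ cy) ne = proj₁ (proj₂ maximal) x y cx cy ne
        D′-pw x y (inj₁ cx) (inj₂ refl) ne = α-b cx
        D′-pw x y (inj₂ refl) (inj₁ cy) ne = b-α cy
        D′-pw x y (inj₂ refl) (inj₂ refl) ne = ⊥-elim (ne refl)

    not-maximal : ⊥
    not-maximal = Tg.target (λ { (b , cb , ok) → extend b cb ok })

theorem5p5 : (n : ℕ) (A : Fin n → Fin n → ℤ) (d : Fin n → ℚ)
    (δ δv γ : Vec ℚ n) (m : ℕ) (P : Vec (Vec ℚ n) m) →
    let open Setup n A d δ δv γ m P in
    IsSymmetrizableCartan → IsAffine → IsDelta → IsDeltaCheck →
    IsGamma → IsΠc →
    (C : Pred (Vec ℚ n) 0ℓ) → C ⊆ Φc →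
    ((IsCluster C × ¬ C δ) ⇔ MaximalCompatIn Φcre C)
theorem5p5 n A d δ δv γ m P cartan affine isδ _ isγ isΠc C C⊆Φc = mk⇔ forward backward
  where
  open Setup n A d δ δv γ m P

  H : AffineData
  H = record { n = n ; A = A ; d = d ; δ = δ ; δv = δv ; γ = γ ; m = m ; P = P
             ; cartan = cartan ; affine = affine ; isδ = isδ ; isγ = isγ ; isΠc = isΠc }

  forward : IsCluster C × ¬ C δ → MaximalCompatIn Φcre C
  forward ((_ , pw , max) , δ∉C) =
    (λ {v} v∈C → C⊆Φc v∈C , λ v≡δ → δ∉C (subst C v≡δ v∈C)) , pw ,
    λ D C⊆D D⊆Φcre → max D C⊆D (proj₁ ∘ D⊆Φcre)

  backward : MaximalCompatIn Φcre C → IsCluster C × ¬ C δ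
  backward maximal@(C⊆ , pw , max) = (C⊆Φc , pw , max′) , δ∉C
    where
    δ∉C : ¬ C δ
    δ∉C δ∈C = proj₂ (C⊆ δ∈C) refl

    max′ : ∀ (D : Pred V 0ℓ) → C ⊆ D → D ⊆ Φc → PairwiseCompat D → D ⊆ C
    -- If δ belongs to `D`, every root of `C` is compatible with it, which `not-maximal` refutes.
    -- Any other element is absorbed by maximality applied to `D` with δ removed.
    max′ D C⊆D D⊆Φc pwD {v} v∈D with Vecₚ.≡-dec _≟_ v δ
    ... | yes refl = ⊥-elim (Compatibility.not-maximal H C maximal
            (λ {α} α∈C → pwD α δ (C⊆D α∈C) v∈D (λ α≡δ → δ∉C (subst C α≡δ α∈C))))
    ... | no v≢δ = max (λ x → D x × x ≢ δ)
            (λ {x} x∈C → C⊆D x∈C , λ x≡δ → δ∉C (subst C x≡δ x∈C))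
            (λ x∈ → D⊆Φc (proj₁ x∈) , proj₂ x∈)
            (λ x y x∈ y∈ → pwD x y (proj₁ x∈) (proj₁ y∈)) (v∈D , v≢δ)
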